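{- Let $q$ be a power of $2$ and let $M$ be a maximal arc of degree $d<q/2$ of Mathon type in $\mathrm{PG}(2,q)$, consisting of $d-1$ conics on a common nucleus $n$ (together with $n$). Let $C_d$ be a conic disjoint from $M$ with the same nucleus $n$. Then there is a unique maximal arc of degree $2d$ of Mathon type containing $M\cup C_d$.
   Context: Let $q$ be a power of $2$ and $\mathrm{Tr}:\mathrm{GF}(q)\to\mathrm{GF}(2)$ the absolute trace. A maximal arc of degree $d$ in $\mathrm{PG}(2,q)$ is a non-empty proper set of points meeting every line in $0$ or $d$ points; the trivial cases (a single point, or an affine plane $d=q$) are excluded. Conics are non-degenerate; for $q$ even the tangent lines of a conic all pass through a common point, its nucleus. For $\alpha,\beta,\lambda\in\mathrm{GF}(q)$ with $\mathrm{Tr}(\alpha\beta)=1$ let $F_{\alpha,\beta,\lambda}=\{(x,y,z):\alpha x^2+xy+\beta y^2+\lambda z^2=0\}$. For $\lambda\ne0$ this is a non-degenerate conic with nucleus $F_0=(0,0,1)$, and the line $z=0$ is external to it. For $\lambda\ne\lambda'$ define $F_{\alpha,\beta,\lambda}\oplus F_{\alpha',\beta',\lambda'}=F_{\alpha'',\beta'',\lambda''}$ with $\alpha''=\frac{\alpha\lambda+\alpha'\lambda'}{\lambda+\lambda'}$, $\beta''=\frac{\beta\lambda+\beta'\lambda'}{\lambda+\lambda'}$, $\lambda''=\lambda+\lambda'$. A set $\mathcal C$ of such conics ($\lambda\neq0$, distinct members having distinct $\lambda$) is closed if the composition of any two distinct members is again a member of $\mathcal C$ (in particular the parameters of the composition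 satisfy the trace condition). For closed $\mathcal C$ the union of the conics of $\mathcal C$ together with $F_0$ is a maximal arc of degree $|\mathcal C|+1$; a maximal arc which, after a change of coordinates of the plane, arises in this way from a non-empty closed set is called of Mathon type. -}

module Defs where

open import Algebra.Bundles using (CommutativeRing)
import Algebra.Properties.CommutativeMonoid.Sum as Sum
import Algebra.Properties.Semiring.Exp as Exp
open import Data.Fin.Base using (Fin; toℕ)
open import Data.Fin.Patterns using (0F; 1F; 2F)
open import Data.Nat.Base as ℕ using (ℕ; suc; NonZero)
open import Data.Product.Base using (∃; _×_; _,_; proj₁)
open import Data.Sum.Base using (_⊎_)
open import Data.Vec.Functional using (Vector; []; _∷_; zipWith; replicate)
import Data.Vec.Functional.Relation.Binary.Equality.Setoid as VectorEquality
open import Function.Bundles using (Inverse)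
open import Level using (Level; _⊔_) renaming (suc to lsuc)
open import Relation.Binary.Bundles using (Setoid)
import Relation.Binary.Construct.On as On
open import Relation.Binary.PropositionalEquality.Core using (_≡_; _≢_)
import Relation.Binary.PropositionalEquality.Properties as ≡
import Relation.Binary.Reasoning.Setoid as ≈-Reasoning
open import Relation.Binary.Definitions using (_Respects_)
open import Relation.Nullary.Negation.Core using (¬_)
open import Relation.Unary
  using (Pred; _∈_; _∉_; _≐_; _∪_; _∩_; _⊢_; ⋃; Empty; Satisfiable)

HasSize : ∀ {a ℓ} → Setoid a ℓ → ℕ → Set (a ⊔ ℓ)
HasSize S n = Inverse (≡.setoid (Fin n)) S

-- The field GF(2 ^ h).  The value 0# ⁻¹ is unconstrained.
record GaloisField₂ (h : ℕ) (c ℓ : Level) : Set (lsuc (c ⊔ ℓ)) where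
  field
    commutativeRing : CommutativeRing c ℓ
  open CommutativeRing commutativeRing public
  infix 8 _⁻¹
  field
    0≉1      : ¬ 0# ≈ 1#
    _⁻¹      : Carrier → Carrier
    ⁻¹-cong  : ∀ {x y} → x ≈ y → x ⁻¹ ≈ y ⁻¹
    inverseʳ : ∀ {x} → ¬ x ≈ 0# → x * x ⁻¹ ≈ 1#
    order    : HasSize setoid (2 ℕ.^ h)

module Plane {h : ℕ} {c ℓ : Level} (F : GaloisField₂ h c ℓ) where

  open GaloisField₂ F
  open Exp semiring using (_^_)
  open Sum +-commutativeMonoid using (sum; sum-cong-≋; sum-replicate-zero)
  open VectorEquality setoid using (_≋_; ≋-sym; ≋-trans)

  q : ℕ
  q = 2 ℕ.^ h

  infixl 7 _/_
  _/_ : Carrier → Carrier → Carrier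
  x / y = x * y ⁻¹

  Tr : Carrier → Carrier
  Tr x = sum {h} (λ i → x ^ (2 ℕ.^ toℕ i))

  Triple : Set c
  Triple = Vector Carrier 3

  0ᵥ : Triple
  0ᵥ = replicate 3 0#

  infixl 6 _+ᵥ_
  _+ᵥ_ : Triple → Triple → Triple
  _+ᵥ_ = zipWith _+_

  infixr 7 _*ᵥ_
  _*ᵥ_ : Carrier → Triple → Triple
  (k *ᵥ v) i = k * v i

  infix 7 _∙_
  _∙_ : Triple → Triple → Carrier
  u ∙ v = sum (zipWith _*_ u v)

  record Point : Set (c ⊔ ℓ) where
    constructor point
    field
      coords  : Triple
      nonzero : ¬ coords ≋ 0ᵥ
  open Point public

  infix 4 _∼_
  _∼_ : Point → Point → Set (c ⊔ ℓ)
  P ∼ Q = ∃ λ k → ¬ k ≈ 0# × coords P ≋ k *ᵥ coords Q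

  ∼-refl : ∀ {P} → P ∼ P
  ∼-refl = 1# , (λ 1≈0 → 0≉1 (sym 1≈0)) , λ i → sym (*-identityˡ _)

  ∼-sym : ∀ {P Q} → P ∼ Q → Q ∼ P
  ∼-sym {P} {Q} (k , k≉0 , P≋kQ) = k ⁻¹ , k⁻¹≉0 , Q≋k⁻¹P
    where
    open ≈-Reasoning setoid
    k⁻¹≉0 : ¬ k ⁻¹ ≈ 0#
    k⁻¹≉0 e = 0≉1 (begin
      0#        ≈⟨ zeroʳ k ⟨
      k * 0#    ≈⟨ *-congˡ e ⟨
      k * k ⁻¹  ≈⟨ inverseʳ k≉0 ⟩
      1#        ∎)
    Q≋k⁻¹P : coords Q ≋ k ⁻¹ *ᵥ coords P
    Q≋k⁻¹P i = begin
      coords Q i                ≈⟨ *-identityˡ _ ⟨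
      1# * coords Q i           ≈⟨ *-congʳ (inverseʳ k≉0) ⟨
      k * k ⁻¹ * coords Q i     ≈⟨ *-congʳ (*-comm k _) ⟩
      k ⁻¹ * k * coords Q i     ≈⟨ *-assoc _ _ _ ⟩
      k ⁻¹ * (k * coords Q i)   ≈⟨ *-congˡ (P≋kQ i) ⟨
      k ⁻¹ * coords P i         ∎

  ∼-trans : ∀ {P Q R} → P ∼ Q → Q ∼ R → P ∼ R
  ∼-trans {P} {Q} {R} (k , k≉0 , P≋kQ) (m , m≉0 , Q≋mR) =
    k * m , km≉0 , λ i →
      trans (P≋kQ i) (trans (*-congˡ (Q≋mR i)) (sym (*-assoc k m _)))
    where
    km≉0 : ¬ k * m ≈ 0#
    km≉0 e = nonzero P λ i →
      trans (P≋kQ i) (trans (*-congˡ (Q≋mR i))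
        (trans (sym (*-assoc k m _)) (trans (*-congʳ e) (zeroˡ _))))

  pointSetoid : Setoid (c ⊔ ℓ) (c ⊔ ℓ)
  pointSetoid = record
    { Carrier       = Point
    ; _≈_           = _∼_
    ; isEquivalence = record
      { refl  = λ {P} → ∼-refl {P}
      ; sym   = λ {P} {Q} → ∼-sym {P} {Q}
      ; trans = λ {P} {Q} {R} → ∼-trans {P} {Q} {R}
      }
    }

  PointSet : Set (lsuc (c ⊔ ℓ))
  PointSet = Pred Point (c ⊔ ℓ)

  HasCardinality : ∀ {p} → Pred Point p → ℕ → Set (c ⊔ ℓ ⊔ p)
  HasCardinality S n = HasSize (On.setoid {B = ∃ S} pointSetoid proj₁) n

  -- The line u₀x + u₁y + u₂z = 0 is given by its dual coordinates (u₀, u₁, u₂).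
  Line : Set (c ⊔ ℓ)
  Line = Point

  on : Line → Pred Point ℓ
  on L P = coords L ∙ coords P ≈ 0#

  Matrix : Set c
  Matrix = Fin 3 → Triple

  apply : Matrix → Triple → Triple
  apply A v i = A i ∙ v

  -- A ∈ GL₃(q); changes of coordinates of the plane are the maps P ↦ A P.
  record Invertible : Set (c ⊔ ℓ) where
    field
      matrix   : Matrix
      inverse  : Matrix
      inverseₗ : ∀ v → apply inverse (apply matrix v) ≋ v
      inverseᵣ : ∀ v → apply matrix (apply inverse v) ≋ v
  open Invertible public

  ∙-0ᵥ : ∀ u {v} → v ≋ 0ᵥ → u ∙ v ≈ 0#
  ∙-0ᵥ u v≋0 =
    trans (sum-cong-≋ (λ i → trans (*-congˡ (v≋0 i)) (zeroʳ (u i))))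
          (sum-replicate-zero 3)

  transform : Invertible → Point → Point
  transform A (point v v≉0) = point (apply (matrix A) v) λ Av≋0 →
    v≉0 (≋-trans (≋-sym (inverseₗ A v)) (λ i → ∙-0ᵥ (inverse A i) Av≋0))

  -- The fields are the coefficients of the respective monomials.
  record QuadraticForm : Set c where
    constructor quadraticForm
    field
      x² y² z² yz xz xy : Carrier

  eval : QuadraticForm → Triple → Carrier
  eval (quadraticForm a₁ a₂ a₃ b₁ b₂ b₃) v =
    a₁ * (x * x) + a₂ * (y * y) + a₃ * (z * z) + b₁ * (y * z) + b₂ * (x * z) + b₃ * (x * y)
    where
    x = v 0F
    y = v 1F
    z = v 2F

  polar : QuadraticForm → Triple → Triple → Carrier
  polar Q v w = eval Q (v +ᵥ w) - eval Q v - eval Q w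

  zeros : QuadraticForm → Pred Point ℓ
  zeros Q P = eval Q (coords P) ≈ 0#

  -- The radical of the polar form contains no singular point.  The polar form
  -- itself is alternating, hence always singular, in characteristic 2.
  Nondegenerate : QuadraticForm → Set (c ⊔ ℓ)
  Nondegenerate Q =
    ∀ P → (∀ w → polar Q (coords P) w ≈ 0#) → P ∉ zeros Q

  IsConic : ∀ {p} → Pred Point p → Set (c ⊔ ℓ ⊔ p)
  IsConic K = ∃ λ Q → Nondegenerate Q × K ≐ zeros Q

  IsTangent : ∀ {p} → Line → Pred Point p → Set (c ⊔ ℓ ⊔ p)
  IsTangent L K = HasCardinality (K ∩ on L) 1

  IsNucleus : ∀ {p} → Point → Pred Point p → Set (c ⊔ ℓ ⊔ p)
  IsNucleus n K = ∀ L → IsTangent L K → n ∈ on L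

  record IsMaximalArc (d : ℕ) (M : PointSet) : Set (c ⊔ ℓ) where
    field
      respects       : M Respects _∼_
      nonempty       : Satisfiable M
      proper         : ∃ λ P → P ∉ M
      intersections  : ∀ L → Empty (M ∩ on L) ⊎ HasCardinality (M ∩ on L) d
      notSinglePoint : d ≢ 1
      notAffinePlane : d ≢ q

  record ConicParameters : Set c where
    constructor params
    field
      α β lam : Carrier
  open ConicParameters public

  infix 4 _≈ₚ_
  _≈ₚ_ : ConicParameters → ConicParameters → Set ℓ
  s ≈ₚ t = α s ≈ α t × β s ≈ β t × lam s ≈ lam t

  infixl 6 _⊕_
  _⊕_ : ConicParameters → ConicParameters → ConicParameters
  params a b l ⊕ params a′ b′ l′ =
    params ((a * l + a′ * l′) / (l + l′)) ((b * l + b′ * l′) / (l + l′)) (l + l′)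

  F⟨_⟩ : ConicParameters → Pred Point ℓ
  F⟨ params a b l ⟩ = zeros (quadraticForm a b l 0# 0# 1#)

  F₀ : Point
  F₀ = point (0# ∷ 0# ∷ 1# ∷ []) λ e → 0≉1 (sym (e 2F))

  -- A closed set of exactly k conics, enumerated without repetition.
  record ClosedSet (k : ℕ) : Set (c ⊔ ℓ) where
    field
      member        : Fin k → ConicParameters
      trace         : ∀ i → Tr (α (member i) * β (member i)) ≈ 1#
      lam≉0         : ∀ i → ¬ lam (member i) ≈ 0#
      lam-injective : ∀ {i j} → lam (member i) ≈ lam (member j) → i ≡ j
      closed        : ∀ {i j} → i ≢ j → ∃ λ l → member i ⊕ member j ≈ₚ member l

  record IsMathonArc (d : ℕ) (M : PointSet) : Set (c ⊔ ℓ) where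
    field
      isMaximalArc : IsMaximalArc d M
      size         : ℕ
      size-nonZero : NonZero size
      degree       : d ≡ suc size
      closedSet    : ClosedSet size
      coordinates  : Invertible

    conic : Fin size → Pred Point ℓ
    conic i = transform coordinates ⊢ F⟨ ClosedSet.member closedSet i ⟩

    field
      decomposition :
        M ≐ ⋃ (Fin size) conic ∪ (transform coordinates ⊢ (_∼ F₀))

{-# OPTIONS --safe #-}
                                                                                  
                                                                                    
                                                                                  
                                                                                 
                                                                                 
                                                                         
                                                                                
                                                                                  
                                                                               
                                                                             
          
module Submission where

open import Defs
open import Algebra.Bundles using (CommutativeRing)
import Algebra.Properties.CommutativeMonoid.Sum as MonoidSum
import Algebra.Properties.Ring as RingProperties
import Algebra.Properties.Semiring.Exp as Exp
import Algebra.Properties.Semiring.Mult as Mult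
import Algebra.Solver.Ring as RingSolver
open import Algebra.Solver.Ring.AlmostCommutativeRing
  using (fromCommutativeRing; _-Raw-AlmostCommutative⟶_)
open import Data.Bool.Base using (Bool; true; false)
open import Data.Bool.Properties using (xor-∧-commutativeRing)
open import Data.Empty using (⊥-elim) renaming (⊥ to False)
open import Data.Fin.Base using (Fin; zero; suc; toℕ; punchIn; punchOut; combine; remQuot)
import Data.Fin.Base as Fin using (_<_)
open import Data.Fin.Patterns using (0F; 1F; 2F)
open import Data.Fin.Permutation using (Permutation; permutation; _⟨$⟩ʳ_)
import Data.Fin.Properties as Fin
open import Data.Maybe.Base using (Maybe; just; nothing)
open import Data.Nat.Base using (ℕ; zero; suc)
import Data.Nat.Base as ℕ
import Data.Nat.Properties as ℕ
open import Data.Product using (∃; ∃₂; ∃!; _×_; _,_; proj₁; proj₂)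
open import Data.Sum as Sum using (_⊎_; inj₁; inj₂)
open import Data.Vec.Functional using ([]; _∷_)
open import Function using (_∘_; Inverse)
open import Level using (Level; _⊔_)
open import Relation.Binary using (Decidable)
open import Relation.Binary.PropositionalEquality as ≡ using (_≡_; _≢_)
import Relation.Binary.Reasoning.Setoid as ≈-Reasoning
open import Relation.Nullary
  using (¬_; Dec; yes; no; ¬?; _×-dec_; _⊎-dec_; recompute; toSum)
open import Relation.Nullary.Decidable using (map′; decidable-stable)
open import Relation.Unary
  using (Pred; _∈_; _∉_; _∩_; _∪_; _≐_; _⊢_; _⊆_; _⊥_; Empty)

-- Multiplied by λ, the equation of a conic becomes a x² + λ x y + b y² + λ² z² = 0 with a = αλ and
-- b = βλ. Composition of conics is now addition of the triples (a, b, λ), and since λ ↦ λ² is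
-- additive the polynomials themselves add. A closed set together with the zero triple is therefore
-- an elementary abelian 2-group (`Pencil`) on which λ is injective and whose nonzero members
-- satisfy Tr(ab/λ²) = 1.
--
-- On a line z = u x + v y such a polynomial restricts to λ (A x² + x y + B y²), and this binary
-- form has a nontrivial zero exactly when Tr(AB) = 0. Here Tr(AB) = Tr(ab/λ²) + φ with φ = Tr(a v²
-- + b u² + λ u v). So under the trace condition the line is a secant of the conic when φ = 1 and
-- misses it when φ = 0. What matters is that φ is a homomorphism from the group to GF(2). Moreover,
-- through a point other than `F₀` and off all conics, the lines realise every such homomorphism as
-- φ (`lineThrough`): within the lines through the point, φ varies by Tr(t² ψ) with ψ the value of
-- the polynomial at the point, and the trace pairing is nondegenerate.
--
-- Existence. Having the same nucleus, C has an equation of the same shape, with a triple (a′, b′,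
-- λ′); but the line z = 0 may be a secant of C. Disjointness from M forces λ′ outside the group of
-- old λ, and forces all members of the coset of C to have the same trace τ′. Because 2d < q, some
-- point of z = 0 lies on no conic of the group generated by M and C. Through it goes a line with φ
-- = 0 on the old group and φ = 1 + τ′ on the coset; shearing this line to z = 0 makes every trace
-- equal to 1, and the sheared group gives the arc N.
--
-- Uniqueness. Taking φ = 0 in `lineThrough`, every point off a Mathon arc lies on a line external
-- to it. Let N′ be a Mathon arc of degree 2d containing M and C. A point of N outside N′ would lie
-- on a line missing N′, hence missing M and C; its φ vanishes on generators of the group of N, so
-- it misses N, a contradiction. Thus N lies in N′, and equality of the degrees gives equality of
-- the arcs.

-- Arithmetic of GF(2^h): characteristic, Frobenius, trace, Artin-Schreier equations.

module FiniteField {h : ℕ} {c ℓ : Level} (F : GaloisField₂ h c ℓ) where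

  open GaloisField₂ F public hiding (zero)
  open Plane F using (q)
  open ≈-Reasoning setoid
  private module O = Inverse order

  infix 4 _≟_
  _≟_ : Decidable _≈_
  x ≟ y with O.from x Fin.≟ O.from y
  ... | yes e = yes (trans (sym (O.strictlyInverseˡ x)) (trans (O.to-cong e) (O.strictlyInverseˡ y)))
  ... | no ne = no (λ e → ne (O.from-cong e))

  1≉0 : ¬ 1# ≈ 0#
  1≉0 = 0≉1 ∘ sym

  inverseˡ : ∀ {x} → ¬ x ≈ 0# → x ⁻¹ * x ≈ 1#
  inverseˡ x≉0 = trans (*-comm _ _) (inverseʳ x≉0)

  cancel : ∀ {x y} → ¬ x ≈ 0# → x * y ≈ 0# → y ≈ 0#
  cancel {x} {y} x≉0 e = begin
    y               ≈⟨ *-identityˡ y ⟨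
    1# * y          ≈⟨ *-congʳ (inverseˡ x≉0) ⟨
    x ⁻¹ * x * y    ≈⟨ *-assoc _ _ _ ⟩
    x ⁻¹ * (x * y)  ≈⟨ *-congˡ e ⟩
    x ⁻¹ * 0#       ≈⟨ zeroʳ _ ⟩
    0#              ∎

  product≉0 : ∀ {x y} → ¬ x ≈ 0# → ¬ y ≈ 0# → ¬ x * y ≈ 0#
  product≉0 x≉0 y≉0 e = y≉0 (cancel x≉0 e)

  noZeroDivisors : ∀ {x y} → x * y ≈ 0# → x ≈ 0# ⊎ y ≈ 0#
  noZeroDivisors {x} e with x ≟ 0#
  ... | yes x≈0 = inj₁ x≈0
  ... | no x≉0 = inj₂ (cancel x≉0 e)

  square≈0 : ∀ {x} → x * x ≈ 0# → x ≈ 0#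
  square≈0 e with noZeroDivisors e
  ... | inj₁ p = p
  ... | inj₂ p = p

  ⁻¹≉0 : ∀ {x} → ¬ x ≈ 0# → ¬ x ⁻¹ ≈ 0#
  ⁻¹≉0 x≉0 e = 0≉1 (trans (sym (zeroʳ _)) (trans (*-congˡ (sym e)) (inverseʳ x≉0)))

  elements : Fin q → Carrier
  elements = O.to

  index : Carrier → Fin q
  index = O.from

  elements-injective : ∀ {i j} → elements i ≈ elements j → i ≡ j
  elements-injective e = ≡.trans (≡.sym (O.strictlyInverseʳ _)) (≡.trans (O.from-cong e) (O.strictlyInverseʳ _))

  elements-index : ∀ x → elements (index x) ≈ x
  elements-index = O.strictlyInverseˡ

  bijection⇒permutation : (f g : Carrier → Carrier) →
    (∀ {x y} → x ≈ y → f x ≈ f y) → (∀ {x y} → x ≈ y → g x ≈ g y) →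
    (∀ x → f (g x) ≈ x) → (∀ x → g (f x) ≈ x) → Permutation q q
  bijection⇒permutation f g f-cong g-cong fg gf = permutation
    (λ i → index (f (elements i))) (λ i → index (g (elements i)))
    (λ i → ≡.trans (O.from-cong (trans (f-cong (elements-index _)) (fg _))) (O.strictlyInverseʳ i))
    (λ i → ≡.trans (O.from-cong (trans (g-cong (elements-index _)) (gf _))) (O.strictlyInverseʳ i))

  private
    open RingProperties ring using (+-cancelˡ)
    module + = MonoidSum +-commutativeMonoid
    module × = MonoidSum *-commutativeMonoid
    open Exp semiring using (_^_; ^-congˡ; ^-assocʳ)

    2^m : ∀ m → +.sum {2 ℕ.^ m} (λ _ → 1#) ≈ (1# + 1#) ^ m
    2^m m = trans (+.sum-replicate (2 ℕ.^ m)) (go m)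
      where
      open Mult semiring using (×1-homo-*) renaming (_×_ to _×ₙ_)
      go : ∀ m → (2 ℕ.^ m) ×ₙ 1# ≈ (1# + 1#) ^ m
      go zero = +-identityʳ 1#
      go (suc m) = begin
        (2 ℕ.* 2 ℕ.^ m) ×ₙ 1#            ≈⟨ ×1-homo-* 2 (2 ℕ.^ m) ⟩
        (2 ×ₙ 1#) * ((2 ℕ.^ m) ×ₙ 1#)    ≈⟨ *-cong (+-congˡ (+-identityʳ 1#)) (go m) ⟩
        (1# + 1#) * (1# + 1#) ^ m        ∎

    power≈0 : ∀ {x} m → x ^ m ≈ 0# → x ≈ 0#
    power≈0 zero e = ⊥-elim (1≉0 e)
    power≈0 (suc m) e with noZeroDivisors e
    ... | inj₁ p = p
    ... | inj₂ p = power≈0 m p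

                                                                            
                  
  -- Translation by 1 permutes the field, so the sum of all elements is unchanged by adding q copies
  -- of 1. Hence (1 + 1)^h = 0, and a field has no nilpotents.
  1+1≈0 : 1# + 1# ≈ 0#
  1+1≈0 = power≈0 h (trans (sym (2^m h)) (+-cancelˡ S _ _ (begin
    S + +.sum {q} (λ _ → 1#)                    ≈⟨ +.∑-distrib-+ elements (λ _ → 1#) ⟨
    +.sum (λ i → elements i + 1#)               ≈⟨ +.sum-cong-≋ {q} (λ i → sym (elements-index (elements i + 1#))) ⟩
    +.sum (λ i → elements (π ⟨$⟩ʳ i))           ≈⟨ +.sum-permute elements π ⟨
    S                                           ≈⟨ +-identityʳ S ⟨
    S + 0#                                      ∎)))
    where
    S = +.sum elements
    π = bijection⇒permutation (_+ 1#) (_- 1#) +-congʳ +-congʳ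
      (λ x → trans (+-assoc _ _ _) (trans (+-congˡ (-‿inverseˡ 1#)) (+-identityʳ x)))
      (λ x → trans (+-assoc _ _ _) (trans (+-congˡ (-‿inverseʳ 1#)) (+-identityʳ x)))

  private
    module B = CommutativeRing xor-∧-commutativeRing

    ⟦_⟧₂ : Bool → Carrier
    ⟦ false ⟧₂ = 0#
    ⟦ true ⟧₂ = 1#

    homomorphism : B.rawRing -Raw-AlmostCommutative⟶ fromCommutativeRing commutativeRing
    homomorphism = record
      { ⟦_⟧    = ⟦_⟧₂
      ; +-homo = λ { false y → sym (+-identityˡ _)
                   ; true false → sym (+-identityʳ _)
                   ; true true → sym 1+1≈0 }
      ; *-homo = λ { false y → sym (zeroˡ _) ; true y → sym (*-identityˡ _) }
      ; -‿homo = λ { false → sym (trans (sym (+-identityˡ _)) (-‿inverseʳ 0#))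
                   ; true → +-cancelˡ 1# _ _ (trans 1+1≈0 (sym (-‿inverseʳ 1#))) }
      ; 0-homo = refl
      ; 1-homo = refl
      }

    _≟₂_ : ∀ x y → Maybe (⟦ x ⟧₂ ≈ ⟦ y ⟧₂)
    false ≟₂ false = just refl
    true ≟₂ true = just refl
    _ ≟₂ _ = nothing

                                                        
  -- Coefficients are taken in GF(2), so that the solver proves identities special to characteristic
  -- 2, such as x + x = 0.
  module Char2Solver = RingSolver B.rawRing (fromCommutativeRing commutativeRing) homomorphism _≟₂_
  open Char2Solver using (solve; _:=_; _:+_; _:*_; con)

  x+x≈0 : ∀ x → x + x ≈ 0#
  x+x≈0 = solve 1 (λ x → x :+ x := con false) refl

  x+y≈0⇒x≈y : ∀ {x y} → x + y ≈ 0# → x ≈ y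
  x+y≈0⇒x≈y {x} {y} e = begin
    x           ≈⟨ solve 2 (λ x y → x := (x :+ y) :+ y) refl x y ⟩
    x + y + y   ≈⟨ +-congʳ e ⟩
    0# + y      ≈⟨ +-identityˡ y ⟩
    y           ∎

  x≈y⇒x+y≈0 : ∀ {x y} → x ≈ y → x + y ≈ 0#
  x≈y⇒x+y≈0 {x} {y} e = trans (+-congʳ e) (x+x≈0 y)

  private
    single : ∀ {n} (w : Fin n → Carrier) i → (∀ j → j ≢ i → w j ≈ 1#) → ×.sum w ≈ w i
    single {suc n} w zero w≈1 = trans (*-congˡ (trans (×.sum-cong-≋ (λ j → w≈1 (suc j) λ ()))
      (×.sum-replicate-zero n))) (*-identityʳ _)
    single {suc n} w (suc i) w≈1 = trans (*-congʳ (w≈1 zero λ ())) (trans (*-identityˡ _)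
      (single (w ∘ suc) i λ j j≢i → w≈1 (suc j) (j≢i ∘ Fin.suc-injective)))

    product-≉0 : ∀ {n} (w : Fin n → Carrier) → (∀ i → ¬ w i ≈ 0#) → ¬ ×.sum w ≈ 0#
    product-≉0 {zero} w w≉0 = 1≉0
    product-≉0 {suc n} w w≉0 = product≉0 (w≉0 zero) (product-≉0 (w ∘ suc) (w≉0 ∘ suc))

                                                                               
                                                                         
  -- Multiplication by a nonzero x permutes the field; the products of all elements before and after
  -- are compared.
  x^q≈x : ∀ x → x ^ q ≈ x
  x^q≈x x with x ≟ 0#
  ... | yes x≈0 = trans (^-congˡ q x≈0) (trans (0^ (2 ℕ.^ h) {{ℕ.m^n≢0 2 h}}) (sym x≈0))
    where
    0^ : ∀ n .{{_ : ℕ.NonZero n}} → 0# ^ n ≈ 0#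
    0^ (suc n) = zeroˡ _
  ... | no x≉0 = x+y≈0⇒x≈y (cancel P≉0 (begin
    P * (x ^ q + x)      ≈⟨ solve 3 (λ p y x → p :* (y :+ x) := y :* p :+ x :* p) refl P _ x ⟩
    x ^ q * P + x * P    ≈⟨ x≈y⇒x+y≈0 x^qP≈xP ⟩
    0#                   ∎))
    where
    -- `f` replaces 0 by 1, which keeps the product over the whole field nonzero. `w` corrects the
    -- factor at 0 and is the source of the single x in x^q P = x P.
    f w : Carrier → Carrier
    f y with y ≟ 0#
    ... | yes _ = 1#
    ... | no _ = y
    w y with y ≟ 0#
    ... | yes _ = x
    ... | no _ = 1#
    f-cong : ∀ {y z} → y ≈ z → f y ≈ f z
    f-cong {y} {z} e with y ≟ 0# | z ≟ 0#
    ... | yes _ | yes _ = refl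
    ... | yes p | no q = ⊥-elim (q (trans (sym e) p))
    ... | no p | yes q = ⊥-elim (p (trans e q))
    ... | no _ | no _ = e
    f≉0 : ∀ y → ¬ f y ≈ 0#
    f≉0 y with y ≟ 0#
    ... | yes _ = 1≉0
    ... | no y≉0 = y≉0
    shift : ∀ y → x * f y ≈ w y * f (x * y)
    shift y with y ≟ 0# | x * y ≟ 0#
    ... | yes _ | yes _ = refl
    ... | yes p | no q = ⊥-elim (q (trans (*-congˡ p) (zeroʳ x)))
    ... | no p | yes q = ⊥-elim (product≉0 x≉0 p q)
    ... | no _ | no _ = sym (*-identityˡ _)
    w-0 : w (elements (index 0#)) ≈ x
    w-0 with elements (index 0#) ≟ 0#
    ... | yes _ = refl
    ... | no p = ⊥-elim (p (elements-index 0#))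
    w-≢ : ∀ j → j ≢ index 0# → w (elements j) ≈ 1#
    w-≢ j j≢ with elements j ≟ 0#
    ... | yes p = ⊥-elim (j≢ (≡.trans (≡.sym (O.strictlyInverseʳ j)) (O.from-cong p)))
    ... | no _ = refl
    π = bijection⇒permutation (x *_) (x ⁻¹ *_) *-congˡ *-congˡ
      (λ y → trans (sym (*-assoc _ _ _)) (trans (*-congʳ (inverseʳ x≉0)) (*-identityˡ y)))
      (λ y → trans (sym (*-assoc _ _ _)) (trans (*-congʳ (inverseˡ x≉0)) (*-identityˡ y)))
    P = ×.sum (f ∘ elements)
    P≉0 : ¬ P ≈ 0#
    P≉0 = product-≉0 {q} (f ∘ elements) (λ i → f≉0 (elements i))
    x^qP≈xP : x ^ q * P ≈ x * P
    x^qP≈xP = begin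
      x ^ q * P                                             ≈⟨ *-congʳ (×.sum-replicate q) ⟨
      ×.sum {q} (λ _ → x) * P                               ≈⟨ ×.∑-distrib-+ {q} (λ _ → x) (f ∘ elements) ⟨
      ×.sum (λ i → x * f (elements i))                      ≈⟨ ×.sum-cong-≋ (λ i → shift (elements i)) ⟩
      ×.sum (λ i → w (elements i) * f (x * elements i))     ≈⟨ ×.∑-distrib-+ (w ∘ elements) _ ⟩
      ×.sum (w ∘ elements) * ×.sum (λ i → f (x * elements i))
        ≈⟨ *-cong (trans (single {q} (w ∘ elements) (index 0#) w-≢) w-0)
             (×.sum-cong-≋ {q} (λ i → f-cong (sym (elements-index (x * elements i))))) ⟩
      x * ×.sum (λ i → f (elements (π ⟨$⟩ʳ i)))             ≈⟨ *-congˡ (×.sum-permute (f ∘ elements) π) ⟨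
      x * P                                                 ∎

                                                         
  -- These are x^(2^n) and the partial trace x + x² + x⁴ + ... with n terms. Recursion on the
  -- squared argument allows inductions without exponent arithmetic.
  frob T : ℕ → Carrier → Carrier
  frob zero x = x
  frob (suc n) x = frob n (x * x)
  T zero x = 0#
  T (suc n) x = x + T n (x * x)

  frob-cong : ∀ n {x y} → x ≈ y → frob n x ≈ frob n y
  frob-cong zero e = e
  frob-cong (suc n) e = frob-cong n (*-cong e e)

  T-cong : ∀ n {x y} → x ≈ y → T n x ≈ T n y
  T-cong zero e = refl
  T-cong (suc n) e = +-cong e (T-cong n (*-cong e e))

  T-+ : ∀ n x y → T n (x + y) ≈ T n x + T n y
  T-+ zero x y = sym (+-identityˡ 0#)
  T-+ (suc n) x y = begin
    x + y + T n ((x + y) * (x + y))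
      ≈⟨ +-congˡ (T-cong n (solve 2 (λ x y → (x :+ y) :* (x :+ y) := x :* x :+ y :* y) refl x y)) ⟩
    x + y + T n (x * x + y * y)            ≈⟨ +-congˡ (T-+ n _ _) ⟩
    x + y + (T n (x * x) + T n (y * y))
      ≈⟨ solve 4 (λ x y s t → x :+ y :+ (s :+ t) := x :+ s :+ (y :+ t)) refl x y _ _ ⟩
    x + T n (x * x) + (y + T n (y * y))    ∎

  T-square : ∀ n x → T n x * T n x ≈ T n (x * x)
  T-square zero x = zeroˡ 0#
  T-square (suc n) x = begin
    (x + T n (x * x)) * (x + T n (x * x))
      ≈⟨ solve 2 (λ x t → (x :+ t) :* (x :+ t) := x :* x :+ t :* t) refl x _ ⟩
    x * x + T n (x * x) * T n (x * x)       ≈⟨ +-congˡ (T-square n (x * x)) ⟩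
    x * x + T n (x * x * (x * x))           ∎

  frob-square : ∀ n x → frob n x * frob n x ≈ frob n (x * x)
  frob-square zero x = refl
  frob-square (suc n) x = frob-square n (x * x)

  T-last : ∀ n x → T (suc n) x ≈ T n x + frob n x
  T-last zero x = +-comm x 0#
  T-last (suc n) x = trans (+-congˡ (T-last n (x * x))) (sym (+-assoc _ _ _))

  frob-pow : ∀ n x → frob n x ≈ x ^ (2 ℕ.^ n)
  frob-pow zero x = sym (*-identityʳ x)
  frob-pow (suc n) x = begin
    frob n (x * x)                ≈⟨ frob-pow n (x * x) ⟩
    (x * x) ^ (2 ℕ.^ n)        ≈⟨ ^-congˡ (2 ℕ.^ n) (*-congˡ (*-identityʳ x)) ⟨
    (x ^ 2) ^ (2 ℕ.^ n)        ≈⟨ ^-assocʳ x 2 (2 ℕ.^ n) ⟩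
    x ^ (2 ℕ.^ suc n)          ∎

  frob-h : ∀ x → frob h x ≈ x
  frob-h x = trans (frob-pow h x) (x^q≈x x)

  open Plane F using (Tr)

  Tr≈T : ∀ x → Tr x ≈ T h x
  Tr≈T x = trans (+.sum-cong-≋ {h} (λ i → sym (frob-pow (toℕ i) x))) (go h x)
    where
    go : ∀ n x → +.sum {n} (λ i → frob (toℕ i) x) ≈ T n x
    go zero x = refl
    go (suc n) x = +-congˡ (go n (x * x))

  Tr-cong : ∀ {x y} → x ≈ y → Tr x ≈ Tr y
  Tr-cong e = trans (Tr≈T _) (trans (T-cong h e) (sym (Tr≈T _)))

  Tr-+ : ∀ x y → Tr (x + y) ≈ Tr x + Tr y
  Tr-+ x y = trans (Tr≈T _) (trans (T-+ h x y) (+-cong (sym (Tr≈T x)) (sym (Tr≈T y))))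

  Tr-0 : Tr 0# ≈ 0#
  Tr-0 = x+y≈0⇒x≈y (trans (+-congˡ (sym (x+x≈0 _))) (trans (sym (+-assoc _ _ _))
    (trans (+-congʳ (trans (sym (Tr-+ 0# 0#)) (Tr-cong (+-identityˡ 0#)))) (x+x≈0 _))))

  -- Squaring permutes the summands cyclically, because x^q = x closes the cycle.
  Tr-square : ∀ x → Tr (x * x) ≈ Tr x
  Tr-square x = trans (Tr≈T _) (trans (sym e) (sym (Tr≈T x)))
    where
    e : T h x ≈ T h (x * x)
    e = x+y≈0⇒x≈y (begin
      T h x + T h (x * x)              ≈⟨ solve 3 (λ x s t → s :+ t := x :+ s :+ (x :+ t)) refl x _ _ ⟩
      x + T h x + (x + T h (x * x))    ≈⟨ +-cong (+-comm _ _) (trans (T-last h x) (+-congˡ (frob-h x))) ⟩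
      T h x + x + (T h x + x)          ≈⟨ x+x≈0 _ ⟩
      0#                               ∎)

  Bit : Carrier → Set ℓ
  Bit x = x ≈ 0# ⊎ x ≈ 1#

  idempotent⇒bit : ∀ {x} → x * x ≈ x → Bit x
  idempotent⇒bit {x} e with noZeroDivisors (trans
    (solve 1 (λ x → x :* (x :+ con true) := x :* x :+ x) refl x) (x≈y⇒x+y≈0 e))
  ... | inj₁ p = inj₁ p
  ... | inj₂ p = inj₂ (x+y≈0⇒x≈y p)

  Tr-bit : ∀ x → Bit (Tr x)
  Tr-bit x = idempotent⇒bit (trans (*-cong (Tr≈T x) (Tr≈T x)) (trans (T-square h x)
    (trans (sym (Tr≈T _)) (Tr-square x))))

  bit-≉0 : ∀ {x} → Bit x → ¬ x ≈ 0# → x ≈ 1#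
  bit-≉0 (inj₁ p) x≉0 = ⊥-elim (x≉0 p)
  bit-≉0 (inj₂ p) x≉0 = p

  bit-+ : ∀ {x y} → Bit x → Bit y → Bit (x + y)
  bit-+ (inj₁ p) (inj₁ r) = inj₁ (trans (+-cong p r) (+-identityˡ 0#))
  bit-+ (inj₁ p) (inj₂ r) = inj₂ (trans (+-cong p r) (+-identityˡ 1#))
  bit-+ (inj₂ p) (inj₁ r) = inj₂ (trans (+-cong p r) (+-identityʳ 1#))
  bit-+ (inj₂ p) (inj₂ r) = inj₁ (trans (+-cong p r) 1+1≈0)

  bit-≉1 : ∀ {x} → Bit x → ¬ x ≈ 1# → x ≈ 0#
  bit-≉1 (inj₁ p) x≉1 = p
  bit-≉1 (inj₂ p) x≉1 = ⊥-elim (x≉1 p)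

  bit-≉ : ∀ {x y} → Bit x → Bit y → ¬ x ≈ y → x + y ≈ 1#
  bit-≉ (inj₁ p) (inj₁ r) n = ⊥-elim (n (trans p (sym r)))
  bit-≉ (inj₁ p) (inj₂ r) n = trans (+-cong p r) (+-identityˡ 1#)
  bit-≉ (inj₂ p) (inj₁ r) n = trans (+-cong p r) (+-identityʳ 1#)
  bit-≉ (inj₂ p) (inj₂ r) n = ⊥-elim (n (trans p (sym r)))

  sqrt : ∀ x → ∃ λ y → y * y ≈ x
  sqrt x = go h ≡.refl (frob-h x)
    where
    singleton : ∀ {n} → n ≡ 1 → (i j : Fin n) → i ≡ j
    singleton ≡.refl zero zero = ≡.refl
    go : ∀ n → n ≡ h → frob n x ≈ x → ∃ λ y → y * y ≈ x
    -- The root is x^(2^(h-1)); the case h = 0 is void, as the field would have a single element.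
    go zero e _ = ⊥-elim (0≉1 (begin
      0#                    ≈⟨ elements-index 0# ⟨
      elements (index 0#)   ≡⟨ ≡.cong elements (singleton (≡.cong (2 ℕ.^_) (≡.sym e)) _ _) ⟩
      elements (index 1#)   ≈⟨ elements-index 1# ⟩
      1#                    ∎))
    go (suc n) _ e = frob n x , trans (frob-square n x) e

  square-injective : ∀ {x y} → x * x ≈ y * y → x ≈ y
  square-injective {x} {y} e = x+y≈0⇒x≈y (square≈0 (trans
    (solve 2 (λ x y → (x :+ y) :* (x :+ y) := x :* x :+ y :* y) refl x y) (x≈y⇒x+y≈0 e)))

                                                                            
  -- Additive Hilbert 90 with its explicit solution, the sum of T_n(c) θ^(2^n) over n < h. Adding it
  -- to its square telescopes to Tr(c) θ^(2^h) + c Tr(θ²), which is c.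
  artinSchreier : ∀ {θ} → Tr θ ≈ 1# → ∀ c → Tr c ≈ 0# → ∃ λ η → η * η + η ≈ c
  artinSchreier {θ} Trθ≈1 c Trc≈0 = H h , (begin
    H h * H h + H h                          ≈⟨ H-equation h ⟩
    T h c * frob h θ + c * T h (θ * θ)          ≈⟨ +-cong (*-congʳ (trans (sym (Tr≈T c)) Trc≈0))
                                                  (*-congˡ (trans (sym (Tr≈T _)) (trans (Tr-square θ) Trθ≈1))) ⟩
    0# * frob h θ + c * 1#                      ≈⟨ solve 2 (λ a c → con false :* a :+ c :* con true := c) refl _ c ⟩
    c                                        ∎)
    where
    H : ℕ → Carrier
    H zero = 0#
    H (suc n) = H n + T n c * frob n θ
    H-equation : ∀ n → H n * H n + H n ≈ T n c * frob n θ + c * T n (θ * θ)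
    H-equation zero = solve 2 (λ c t → con false :* con false :+ con false := con false :* t :+ c :* con false) refl c θ
    H-equation (suc n) = begin
      H (suc n) * H (suc n) + H (suc n)
        ≈⟨ solve 3 (λ H t f → (H :+ t :* f) :* (H :+ t :* f) :+ (H :+ t :* f)
              := H :* H :+ H :+ (t :* t :* (f :* f) :+ t :* f)) refl (H n) (T n c) (frob n θ) ⟩
      H n * H n + H n + (T n c * T n c * (frob n θ * frob n θ) + T n c * frob n θ)
        ≈⟨ +-cong (H-equation n) (+-congʳ (*-cong (T-square n c) (frob-square n θ))) ⟩
      T n c * frob n θ + c * T n (θ * θ) + (T n (c * c) * frob n (θ * θ) + T n c * frob n θ)
        ≈⟨ solve 5 (λ c a t s f → a :+ c :* t :+ (s :* f :+ a) := (c :+ s) :* f :+ c :* (t :+ f)) refl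
             c _ (T n (θ * θ)) (T n (c * c)) (frob n (θ * θ)) ⟩
      (c + T n (c * c)) * frob n (θ * θ) + c * (T n (θ * θ) + frob n (θ * θ))
        ≈⟨ +-congˡ (*-congˡ (T-last n (θ * θ))) ⟨
      T (suc n) c * frob (suc n) θ + c * T (suc n) (θ * θ) ∎

-- Binary quadratic forms, the trace pairing, and roots of quadratics.

module TraceForm {h : ℕ} {c ℓ : Level} (F : GaloisField₂ h c ℓ) where

  open FiniteField F
  open Plane F using (q; Tr)
  open ≈-Reasoning setoid
  open Char2Solver using (solve; _:=_; _:+_; _:*_; con)

  x*0y≈0 : ∀ {x y} → y ≈ 0# → x * y ≈ 0#
  x*0y≈0 e = trans (*-congˡ e) (zeroʳ _)

  0x*y≈0 : ∀ {x y} → x ≈ 0# → x * y ≈ 0#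
  0x*y≈0 e = trans (*-congʳ e) (zeroˡ _)

  0+0≈0 : ∀ {x y} → x ≈ 0# → y ≈ 0# → x + y ≈ 0#
  0+0≈0 e f = trans (+-cong e f) (+-identityˡ 0#)

                                                  
  -- A factorisation A x² + x y + B y² = (r x + s y)(r′ x + s′ y). The middle coefficient is the
  -- determinant of the two factors, so they are never proportional.
  record Splits (A B : Carrier) : Set (c ⊔ ℓ) where
    field
      r s r′ s′ : Carrier
      rr′ : r * r′ ≈ A
      ss′ : s * s′ ≈ B
      det : r * s′ + r′ * s ≈ 1#

  -- With η² + η = AB the factors are A x + η y and x + (η + 1) y / A; for A = 0 they are y and x +
  -- B y.
  splits : ∀ {θ} → Tr θ ≈ 1# → ∀ A B → Tr (A * B) ≈ 0# → Splits A B
  splits Trθ≈1 A B e with A ≟ 0#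
  ... | yes A≈0 = record
    { r = 0# ; s = 1# ; r′ = 1# ; s′ = B
    ; rr′ = trans (zeroˡ _) (sym A≈0) ; ss′ = *-identityˡ B
    ; det = trans (+-cong (zeroˡ B) (*-identityˡ 1#)) (+-identityˡ 1#) }
  ... | no A≉0 with artinSchreier Trθ≈1 (A * B) e
  ...   | η , η²+η≈AB = record
    { r = A ; s = η ; r′ = 1# ; s′ = (η + 1#) * A ⁻¹
    ; rr′ = *-identityʳ A
    ; ss′ = begin
        η * ((η + 1#) * A ⁻¹)
          ≈⟨ solve 2 (λ η i → η :* ((η :+ con true) :* i) := (η :* η :+ η) :* i) refl η (A ⁻¹) ⟩
        (η * η + η) * A ⁻¹     ≈⟨ *-congʳ η²+η≈AB ⟩
        A * B * A ⁻¹           ≈⟨ solve 3 (λ a b i → a :* b :* i := a :* i :* b) refl A B (A ⁻¹) ⟩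
        A * A ⁻¹ * B           ≈⟨ *-congʳ (inverseʳ A≉0) ⟩
        1# * B                 ≈⟨ *-identityˡ B ⟩
        B                      ∎
    ; det = begin
        A * ((η + 1#) * A ⁻¹) + 1# * η
          ≈⟨ solve 3 (λ a η i → a :* ((η :+ con true) :* i) :+ con true :* η
                := a :* i :* (η :+ con true) :+ η) refl A η (A ⁻¹) ⟩
        A * A ⁻¹ * (η + 1#) + η   ≈⟨ +-congʳ (*-congʳ (inverseʳ A≉0)) ⟩
        1# * (η + 1#) + η         ≈⟨ solve 1 (λ η → con true :* (η :+ con true) :+ η := con true) refl η ⟩
        1#                        ∎ }

  -- For y nonzero and t = A x / y the equation reads AB = t² + t, and t² and t have the same trace.
  -- For y = 0 it forces A = 0.
  isotropic⇒Tr≈0 : ∀ A B x y → ¬ (x ≈ 0# × y ≈ 0#) →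
    A * (x * x) + x * y + B * (y * y) ≈ 0# → Tr (A * B) ≈ 0#
  isotropic⇒Tr≈0 A B x y xy≉0 e with y ≟ 0#
  ... | yes y≈0 = trans (Tr-cong (trans (*-congʳ A≈0) (zeroˡ B))) Tr-0
    where
    x≉0 : ¬ x ≈ 0#
    x≉0 x≈0 = xy≉0 (x≈0 , y≈0)
    A≈0 : A ≈ 0#
    A≈0 = cancel (product≉0 x≉0 x≉0) (begin
      x * x * A
        ≈⟨ solve 4 (λ A B x y → x :* x :* A := A :* (x :* x) :+ x :* y :+ B :* (y :* y) :+ (x :+ B :* y) :* y) refl A B x y ⟩
      A * (x * x) + x * y + B * (y * y) + (x + B * y) * y ≈⟨ 0+0≈0 e (x*0y≈0 y≈0) ⟩
      0# ∎)
  ... | no y≉0 = begin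
      Tr (A * B)         ≈⟨ Tr-cong AB≈ ⟩
      Tr (t * t + t)     ≈⟨ Tr-+ _ _ ⟩
      Tr (t * t) + Tr t  ≈⟨ +-congʳ (Tr-square t) ⟩
      Tr t + Tr t        ≈⟨ x+x≈0 _ ⟩
      0#                 ∎
    where
    i = y ⁻¹
    t = A * x * i
    AB≈ : A * B ≈ t * t + t
    AB≈ = begin
      A * B                            ≈⟨ solve 2 (λ A B → A :* B := A :* (B :* con true :* con true)) refl A B ⟩
      A * (B * 1# * 1#)                ≈⟨ *-congˡ (*-cong (*-congˡ (inverseʳ y≉0)) (inverseʳ y≉0)) ⟨
      A * (B * (y * i) * (y * i))
        ≈⟨ solve 5 (λ A B x y i → A :* (B :* (y :* i) :* (y :* i))
             := (A :* x :* i) :* (A :* x :* i) :+ (A :* x :* i) :* (y :* i)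
                :+ A :* i :* i :* (A :* (x :* x) :+ x :* y :+ B :* (y :* y))) refl A B x y i ⟩
      t * t + t * (y * i) + A * i * i * (A * (x * x) + x * y + B * (y * y))
        ≈⟨ +-cong (+-congˡ (trans (*-congˡ (inverseʳ y≉0)) (*-identityʳ t))) (x*0y≈0 e) ⟩
      t * t + t + 0#                   ≈⟨ +-identityʳ _ ⟩
      t * t + t                        ∎

  module Duality {θ : Carrier} (Trθ≈1 : Tr θ ≈ 1#) where

    -- A trace functional separates x from the span of the generators, by induction on their number.
    -- If the functional w found for x is 1 on the new generator g, a functional v is sought for g +
    -- x: either v itself is 0 on g, or w + v is. An arbitrary subgroup S around the generators
    -- spares the construction of their span.
    separate : ∀ {ℓ′} (S : Pred Carrier ℓ′) → 0# ∈ S →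
      (∀ {x y} → x ≈ y → x ∈ S → y ∈ S) → (∀ {x y} → x ∈ S → y ∈ S → (x + y) ∈ S) →
      ∀ {n} (g : Fin n → Carrier) → (∀ i → g i ∈ S) → ∀ x →
      x ∈ S ⊎ ∃ λ w → (∀ i → Tr (w * g i) ≈ 0#) × Tr (w * x) ≈ 1#
    separate S 0∈S resp closed {zero} g g∈S x with x ≟ 0#
    ... | yes x≈0 = inj₁ (resp (sym x≈0) 0∈S)
    ... | no x≉0 = inj₂ (θ * x ⁻¹ , (λ ()) , trans (Tr-cong (begin
      θ * x ⁻¹ * x       ≈⟨ *-assoc _ _ _ ⟩
      θ * (x ⁻¹ * x)     ≈⟨ *-congˡ (inverseˡ x≉0) ⟩
      θ * 1#             ≈⟨ *-identityʳ θ ⟩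
      θ                  ∎)) Trθ≈1)
    separate S 0∈S resp closed {suc n} g g∈S x
      with separate S 0∈S resp closed (g ∘ suc) (g∈S ∘ suc) x
    ... | inj₁ x∈S = inj₁ x∈S
    ... | inj₂ (w , w⊥ , wx) with Tr-bit (w * g zero)
    ...   | inj₁ wg = inj₂ (w , (λ { zero → wg ; (suc i) → w⊥ i }) , wx)
    ...   | inj₂ wg with separate S 0∈S resp closed (g ∘ suc) (g∈S ∘ suc) (g zero + x)
    ...     | inj₁ gx∈S = inj₁ (resp
                (solve 2 (λ g x → g :+ (g :+ x) := x) refl (g zero) x) (closed (g∈S zero) gx∈S))
    ...     | inj₂ (v , v⊥ , vgx) with Tr-bit (v * g zero)
    ...       | inj₁ vg = inj₂ (v , (λ { zero → vg ; (suc i) → v⊥ i }) , (begin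
                  Tr (v * x)                       ≈⟨ +-identityˡ _ ⟨
                  0# + Tr (v * x)                  ≈⟨ +-congʳ vg ⟨
                  Tr (v * g zero) + Tr (v * x)     ≈⟨ Tr-+ _ _ ⟨
                  Tr (v * g zero + v * x)          ≈⟨ Tr-cong (distribˡ _ _ _) ⟨
                  Tr (v * (g zero + x))            ≈⟨ vgx ⟩
                  1#                               ∎))
    ...       | inj₂ vg = inj₂ (w + v , (λ { zero → wv _ wg vg 1+1≈0
                                          ; (suc i) → wv _ (w⊥ i) (v⊥ i) (+-identityˡ 0#) }) ,
                                wv _ wx vx (+-identityʳ 1#))
      where
      wv : ∀ y {a b s} → Tr (w * y) ≈ a → Tr (v * y) ≈ b → a + b ≈ s → Tr ((w + v) * y) ≈ s
      wv y p r s = trans (Tr-cong (distribʳ _ _ _)) (trans (Tr-+ _ _) (trans (+-cong p r) s))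
      vx : Tr (v * x) ≈ 0#
      vx = begin
        Tr (v * x)
          ≈⟨ Tr-cong (solve 3 (λ v g x → v :* x := v :* g :+ v :* (g :+ x)) refl v (g zero) x) ⟩
        Tr (v * g zero + v * (g zero + x))        ≈⟨ Tr-+ _ _ ⟩
        Tr (v * g zero) + Tr (v * (g zero + x))   ≈⟨ +-cong vg vgx ⟩
        1# + 1#                                   ≈⟨ 1+1≈0 ⟩
        0#                                        ∎

    -- Nondegeneracy of the pairing Tr(w x): an additive bit-valued function that factors through g
    -- is a trace functional of g. The functional is corrected by `separate` at each listed argument
    -- where it fails.
    represent : ∀ {d} (_⊞_ : Fin d → Fin d → Fin d) (o : Fin d) (g f : Fin d → Carrier) →
      (∀ i j → g (i ⊞ j) ≈ g i + g j) → (∀ i j → f (i ⊞ j) ≈ f i + f j) →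
      g o ≈ 0# → f o ≈ 0# → (∀ i → Bit (f i)) → (∀ i → g i ≈ 0# → f i ≈ 0#) →
      ∃ λ w → ∀ i → Tr (w * g i) ≈ f i
    represent {d} _⊞_ o g f g-⊞ f-⊞ go≈0 fo≈0 f-bit g≈0⇒f≈0 = go (λ i → i)
      where
      go : ∀ {n} (ι : Fin n → Fin d) → ∃ λ w → ∀ i → Tr (w * g (ι i)) ≈ f (ι i)
      go {zero} ι = 0# , λ ()
      go {suc n} ι with go (ι ∘ suc)
      ... | w , w-ok with Tr (w * g (ι zero)) ≟ f (ι zero)
      ...   | yes e = w , λ { zero → e ; (suc i) → w-ok i }
      -- The subgroup consists of the values `g j` at which w already gives `f j`. If the new value
      -- belonged to it, additivity would make w correct there too.
      ...   | no ne with separate (λ x → ∃ λ j → x ≈ g j × Tr (w * x) ≈ f j)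
                (o , sym go≈0 , trans (Tr-cong (zeroʳ w)) (trans Tr-0 (sym fo≈0)))
                (λ e (j , p , r) → j , trans (sym e) p , trans (Tr-cong (*-congˡ (sym e))) r)
                (λ (j , p , r) (k , p′ , r′) → j ⊞ k , trans (+-cong p p′) (sym (g-⊞ j k)) ,
                  trans (Tr-cong (distribˡ _ _ _)) (trans (Tr-+ _ _) (trans (+-cong r r′) (sym (f-⊞ j k)))))
                (g ∘ ι ∘ suc) (λ i → ι (suc i) , refl , w-ok i) (g (ι zero))
      ...     | inj₁ (j , p , r) = ⊥-elim (ne (trans r (x+y≈0⇒x≈y (trans (sym (f-⊞ j (ι zero)))
                  (g≈0⇒f≈0 _ (trans (g-⊞ j (ι zero)) (x≈y⇒x+y≈0 (sym p))))))))
      ...     | inj₂ (v , v⊥ , vg) = w + v , λ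
                  { zero → trans (add _) (trans (+-congˡ vg) (trans (+-congˡ (sym (bit-≉ (Tr-bit _) (f-bit _) ne)))
                      (solve 2 (λ a b → a :+ (a :+ b) := b) refl _ _)))
                  ; (suc i) → trans (add _) (trans (+-cong (w-ok i) (v⊥ i)) (+-identityʳ _)) }
        where
        add : ∀ y → Tr ((w + v) * y) ≈ Tr (w * y) + Tr (v * y)
        add y = trans (Tr-cong (distribʳ _ _ _)) (Tr-+ _ _)

  -- The leading coefficient may be 0. Subtracting equations gives a (x + y) = l and a (x + z) = l,
  -- hence a = 0, and l = 0 follows.
  quadratic≤2 : ∀ {a l b x y z} → ¬ l ≈ 0# →
    a * (x * x) + l * x + b ≈ 0# → a * (y * y) + l * y + b ≈ 0# → a * (z * z) + l * z + b ≈ 0# →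
    ¬ x ≈ y → ¬ y ≈ z → ¬ x ≈ z → False
  quadratic≤2 {a} {l} {b} {x} {y} {z} l≉0 ex ey ez x≉y y≉z x≉z = l≉0 (begin
    l                                   ≈⟨ solve 3 (λ l a x → l := a :* x :+ (a :* x :+ l)) refl l a (x + y) ⟩
    a * (x + y) + (a * (x + y) + l)     ≈⟨ 0+0≈0 (0x*y≈0 a≈0) (chord ex ey x≉y) ⟩
    0#                                  ∎)
    where
    chord : ∀ {x y} → a * (x * x) + l * x + b ≈ 0# → a * (y * y) + l * y + b ≈ 0# →
      ¬ x ≈ y → a * (x + y) + l ≈ 0#
    chord {x} {y} ex ey x≉y = cancel (x≉y ∘ x+y≈0⇒x≈y) (trans
      (solve 5 (λ a l b x y → (x :+ y) :* (a :* (x :+ y) :+ l)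
         := (a :* (x :* x) :+ l :* x :+ b) :+ (a :* (y :* y) :+ l :* y :+ b)) refl a l b x y) (0+0≈0 ex ey))
    a≈0 : a ≈ 0#
    a≈0 = cancel (y≉z ∘ x+y≈0⇒x≈y) (trans
      (solve 5 (λ a l x y z → (y :+ z) :* a := (a :* (x :+ y) :+ l) :+ (a :* (x :+ z) :+ l)) refl a l x y z)
      (0+0≈0 (chord ex ey x≉y) (chord ex ez x≉z)))

  -- Each of the d quadratics has at most two roots, so together they cannot cover q > 2d elements.
  avoidRoots : ∀ {d} (a l b : Fin d → Carrier) → (∀ i → ¬ l i ≈ 0#) → 2 ℕ.* d ℕ.< q →
    ∃ λ x → ∀ i → ¬ a i * (x * x) + l i * x + b i ≈ 0#
  avoidRoots {d} a l b l≉0 2d<q with Fin.any? (λ s → Fin.all? (λ i → ¬? (value i s ≟ 0#)))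
    where
    value : Fin d → Fin q → Carrier
    value i s = a i * (elements s * elements s) + l i * elements s + b i
  ... | yes (s , s-ok) = elements s , s-ok
  ... | no none = ⊥-elim (collision (Fin.pigeonhole 2d<q code))
    where
    value : Fin d → Fin q → Carrier
    value i s = a i * (elements s * elements s) + l i * elements s + b i
    root : ∀ s → ∃ λ i → value i s ≈ 0#
    root s with Fin.any? (λ i → value i s ≟ 0#)
    ... | yes r = r
    ... | no ¬r = ⊥-elim (none (s , λ i e → ¬r (i , e)))
    Earlier : Fin q → Set ℓ
    Earlier s = ∃ λ t → t Fin.< s × value (proj₁ (root s)) t ≈ 0#
    earlier? : ∀ s → Dec (Earlier s)
    earlier? s = Fin.any? (λ t → (t Fin.<? s) ×-dec (value (proj₁ (root s)) t ≟ 0#))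
    -- Tells whether an element is preceded by another root of the quadratic assigned to it. Two
    -- elements with the same quadratic and the same rank would give three roots, or two elements
    -- both without a preceding root.
    rank : ∀ {s} → Dec (Earlier s) → Fin 2
    rank (yes _) = 0F
    rank (no _) = 1F
    distinct : ∀ {s t} → s Fin.< t → ¬ elements s ≈ elements t
    distinct s<t e = Fin.<⇒≢ s<t (elements-injective e)
    clash : ∀ {s t} → s Fin.< t → rank (earlier? s) ≡ rank (earlier? t) → proj₁ (root s) ≡ proj₁ (root t) → False
    clash {s} {t} s<t e i≡ with earlier? s | earlier? t
    ... | _ | no ¬earlier = ¬earlier (s , s<t , ≡.subst (λ i → value i s ≈ 0#) i≡ (proj₂ (root s)))
    clash s<t () i≡ | no _ | yes _
    clash {s} {t} s<t e i≡ | yes (r , r<s , er) | yes _ = quadratic≤2 (l≉0 _) er (proj₂ (root s))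
      (≡.subst (λ i → value i t ≈ 0#) (≡.sym i≡) (proj₂ (root t)))
      (distinct r<s) (distinct s<t) (distinct (Fin.<-trans r<s s<t))
    code : Fin q → Fin (2 ℕ.* d)
    code s = combine (rank (earlier? s)) (proj₁ (root s))
    collision : ¬ ∃₂ λ s t → s Fin.< t × code s ≡ code t
    collision (s , t , s<t , e) with Fin.combine-injective
      (rank (earlier? s)) (proj₁ (root s)) (rank (earlier? t)) (proj₁ (root t)) e
    ... | rank≡ , root≡ = clash s<t rank≡ root≡

-- Closed sets as groups of quadratic forms, and their restrictions to lines.

module Pencils {h : ℕ} {c ℓ : Level} (F : GaloisField₂ h c ℓ) where

  open FiniteField F
  open TraceForm F
  open Plane F
  open ≈-Reasoning setoid
  open Char2Solver using (solve; _:=_; _:+_; _:*_; con)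

  proportional : ∀ (P Q : Point) → (∀ i j → coords P i * coords Q j ≈ coords P j * coords Q i) → P ∼ Q
  proportional (point u u≉0) (point v v≉0) minors with Fin.all? (λ i → v i ≟ 0#)
  ... | yes v≈0 = ⊥-elim (v≉0 v≈0)
  ... | no v≉0′ with Fin.¬∀⟶∃¬ 3 _ (λ i → v i ≟ 0#) v≉0′
  ...   | i , vi≉0 = u i * v i ⁻¹ , k≉0 , u≋kv
    where
    u≋kv : ∀ j → u j ≈ u i * v i ⁻¹ * v j
    u≋kv j = begin
      u j                     ≈⟨ *-identityʳ _ ⟨
      u j * 1#                ≈⟨ *-congˡ (inverseʳ vi≉0) ⟨
      u j * (v i * v i ⁻¹)    ≈⟨ *-assoc _ _ _ ⟨
      u j * v i * v i ⁻¹      ≈⟨ *-congʳ (minors j i) ⟩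
      u i * v j * v i ⁻¹      ≈⟨ solve 3 (λ a b c → a :* b :* c := a :* c :* b) refl _ _ _ ⟩
      u i * v i ⁻¹ * v j      ∎
    k≉0 : ¬ u i * v i ⁻¹ ≈ 0#
    k≉0 k≈0 = u≉0 (λ j → trans (u≋kv j) (0x*y≈0 k≈0))

  proportional₃ : ∀ (P Q : Point) → (let x = coords P; y = coords Q) →
    x 0F * y 1F ≈ x 1F * y 0F → x 0F * y 2F ≈ x 2F * y 0F → x 1F * y 2F ≈ x 2F * y 1F → P ∼ Q
  proportional₃ P Q e f g = proportional P Q λ
    { 0F 0F → refl ; 0F 1F → e ; 0F 2F → f
    ; 1F 0F → sym e ; 1F 1F → refl ; 1F 2F → g
    ; 2F 0F → sym f ; 2F 1F → sym g ; 2F 2F → refl }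

  symP : ∀ P Q → P ∼ Q → Q ∼ P
  symP P Q = ∼-sym {P} {Q}

  transP : ∀ P Q R → P ∼ Q → Q ∼ R → P ∼ R
  transP P Q R = ∼-trans {P} {Q} {R}

  enumerate : ∀ {p d} {S : Pred Point p} (f : Fin d → ∃ S) →
    (∀ i j → proj₁ (f i) ∼ proj₁ (f j) → i ≡ j) →
    (∀ P → P ∈ S → ∃ λ i → P ∼ proj₁ (f i)) → HasCardinality S d
  enumerate {S = S} f injective surjective = record
    { to = f
    ; from = from
    ; to-cong = λ { {i} ≡.refl → ∼-refl {g i} }
    ; from-cong = λ {x} {y} x∼y → injective (from x) (from y)
        (transP (g (from x)) (proj₁ x) (g (from y)) (symP (proj₁ x) (g (from x)) (∼from x))
          (transP (proj₁ x) (proj₁ y) (g (from y)) x∼y (∼from y)))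
    ; inverse =
        (λ { {x} ≡.refl → symP (proj₁ x) (g (from x)) (∼from x) }) ,
        (λ {i} {x} x∼gi → injective (from x) i
          (transP (g (from x)) (proj₁ x) (g i) (symP (proj₁ x) (g (from x)) (∼from x)) x∼gi))
    }
    where
    g = proj₁ ∘ f
    from : ∃ S → Fin _
    from (P , P∈S) = proj₁ (surjective P P∈S)
    ∼from : ∀ x → proj₁ x ∼ g (from x)
    ∼from (P , P∈S) = proj₂ (surjective P P∈S)

                                                                                
                                                                 
  -- The conic with parameters a / l, b / l, l, its equation multiplied by l. This scaling makes the
  -- polynomial additive in (a, b, l), the square of l included.
  Ψ : (a b l x y z : Carrier) → Carrier
  Ψ a b l x y z = a * (x * x) + l * (x * y) + b * (y * y) + l * l * (z * z)

  Ψ-cong : ∀ {a b l a′ b′ l′ x y z x′ y′ z′} → a ≈ a′ → b ≈ b′ → l ≈ l′ → x ≈ x′ → y ≈ y′ → z ≈ z′ →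
    Ψ a b l x y z ≈ Ψ a′ b′ l′ x′ y′ z′
  Ψ-cong ea eb el ex ey ez = +-cong (+-cong (+-cong (*-cong ea (*-cong ex ex)) (*-cong el (*-cong ex ey)))
    (*-cong eb (*-cong ey ey))) (*-cong (*-cong el el) (*-cong ez ez))

                                                                                       
  -- Squaring is bijective, so for l nonzero there is exactly one z over each (x, y): a line through
  -- `F₀` meets the conic once.
  height : (a b l x y : Carrier) → Carrier
  height a b l x y = proj₁ (sqrt ((a * (x * x) + l * (x * y) + b * (y * y)) * (l ⁻¹ * l ⁻¹)))

  height-conic : ∀ {a b l} → ¬ l ≈ 0# → ∀ x y → Ψ a b l x y (height a b l x y) ≈ 0#
  height-conic {a} {b} {l} l≉0 x y = begin
    M + l * l * (z * z)                       ≈⟨ +-congˡ (*-congˡ (proj₂ (sqrt (M * (l ⁻¹ * l ⁻¹))))) ⟩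
    M + l * l * (M * (l ⁻¹ * l ⁻¹))
      ≈⟨ solve 3 (λ M l m → M :+ l :* l :* (M :* (m :* m)) := M :* (con true :+ (l :* m) :* (l :* m))) refl M l (l ⁻¹) ⟩
    M * (1# + (l * l ⁻¹) * (l * l ⁻¹))
      ≈⟨ *-congˡ (+-congˡ (*-cong (inverseʳ l≉0) (inverseʳ l≉0))) ⟩
    M * (1# + 1# * 1#)                        ≈⟨ solve 1 (λ M → M :* (con true :+ con true :* con true) := con false) refl M ⟩
    0#                                        ∎
    where
    M = a * (x * x) + l * (x * y) + b * (y * y)
    z = height a b l x y

  -- Its trace is what the slopes u, v contribute to Tr(AB) for the restricted form. It is additive
  -- in (a, b, l).
  Φ : (a b l u v : Carrier) → Carrier
  Φ a b l u v = a * (v * v) + b * (u * u) + l * (u * v)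

  Φ-cong : ∀ {a b l a′ b′ l′ u v} → a ≈ a′ → b ≈ b′ → l ≈ l′ → Φ a b l u v ≈ Φ a′ b′ l′ u v
  Φ-cong ea eb el = +-cong (+-cong (*-congʳ ea) (*-congʳ eb)) (*-congʳ el)

  -- This is Tr(αβ) for α = a / l and β = b / l; the value 1 means that the line z = 0 misses the
  -- conic.
  traceOf : (a b l : Carrier) → Carrier
  traceOf a b l = Tr ((a * l ⁻¹) * (b * l ⁻¹))

                                                                   
  module OnLine (a b l : Carrier) (l≉0 : ¬ l ≈ 0#) (u v : Carrier) where

    A B : Carrier
    A = a * l ⁻¹ + l * (u * u)
    B = b * l ⁻¹ + l * (v * v)

    -- Expanding AB produces (l u v)², quadratic in l; the trace does not distinguish it from l u v,
    -- which is linear.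
    Tr-AB : Tr (A * B) ≈ traceOf a b l + Tr (Φ a b l u v)
    Tr-AB = begin
      Tr (A * B)
        ≈⟨ Tr-cong (solve 6 (λ a b l m u v →
             (a :* m :+ l :* (u :* u)) :* (b :* m :+ l :* (v :* v))
             := (a :* m) :* (b :* m) :+ ((l :* m) :* (a :* (v :* v) :+ b :* (u :* u))
                  :+ l :* (u :* v) :* (l :* (u :* v)))) refl a b l (l ⁻¹) u v) ⟩
      Tr ((a * l ⁻¹) * (b * l ⁻¹) + (l * l ⁻¹ * N + luv * luv))
        ≈⟨ trans (Tr-+ _ _) (+-congˡ (Tr-+ _ _)) ⟩
      traceOf a b l + (Tr (l * l ⁻¹ * N) + Tr (luv * luv))
        ≈⟨ +-congˡ (+-cong (Tr-cong (trans (*-congʳ (inverseʳ l≉0)) (*-identityˡ N))) (Tr-square luv)) ⟩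
      traceOf a b l + (Tr N + Tr luv)    ≈⟨ +-congˡ (Tr-+ _ _) ⟨
      traceOf a b l + Tr (Φ a b l u v)   ∎
      where
      N = a * (v * v) + b * (u * u)
      luv = l * (u * v)

    restrict : ∀ x y → Ψ a b l x y (u * x + v * y) ≈ l * (A * (x * x) + x * y + B * (y * y))
    restrict x y = begin
      Ψ a b l x y (u * x + v * y)
        ≈⟨ solve 7 (λ a b l u v x y →
             a :* (x :* x) :+ l :* (x :* y) :+ b :* (y :* y) :+ l :* l :* ((u :* x :+ v :* y) :* (u :* x :+ v :* y))
             := con true :* (a :* (x :* x) :+ b :* (y :* y))
                  :+ l :* (l :* (u :* u) :* (x :* x) :+ x :* y :+ l :* (v :* v) :* (y :* y))) refl a b l u v x y ⟩
      1# * N + l * N′                     ≈⟨ +-congʳ (*-congʳ (inverseʳ l≉0)) ⟨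
      l * l ⁻¹ * N + l * N′
        ≈⟨ solve 8 (λ a b l m u v x y →
             l :* m :* (a :* (x :* x) :+ b :* (y :* y))
               :+ l :* (l :* (u :* u) :* (x :* x) :+ x :* y :+ l :* (v :* v) :* (y :* y))
             := l :* ((a :* m :+ l :* (u :* u)) :* (x :* x) :+ x :* y :+ (b :* m :+ l :* (v :* v)) :* (y :* y)))
             refl a b l (l ⁻¹) u v x y ⟩
      l * (A * (x * x) + x * y + B * (y * y)) ∎
      where
      N = a * (x * x) + b * (y * y)
      N′ = l * (u * u) * (x * x) + x * y + l * (v * v) * (y * y)

    meets⇒ : ∀ x y → ¬ (x ≈ 0# × y ≈ 0#) → Ψ a b l x y (u * x + v * y) ≈ 0# →
      traceOf a b l + Tr (Φ a b l u v) ≈ 0#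
    meets⇒ x y xy≉0 e = trans (sym Tr-AB) (isotropic⇒Tr≈0 A B x y xy≉0
      (cancel l≉0 (trans (sym (restrict x y)) e)))


  bezout : ∀ {x y} → ¬ (x ≈ 0# × y ≈ 0#) → ∃₂ λ p r → p * x + r * y ≈ 1#
  bezout {x} {y} xy≉0 with x ≟ 0# | y ≟ 0#
  ... | no x≉0 | _ = x ⁻¹ , 0# , trans (+-cong (inverseˡ x≉0) (zeroˡ y)) (+-identityʳ 1#)
  ... | yes x≈0 | no y≉0 = 0# , y ⁻¹ , trans (+-cong (zeroˡ x) (inverseˡ y≉0)) (+-identityˡ 1#)
  ... | yes x≈0 | yes y≈0 = ⊥-elim (xy≉0 (x≈0 , y≈0))

  ∼F₀ : ∀ P → coords P 0F ≈ 0# → coords P 1F ≈ 0# → P ∼ F₀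
  ∼F₀ P x≈0 y≈0 = proportional₃ P F₀ (trans (0x*y≈0 x≈0) (sym (0x*y≈0 y≈0)))
    (trans (0x*y≈0 x≈0) (sym (zeroʳ _))) (trans (0x*y≈0 y≈0) (sym (zeroʳ _)))

  on-conic⇒xy≉0 : ∀ {a b l} → ¬ l ≈ 0# → (P : Point) →
    Ψ a b l (coords P 0F) (coords P 1F) (coords P 2F) ≈ 0# →
    ¬ (coords P 0F ≈ 0# × coords P 1F ≈ 0#)
  on-conic⇒xy≉0 {a} {b} {l} l≉0 P e (x≈0 , y≈0) = nonzero P λ { 0F → x≈0 ; 1F → y≈0 ; 2F → z≈0 }
    where
    z≈0 = square≈0 (cancel (product≉0 l≉0 l≉0) (trans
      (solve 6 (λ a b l x y z → l :* l :* (z :* z) := (a :* (x :* x) :+ l :* (x :* y) :+ b :* (y :* y)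
          :+ l :* l :* (z :* z)) :+ (x :* (a :* x :+ l :* y) :+ y :* (b :* y))) refl
        a b l (coords P 0F) (coords P 1F) (coords P 2F))
      (0+0≈0 e (0+0≈0 (0x*y≈0 x≈0) (0x*y≈0 y≈0)))))

                                                                            
  -- The zero triple is included, at index `o`, to make the index set a group. The trace condition
  -- is kept apart because the group generated by M and C may violate it until the plane is sheared.
  record Pencil (d : ℕ) : Set (c ⊔ ℓ) where
    infixl 6 _⊞_
    field
      a b l : Fin d → Carrier
      o     : Fin d
      a-o   : a o ≈ 0#
      b-o   : b o ≈ 0#
      l-o   : l o ≈ 0#
      _⊞_   : Fin d → Fin d → Fin d
      a-⊞   : ∀ i j → a (i ⊞ j) ≈ a i + a j
      b-⊞   : ∀ i j → b (i ⊞ j) ≈ b i + b j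
      l-⊞   : ∀ i j → l (i ⊞ j) ≈ l i + l j
      l-inj : ∀ {i j} → l i ≈ l j → i ≡ j

    l≉0 : ∀ {i} → i ≢ o → ¬ l i ≈ 0#
    l≉0 i≢o e = i≢o (l-inj (trans e (sym l-o)))

    ψ : Fin d → (x y z : Carrier) → Carrier
    ψ i = Ψ (a i) (b i) (l i)

    ω : (u v : Carrier) → Fin d → Carrier
    ω u v i = Φ (a i) (b i) (l i) u v

    τ : Fin d → Carrier
    τ i = traceOf (a i) (b i) (l i)

    ψ-⊞ : ∀ i j x y z → ψ (i ⊞ j) x y z ≈ ψ i x y z + ψ j x y z
    ψ-⊞ i j x y z = trans (Ψ-cong (a-⊞ i j) (b-⊞ i j) (l-⊞ i j) refl refl refl)
      (solve 9 (λ a b l a′ b′ l′ x y z →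
        (a :+ a′) :* (x :* x) :+ (l :+ l′) :* (x :* y) :+ (b :+ b′) :* (y :* y) :+ (l :+ l′) :* (l :+ l′) :* (z :* z)
        := (a :* (x :* x) :+ l :* (x :* y) :+ b :* (y :* y) :+ l :* l :* (z :* z))
           :+ (a′ :* (x :* x) :+ l′ :* (x :* y) :+ b′ :* (y :* y) :+ l′ :* l′ :* (z :* z))) refl
        (a i) (b i) (l i) (a j) (b j) (l j) x y z)

    ω-⊞ : ∀ u v i j → ω u v (i ⊞ j) ≈ ω u v i + ω u v j
    ω-⊞ u v i j = trans (Φ-cong (a-⊞ i j) (b-⊞ i j) (l-⊞ i j))
      (solve 8 (λ a b l a′ b′ l′ u v →
        (a :+ a′) :* (v :* v) :+ (b :+ b′) :* (u :* u) :+ (l :+ l′) :* (u :* v)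
        := (a :* (v :* v) :+ b :* (u :* u) :+ l :* (u :* v))
           :+ (a′ :* (v :* v) :+ b′ :* (u :* u) :+ l′ :* (u :* v))) refl
        (a i) (b i) (l i) (a j) (b j) (l j) u v)

    φ : (u v : Carrier) → Fin d → Carrier
    φ u v i = Tr (ω u v i)

    φ-⊞ : ∀ u v i j → φ u v (i ⊞ j) ≈ φ u v i + φ u v j
    φ-⊞ u v i j = trans (Tr-cong (ω-⊞ u v i j)) (Tr-+ _ _)

    ψ-o : ∀ x y z → ψ o x y z ≈ 0#
    ψ-o x y z = 0+0≈0 (0+0≈0 (0+0≈0 (0x*y≈0 a-o) (0x*y≈0 l-o)) (0x*y≈0 b-o)) (0x*y≈0 (0x*y≈0 l-o))

    φ-o : ∀ u v → φ u v o ≈ 0#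
    φ-o u v = trans (Tr-cong (0+0≈0 (0+0≈0 (0x*y≈0 a-o) (0x*y≈0 b-o)) (0x*y≈0 l-o))) Tr-0

    φ≈1⇒≢o : ∀ {u v i} → φ u v i ≈ 1# → i ≢ o
    φ≈1⇒≢o e ≡.refl = 0≉1 (trans (sym (φ-o _ _)) e)

    cancel-⊞ : ∀ i j → i ⊞ j ⊞ j ≡ i
    cancel-⊞ i j = l-inj (trans (l-⊞ _ _) (trans (+-congʳ (l-⊞ _ _))
      (solve 2 (λ x y → x :+ y :+ y := x) refl _ _)))

    ⊞-cancel : ∀ {i j k} → i ⊞ k ≡ j ⊞ k → i ≡ j
    ⊞-cancel {i} {j} {k} e = ≡.trans (≡.sym (cancel-⊞ i k)) (≡.trans (≡.cong (_⊞ k) e) (cancel-⊞ j k))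

    conic : Fin d → Pred Point ℓ
    conic i P = ψ i (coords P 0F) (coords P 1F) (coords P 2F) ≈ 0#

    arc : PointSet
    arc P = (∃ λ i → i ≢ o × P ∈ conic i) ⊎ P ∼ F₀

    conic-resp : ∀ i P Q → P ∼ Q → P ∈ conic i → Q ∈ conic i
    conic-resp i P Q (k , k≉0 , P≋kQ) e = cancel (product≉0 k≉0 k≉0) (trans
      (solve 7 (λ a b l k x y z → k :* k :* (a :* (x :* x) :+ l :* (x :* y) :+ b :* (y :* y) :+ l :* l :* (z :* z))
        := a :* (k :* x :* (k :* x)) :+ l :* (k :* x :* (k :* y)) :+ b :* (k :* y :* (k :* y))
           :+ l :* l :* (k :* z :* (k :* z))) refl (a i) (b i) (l i) k (coords Q 0F) (coords Q 1F) (coords Q 2F))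
      (trans (Ψ-cong refl refl refl (sym (P≋kQ 0F)) (sym (P≋kQ 1F)) (sym (P≋kQ 2F))) e))

    arc-resp : ∀ {P Q} → P ∼ Q → P ∈ arc → Q ∈ arc
    arc-resp {P} {Q} P∼Q (inj₁ (i , i≢o , e)) = inj₁ (i , i≢o , conic-resp i P Q P∼Q e)
    arc-resp {P} {Q} P∼Q (inj₂ P∼F₀) = inj₂ (transP Q P F₀ (symP P Q P∼Q) P∼F₀)

  Traces : ∀ {d} → Pencil d → Set ℓ
  Traces V = ∀ i → i ≢ o → τ i ≈ 1#
    where open Pencil V

  module _ {d} (V : Pencil d) (traces : Traces V) where
    open Pencil V

    meets⇒φ≈1 : ∀ {i} → i ≢ o → ∀ {u v x y z} → ¬ (x ≈ 0# × y ≈ 0#) → z ≈ u * x + v * y →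
      ψ i x y z ≈ 0# → φ u v i ≈ 1#
    meets⇒φ≈1 {i} i≢o {u} {v} {x} {y} xy≉0 z≈ e = sym (x+y≈0⇒x≈y (trans (+-congʳ (sym (traces i i≢o)))
      (OnLine.meets⇒ (a i) (b i) (l i) (l≉0 i≢o) u v x y xy≉0
        (trans (Ψ-cong refl refl refl refl refl (sym z≈)) e))))

    -- A common point of the conics i and j also lies on the conic of `i ⊞ j`, since the polynomials
    -- add. A line through that point avoiding `F₀` would have φ = 1 at all three indices, against
    -- additivity of φ.
    disjoint : ∀ {i j} → i ≢ o → j ≢ o → ∀ {x y z} → ¬ (x ≈ 0# × y ≈ 0#) →
      ψ i x y z ≈ 0# → ψ j x y z ≈ 0# → i ≡ j
    disjoint {i} {j} i≢o j≢o {x} {y} {z} xy≉0 ei ej with l i ≟ l j | bezout xy≉0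
    ... | yes e | _ = l-inj e
    ... | no ne | p , r , px+ry≈1 = ⊥-elim (0≉1 (begin
      0#                            ≈⟨ 1+1≈0 ⟨
      1# + 1#                       ≈⟨ +-cong (φ≈1 i i≢o ei) (φ≈1 j j≢o ej) ⟨
      φ u v i + φ u v j             ≈⟨ φ-⊞ u v i j ⟨
      φ u v (i ⊞ j)                 ≈⟨ φ≈1 (i ⊞ j) k≢o (trans (ψ-⊞ i j x y z) (0+0≈0 ei ej)) ⟩
      1#                            ∎))
      where
      u = z * p
      v = z * r
      φ≈1 : ∀ k → k ≢ o → ψ k x y z ≈ 0# → φ u v k ≈ 1#
      φ≈1 k k≢o = meets⇒φ≈1 k≢o xy≉0 (begin
        z                          ≈⟨ *-identityʳ z ⟨
        z * 1#                     ≈⟨ *-congˡ px+ry≈1 ⟨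
        z * (p * x + r * y)        ≈⟨ solve 5 (λ x y z p r → z :* (p :* x :+ r :* y) := z :* p :* x :+ z :* r :* y)
                                        refl x y z p r ⟩
        u * x + v * y              ∎)
      k≢o : i ⊞ j ≢ o
      k≢o e = ne (x+y≈0⇒x≈y (trans (sym (l-⊞ i j)) (trans (reflexive (≡.cong l e)) l-o)))

    disjointP : ∀ {i j} → i ≢ o → j ≢ o → ∀ P → P ∈ conic i → P ∈ conic j → i ≡ j
    disjointP i≢o j≢o P e f = disjoint i≢o j≢o (on-conic⇒xy≉0 (l≉0 i≢o) P e) e f

-- Maximal arcs from pencils: counting the points of a line.

module MathonArcs {h : ℕ} {c ℓ : Level} (F : GaloisField₂ h c ℓ) where

  open FiniteField F
  open TraceForm F
  open Plane F
  open Pencils F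
  open ≈-Reasoning setoid
  open Char2Solver using (solve; _:=_; _:+_; _:*_; con)

  module _ {d} (V : Pencil d) (traces : Traces V) where
    open Pencil V

                                                                
    -- Such a line carries `F₀` and one point of each of the d - 1 conics; the index `o` is spent on
    -- `F₀`.
    module ThroughF₀ (L : Line) (L₂≈0 : coords L 2F ≈ 0#) where

      -- In characteristic 2 the points of L₀ X + L₁ Y = 0 other than `F₀` are those with (X, Y)
      -- proportional to (L₁, L₀).
      x y : Carrier
      x = coords L 1F
      y = coords L 0F

      xy≉0 : ¬ (x ≈ 0# × y ≈ 0#)
      xy≉0 (x≈0 , y≈0) = nonzero L λ { 0F → y≈0 ; 1F → x≈0 ; 2F → L₂≈0 }

      z : Fin d → Carrier
      z i = height (a i) (b i) (l i) x y

      z-conic : ∀ i → i ≢ o → ψ i x y (z i) ≈ 0#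
      z-conic i i≢o = height-conic (l≉0 i≢o) x y

      pt : Fin d → Point
      pt i = point (x ∷ y ∷ z i ∷ []) λ e → xy≉0 (e 0F , e 1F)

      pt-on : ∀ i → pt i ∈ on L
      pt-on i = trans (+-congˡ (+-congˡ (trans (+-identityʳ _) (0x*y≈0 L₂≈0))))
        (solve 2 (λ x y → y :* x :+ (x :* y :+ con false) := con false) refl x y)

      f : Fin d → ∃ (arc ∩ on L)
      f i with i Fin.≟ o
      ... | yes _ = F₀ , inj₂ (∼-refl {F₀}) , 0+0≈0 (zeroʳ _) (0+0≈0 (zeroʳ _) (0+0≈0 (0x*y≈0 L₂≈0) refl))
      ... | no i≢o = pt i , inj₁ (i , i≢o , z-conic i i≢o) , pt-on i

      pt≁F₀ : ∀ i → ¬ pt i ∼ F₀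
      pt≁F₀ i (k , _ , e) = xy≉0 (trans (e 0F) (zeroʳ k) , trans (e 1F) (zeroʳ k))

      pt-injective : ∀ {i j} → i ≢ o → j ≢ o → pt i ∼ pt j → i ≡ j
      pt-injective {i} {j} i≢o j≢o p = disjointP V traces i≢o j≢o (pt j)
        (conic-resp i (pt i) (pt j) p (z-conic i i≢o)) (z-conic j j≢o)

      f-injective : ∀ i j → proj₁ (f i) ∼ proj₁ (f j) → i ≡ j
      f-injective i j p with i Fin.≟ o | j Fin.≟ o
      ... | yes i≡o | yes j≡o = ≡.trans i≡o (≡.sym j≡o)
      ... | yes _ | no _ = ⊥-elim (pt≁F₀ j (symP F₀ (pt j) p))
      ... | no _ | yes _ = ⊥-elim (pt≁F₀ i p)
      ... | no i≢o | no j≢o = pt-injective i≢o j≢o p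

      f-o : proj₁ (f o) ∼ F₀
      f-o with o Fin.≟ o
      ... | yes _ = ∼-refl {F₀}
      ... | no o≢o = ⊥-elim (o≢o ≡.refl)

      f-≢o : ∀ {i} → i ≢ o → proj₁ (f i) ∼ pt i
      f-≢o {i} i≢o with i Fin.≟ o
      ... | yes i≡o = ⊥-elim (i≢o i≡o)
      ... | no _ = ∼-refl {pt i}

      f-surjective : ∀ P → P ∈ arc ∩ on L → ∃ λ i → P ∼ proj₁ (f i)
      f-surjective P (inj₂ P∼F₀ , _) = o , transP P F₀ (proj₁ (f o)) P∼F₀ (symP (proj₁ (f o)) F₀ f-o)
      f-surjective P (inj₁ (i , i≢o , e) , P∈L) = i , transP P (pt i) (proj₁ (f i)) P∼pt (symP (proj₁ (f i)) (pt i) (f-≢o i≢o))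
        where
        X = coords P 0F
        Y = coords P 1F
        Z = coords P 2F
        cross : y * X + x * Y ≈ 0#
        cross = begin
          y * X + x * Y   ≈⟨ solve 4 (λ x y X Y → y :* X :+ x :* Y := y :* X :+ (x :* Y :+ con false)) refl x y X Y ⟩
          y * X + (x * Y + 0#)   ≈⟨ +-congˡ (+-congˡ (trans (+-identityʳ _) (0x*y≈0 L₂≈0))) ⟨
          coords L ∙ coords P    ≈⟨ P∈L ⟩
          0#                     ∎
        Xy≈Yx : X * y ≈ Y * x
        Xy≈Yx = x+y≈0⇒x≈y (trans (solve 4 (λ x y X Y → X :* y :+ Y :* x := y :* X :+ x :* Y) refl x y X Y) cross)
                                                                           
                                                
        -- Over proportional pairs (X, Y) and (x, y) the heights are proportional, by uniqueness of
        -- square roots. Applied with s = x and with s = y, one of which may be 0.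
        Zs≈ : ∀ s S → s * X ≈ S * x → s * Y ≈ S * y → s * Z ≈ S * z i
        Zs≈ s S p r = square-injective (x+y≈0⇒x≈y (cancel (product≉0 (l≉0 i≢o) (l≉0 i≢o)) (begin
          l i * l i * (s * Z * (s * Z) + S * z i * (S * z i))
            ≈⟨ solve 11 (λ a b l s S x y z X Y Z → l :* l :* (s :* Z :* (s :* Z) :+ S :* z :* (S :* z))
                 := s :* s :* (a :* (X :* X) :+ l :* (X :* Y) :+ b :* (Y :* Y) :+ l :* l :* (Z :* Z))
                    :+ S :* S :* (a :* (x :* x) :+ l :* (x :* y) :+ b :* (y :* y) :+ l :* l :* (z :* z))
                    :+ (a :* (s :* X :* (s :* X) :+ S :* x :* (S :* x))
                       :+ l :* (s :* X :* (s :* Y) :+ S :* x :* (S :* y))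
                       :+ b :* (s :* Y :* (s :* Y) :+ S :* y :* (S :* y)))) refl
                 (a i) (b i) (l i) s S x y (z i) X Y Z ⟩
          _ ≈⟨ 0+0≈0 (0+0≈0 (x*0y≈0 e) (x*0y≈0 (z-conic i i≢o))) (0+0≈0 (0+0≈0
                 (x*0y≈0 (x≈y⇒x+y≈0 (*-cong p p))) (x*0y≈0 (x≈y⇒x+y≈0 (*-cong p r))))
                 (x*0y≈0 (x≈y⇒x+y≈0 (*-cong r r)))) ⟩
          0#   ∎)))
        P∼pt : P ∼ pt i
        P∼pt = proportional₃ P (pt i) Xy≈Yx
          (trans (sym (Zs≈ x X (*-comm _ _) (trans (*-comm _ _) (sym Xy≈Yx)))) (*-comm _ _))
          (trans (sym (Zs≈ y Y (trans (*-comm _ _) Xy≈Yx) (*-comm _ _))) (*-comm _ _))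

      cardinality : HasCardinality (arc ∩ on L) d
      cardinality = enumerate f f-injective f-surjective

  module Slopes (L : Line) (L₂≉0 : ¬ coords L 2F ≈ 0#) where

    u v : Carrier
    u = coords L 0F * coords L 2F ⁻¹
    v = coords L 1F * coords L 2F ⁻¹

    on-line : ∀ x y z → coords L 2F * (z + (u * x + v * y)) ≈
      coords L 0F * x + (coords L 1F * y + (coords L 2F * z + 0#))
    on-line x y z = begin
      n * (z + (k * i * x + m * i * y))
        ≈⟨ solve 7 (λ k m n i x y z → n :* (z :+ (k :* i :* x :+ m :* i :* y))
             := n :* z :+ n :* i :* (k :* x :+ m :* y)) refl k m n i x y z ⟩
      n * z + n * i * (k * x + m * y)    ≈⟨ +-congˡ (*-congʳ (inverseʳ L₂≉0)) ⟩
      n * z + 1# * (k * x + m * y)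
        ≈⟨ solve 6 (λ k m n x y z → n :* z :+ con true :* (k :* x :+ m :* y)
             := k :* x :+ (m :* y :+ (n :* z :+ con false))) refl k m n x y z ⟩
      k * x + (m * y + (n * z + 0#))     ∎
      where
      k = coords L 0F
      m = coords L 1F
      n = coords L 2F
      i = n ⁻¹

    on⇒ : ∀ P → P ∈ on L → coords P 2F ≈ u * coords P 0F + v * coords P 1F
    on⇒ P e = x+y≈0⇒x≈y (cancel L₂≉0 (trans (on-line _ _ _) e))

    on⇐ : ∀ P → coords P 2F ≈ u * coords P 0F + v * coords P 1F → P ∈ on L
    on⇐ P e = trans (sym (on-line _ _ _)) (x*0y≈0 (x≈y⇒x+y≈0 e))

  record Secant (a b l u v : Carrier) : Set (c ⊔ ℓ) where
    field
      P₁ P₂    : Point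
      on-line₁ : coords P₁ 2F ≈ u * coords P₁ 0F + v * coords P₁ 1F
      on-line₂ : coords P₂ 2F ≈ u * coords P₂ 0F + v * coords P₂ 1F
      conic₁   : Ψ a b l (coords P₁ 0F) (coords P₁ 1F) (coords P₁ 2F) ≈ 0#
      conic₂   : Ψ a b l (coords P₂ 0F) (coords P₂ 1F) (coords P₂ 2F) ≈ 0#
      P₁≁P₂    : ¬ P₁ ∼ P₂
      complete : ∀ P → coords P 2F ≈ u * coords P 0F + v * coords P 1F →
        Ψ a b l (coords P 0F) (coords P 1F) (coords P 2F) ≈ 0# → P ∼ P₁ ⊎ P ∼ P₂

                                                                             
                           
  -- The two linear factors vanish at (s, r) and (s′, r′), and `det` keeps these directions apart.
  splits⇒secant : ∀ a b l u v (l≉0 : ¬ l ≈ 0#) →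
    (let open OnLine a b l l≉0 u v) → Splits A B → Secant a b l u v
  splits⇒secant a b l u v l≉0 AB = record
    { P₁ = P₁ ; P₂ = P₂
    ; on-line₁ = refl ; on-line₂ = refl
    ; conic₁ = trans (factor s r) (x*0y≈0 (0x*y≈0 (solve 2 (λ r s → r :* s :+ s :* r := con false) refl r s)))
    ; conic₂ = trans (factor s′ r′) (x*0y≈0 (x*0y≈0 (solve 2 (λ r s → r :* s :+ s :* r := con false) refl r′ s′)))
    ; P₁≁P₂ = λ (k , _ , e) → 0≉1 (begin
        0#                                       ≈⟨ solve 3 (λ k r s → k :* r :* s :+ r :* (k :* s) := con false) refl k r′ s′ ⟨
        k * r′ * s′ + r′ * (k * s′)              ≈⟨ +-cong (*-congʳ (e 1F)) (*-congˡ (e 0F)) ⟨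
        r * s′ + r′ * s                          ≈⟨ det ⟩
        1#                                       ∎)
    ; complete = complete }
    where
    open OnLine a b l l≉0 u v
    open Splits AB
    factor : ∀ x y → Ψ a b l x y (u * x + v * y) ≈ l * ((r * x + s * y) * (r′ * x + s′ * y))
    factor x y = trans (restrict x y) (*-congˡ (begin
      A * (x * x) + x * y + B * (y * y)
        ≈⟨ +-cong (+-cong (*-congʳ rr′) (*-identityˡ _)) (*-congʳ ss′) ⟨
      r * r′ * (x * x) + 1# * (x * y) + s * s′ * (y * y)
        ≈⟨ +-congʳ (+-congˡ (*-congʳ det)) ⟨
      r * r′ * (x * x) + (r * s′ + r′ * s) * (x * y) + s * s′ * (y * y)
        ≈⟨ solve 6 (λ r s r′ s′ x y → r :* r′ :* (x :* x) :+ (r :* s′ :+ r′ :* s) :* (x :* y) :+ s :* s′ :* (y :* y)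
             := (r :* x :+ s :* y) :* (r′ :* x :+ s′ :* y)) refl r s r′ s′ x y ⟩
      (r * x + s * y) * (r′ * x + s′ * y) ∎))
    pt : (x y : Carrier) → ¬ (x ≈ 0# × y ≈ 0#) → Point
    pt x y xy≉0 = point (x ∷ y ∷ u * x + v * y ∷ []) λ e → xy≉0 (e 0F , e 1F)
    sr≉0 : ¬ (s ≈ 0# × r ≈ 0#)
    sr≉0 (s≈0 , r≈0) = 0≉1 (trans (sym (0+0≈0 (0x*y≈0 r≈0) (x*0y≈0 s≈0))) det)
    s′r′≉0 : ¬ (s′ ≈ 0# × r′ ≈ 0#)
    s′r′≉0 (s′≈0 , r′≈0) = 0≉1 (trans (sym (0+0≈0 (x*0y≈0 s′≈0) (0x*y≈0 r′≈0))) det)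
    P₁ P₂ : Point
    P₁ = pt s r sr≉0
    P₂ = pt s′ r′ s′r′≉0
    same : ∀ P x y xy≉0 → coords P 2F ≈ u * coords P 0F + v * coords P 1F →
      y * coords P 0F + x * coords P 1F ≈ 0# → P ∼ pt x y xy≉0
    same P x y xy≉0 z≈ e = proportional₃ P (pt x y xy≉0)
      (x+y≈0⇒x≈y (trans (solve 4 (λ x y X Y → X :* y :+ Y :* x := y :* X :+ x :* Y) refl x y X Y) e))
      (trans (x+y≈0⇒x≈y (trans (solve 6 (λ u v x y X Y → X :* (u :* x :+ v :* y) :+ (u :* X :+ v :* Y) :* x
         := v :* (y :* X :+ x :* Y)) refl u v x y X Y) (x*0y≈0 e))) (*-congʳ (sym z≈)))
      (trans (x+y≈0⇒x≈y (trans (solve 6 (λ u v x y X Y → Y :* (u :* x :+ v :* y) :+ (u :* X :+ v :* Y) :* y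
         := u :* (y :* X :+ x :* Y)) refl u v x y X Y) (x*0y≈0 e))) (*-congʳ (sym z≈)))
      where
      X = coords P 0F
      Y = coords P 1F
    complete : ∀ P → coords P 2F ≈ u * coords P 0F + v * coords P 1F →
      Ψ a b l (coords P 0F) (coords P 1F) (coords P 2F) ≈ 0# → P ∼ P₁ ⊎ P ∼ P₂
    complete P z≈ e = Sum.map (same P s r sr≉0 z≈) (same P s′ r′ s′r′≉0 z≈)
      (noZeroDivisors (cancel l≉0 (trans (sym (factor (coords P 0F) (coords P 1F)))
        (trans (Ψ-cong refl refl refl refl refl (sym z≈)) e))))

  secant : ∀ {θ} → Tr θ ≈ 1# → ∀ a b l u v → ¬ l ≈ 0# →
    traceOf a b l + Tr (Φ a b l u v) ≈ 0# → Secant a b l u v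
  secant Trθ≈1 a b l u v l≉0 τ+φ≈0 = splits⇒secant a b l u v l≉0 (splits Trθ≈1 A B (trans Tr-AB τ+φ≈0))
    where open OnLine a b l l≉0 u v

  module _ {d} (V : Pencil d) (traces : Traces V) where
    open Pencil V

    F₀-off : ∀ u v P → P ∼ F₀ → ¬ coords P 2F ≈ u * coords P 0F + v * coords P 1F
    F₀-off u v P (k , k≉0 , e) z≈ = k≉0 (begin
      k                                  ≈⟨ *-identityʳ k ⟨
      k * 1#                             ≈⟨ e 2F ⟨
      coords P 2F                        ≈⟨ z≈ ⟩
      u * coords P 0F + v * coords P 1F  ≈⟨ 0+0≈0 (x*0y≈0 (trans (e 0F) (zeroʳ k))) (x*0y≈0 (trans (e 1F) (zeroʳ k))) ⟩
      0#                                 ∎)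

    external : ∀ {u v} → (∀ i → φ u v i ≈ 0#) → ∀ P → P ∈ arc → ¬ coords P 2F ≈ u * coords P 0F + v * coords P 1F
    external φ≈0 P (inj₁ (i , i≢o , e)) z≈ = 0≉1 (trans (sym (φ≈0 i))
      (meets⇒φ≈1 V traces i≢o (on-conic⇒xy≉0 (l≉0 i≢o) P e) z≈ e))
    external {u} {v} φ≈0 P (inj₂ P∼F₀) = F₀-off u v P P∼F₀

                                                                                   
                                                                                      
    -- Here every conic is met in two points or none, according to φ. If the homomorphism φ takes
    -- the value 1 at all, it does so on exactly half of the d indices, which gives d points.
    module NotThroughF₀ (L : Line) (L₂≉0 : ¬ coords L 2F ≈ 0#) where

      open Slopes L L₂≉0

      F₀∉L : ∀ P → P ∼ F₀ → P ∉ on L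
      F₀∉L P P∼F₀ P∈L = F₀-off u v P P∼F₀ (on⇒ P P∈L)

      φ≈1 : ∀ {i} P → i ≢ o → P ∈ conic i → P ∈ on L → φ u v i ≈ 1#
      φ≈1 P i≢o e P∈L = meets⇒φ≈1 V traces i≢o (on-conic⇒xy≉0 (l≉0 i≢o) P e) (on⇒ P P∈L) e

      -- The proof of φ = 1 is an irrelevant argument, so that the two chosen points depend on the
      -- index alone.
      secants : ∀ {i₀} → φ u v i₀ ≈ 1# → ∀ i → .(φ u v i ≈ 1#) → Secant (a i) (b i) (l i) u v
      secants {i₀} φi₀≈1 i φi≈1 = secant (traces i₀ (φ≈1⇒≢o φi₀≈1)) (a i) (b i) (l i) u v (l≉0 (φ≈1⇒≢o e))
        (trans (+-cong (traces i (φ≈1⇒≢o e)) e) 1+1≈0)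
        where
        e : φ u v i ≈ 1#
        e = recompute (φ u v i ≟ 1#) φi≈1

      module Enumeration {i₀} (φi₀≈1 : φ u v i₀ ≈ 1#)
        (secants : ∀ i → .(φ u v i ≈ 1#) → Secant (a i) (b i) (l i) u v) where

        open Secant

        shift : ∀ {i} → ¬ φ u v i ≈ 1# → φ u v (i ⊞ i₀) ≈ 1#
        shift {i} ne = trans (φ-⊞ u v i i₀) (trans (+-cong (bit-≉1 (Tr-bit _) ne) φi₀≈1) (+-identityˡ 1#))

        unshift : ∀ {i} → φ u v i ≈ 1# → ¬ φ u v (i ⊞ i₀) ≈ 1#
        unshift {i} e e′ = 0≉1 (trans (trans (sym 1+1≈0) (trans (+-cong (sym e) (sym φi₀≈1)) (sym (φ-⊞ u v i i₀)))) e′)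

        conics-disjoint : ∀ {i j} → φ u v i ≈ 1# → φ u v j ≈ 1# → ∀ P Q →
          P ∈ conic i → Q ∈ conic j → P ∼ Q → i ≡ j
        conics-disjoint {i} ei ej P Q p q P∼Q = disjointP V traces (φ≈1⇒≢o ei) (φ≈1⇒≢o ej) Q
          (conic-resp i P Q P∼Q p) q

        first≁second : ∀ {i j} (ei : φ u v i ≈ 1#) (ej : φ u v j ≈ 1#) →
          ¬ P₁ (secants i ei) ∼ P₂ (secants j ej)
        first≁second {i} {j} ei ej p = go (conics-disjoint ei ej (P₁ S) (P₂ S′) (conic₁ S) (conic₂ S′) p) ej p
          where
          S = secants i ei
          S′ = secants j ej
          go : ∀ {j} → i ≡ j → (ej : φ u v j ≈ 1#) → ¬ P₁ (secants i ei) ∼ P₂ (secants j ej)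
          go ≡.refl _ = P₁≁P₂ (secants i ei)

        -- Translation by `i₀` exchanges the indices with φ = 1 and φ = 0. The former list first
        -- points of intersection; the latter list second points, those of the conic at the
        -- translated index.
        f′ : ∀ i → Dec (φ u v i ≈ 1#) → ∃ (arc ∩ on L)
        f′ i (yes e) = P₁ S , inj₁ (i , φ≈1⇒≢o e , conic₁ S) , on⇐ (P₁ S) (on-line₁ S)
          where S = secants i e
        f′ i (no ne) = P₂ S , inj₁ (i ⊞ i₀ , φ≈1⇒≢o (shift ne) , conic₂ S) , on⇐ (P₂ S) (on-line₂ S)
          where S = secants (i ⊞ i₀) (shift ne)

        f : Fin d → ∃ (arc ∩ on L)
        f i = f′ i (φ u v i ≟ 1#)

        f′-injective : ∀ i j p r → proj₁ (f′ i p) ∼ proj₁ (f′ j r) → i ≡ j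
        f′-injective i j (yes ei) (yes ej) = conics-disjoint ei ej (P₁ S) (P₁ S′) (conic₁ S) (conic₁ S′)
          where
          S = secants i ei
          S′ = secants j ej
        f′-injective i j (yes ei) (no nj) p = ⊥-elim (first≁second ei (shift nj) p)
        f′-injective i j (no ni) (yes ej) p = ⊥-elim (first≁second ej (shift ni)
          (symP (P₂ (secants (i ⊞ i₀) (shift ni))) (P₁ (secants j ej)) p))
        f′-injective i j (no ni) (no nj) p =
          ⊞-cancel (conics-disjoint (shift ni) (shift nj) (P₂ S) (P₂ S′) (conic₂ S) (conic₂ S′) p)
          where
          S = secants (i ⊞ i₀) (shift ni)
          S′ = secants (j ⊞ i₀) (shift nj)

        f-first : ∀ {i} (e : φ u v i ≈ 1#) p → P₁ (secants i e) ∼ proj₁ (f′ i p)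
        f-first {i} e (yes _) = ∼-refl {P₁ (secants i e)}
        f-first {i} e (no ne) = ⊥-elim (ne e)

        f-second : ∀ {i j} (e : φ u v i ≈ 1#) → j ⊞ i₀ ≡ i → ∀ p → P₂ (secants i e) ∼ proj₁ (f′ j p)
        f-second {_} {j} e ≡.refl (yes e′) = ⊥-elim (unshift e′ e)
        f-second {_} {j} e ≡.refl (no ne) = ∼-refl {P₂ (secants (j ⊞ i₀) e)}

        f-surjective : ∀ P → P ∈ arc ∩ on L → ∃ λ i → P ∼ proj₁ (f i)
        f-surjective P (inj₂ P∼F₀ , P∈L) = ⊥-elim (F₀∉L P P∼F₀ P∈L)
        f-surjective P (inj₁ (i , i≢o , e) , P∈L) =
          Sum.[ (λ p → i , transP P (P₁ S) (proj₁ (f i)) p (f-first φi≈1 (φ u v i ≟ 1#)))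
              , (λ p → i ⊞ i₀ , transP P (P₂ S) (proj₁ (f (i ⊞ i₀))) p (f-second φi≈1 (cancel-⊞ i i₀) (φ u v (i ⊞ i₀) ≟ 1#)))
              ]′ (complete S P (on⇒ P P∈L) e)
          where
          φi≈1 = φ≈1 P i≢o e P∈L
          S = secants i φi≈1

        cardinality : HasCardinality (arc ∩ on L) d
        cardinality = enumerate f (λ i j → f′-injective i j (φ u v i ≟ 1#) (φ u v j ≟ 1#)) f-surjective

    arc-intersections : ∀ L → Empty (arc ∩ on L) ⊎ HasCardinality (arc ∩ on L) d
    arc-intersections L = Sum.[ (λ L₂≈0 → inj₂ (ThroughF₀.cardinality V traces L L₂≈0)) , notThrough ]′
      (toSum (coords L 2F ≟ 0#))
      where
      notThrough : ¬ coords L 2F ≈ 0# → Empty (arc ∩ on L) ⊎ HasCardinality (arc ∩ on L) d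
      notThrough L₂≉0 = Sum.[ (λ (i₀ , e) → inj₂ (Enumeration.cardinality e (secants e)))
                            , (λ ¬e → inj₁ λ P (P∈arc , P∈L) → external
                                (λ i → bit-≉1 (Tr-bit (ω u v i)) λ e → ¬e (i , e)) P P∈arc (on⇒ P P∈L)) ]′
        (toSum (Fin.any? (λ i → φ u v i ≟ 1#)))
        where
        open NotThroughF₀ L L₂≉0
        open Slopes L L₂≉0

                                                                         
    arc-proper : ∀ {i} → i ≢ o → ∃ λ P → P ∉ arc
    arc-proper i≢o = E , λ
      { (inj₁ (i , i≢o , e)) → 0≉1 (trans (sym Tr-0) (trans
          (Tr-cong (sym (0x*y≈0 (0x*y≈0 (a≈0 i e))))) (traces i i≢o)))
      ; (inj₂ (k , _ , e)) → 1≉0 (trans (e 0F) (zeroʳ k)) }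
      where
      -- On a conic through (1, 0, 0) the coefficient a is 0, so its trace would be 0 instead of 1.
      E = point (1# ∷ 0# ∷ 0# ∷ []) λ e → 1≉0 (e 0F)
      a≈0 : ∀ i → E ∈ conic i → a i ≈ 0#
      a≈0 i e = trans (solve 3 (λ a b l → a := a :* (con true :* con true) :+ l :* (con true :* con false)
        :+ b :* (con false :* con false) :+ l :* l :* (con false :* con false)) refl (a i) (b i) (l i)) e

    arc-isMaximalArc : d ≢ 1 → d ≢ q → ∀ {i} → i ≢ o → IsMaximalArc d arc
    arc-isMaximalArc d≢1 d≢q i≢o = record
      { respects = λ {P} {Q} → arc-resp {P} {Q}
      ; nonempty = F₀ , inj₂ (∼-refl {F₀})
      ; proper = arc-proper i≢o
      ; intersections = arc-intersections
      ; notSinglePoint = d≢1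
      ; notAffinePlane = d≢q
      }

-- Lines through a point, changes of coordinates, and closed sets as pencils.

module Coordinates {h : ℕ} {c ℓ : Level} (F : GaloisField₂ h c ℓ) where

  open FiniteField F
  open TraceForm F
  open Plane F
  open Pencils F
  open MathonArcs F
  open ≈-Reasoning setoid
  open Char2Solver using (solve; _:=_; _:+_; _:*_; con)

                                                                           
                                      
  -- With p x + r y = 1, the lines of slopes z p + t y and z r + t x all pass through the point.
  -- Passing from 0 to t changes φ at i by Tr(t² ψ i), since the other new terms m² + m, with m = l
  -- z t, have trace 0. Off the conics ψ vanishes only at `o`, so `represent` supplies a t that
  -- turns φ into the prescribed homomorphism.
  lineThrough : ∀ {θ} → Tr θ ≈ 1# → ∀ {d} (V : Pencil d) (let open Pencil V) → ∀ {x y z} →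
    ¬ (x ≈ 0# × y ≈ 0#) → (∀ i → i ≢ o → ¬ ψ i x y z ≈ 0#) →
    (f : Fin d → Carrier) → (∀ i → Bit (f i)) → f o ≈ 0# → (∀ i j → f (i ⊞ j) ≈ f i + f j) →
    ∃₂ λ u v → z ≈ u * x + v * y × ∀ i → φ u v i ≈ f i
  lineThrough Trθ≈1 {d} V {x} {y} {z} xy≉0 ψ≉0 f f-bit f-o f-⊞ = z * p + t * y , z * r + t * x , z≈ , φ≈f
    where
    open Pencil V
    p = proj₁ (bezout xy≉0)
    r = proj₁ (proj₂ (bezout xy≉0))
    px+ry≈1 : p * x + r * y ≈ 1#
    px+ry≈1 = proj₂ (proj₂ (bezout xy≉0))
    g k : Fin d → Carrier
    g i = ψ i x y z
    k i = φ (z * p) (z * r) i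
    f+k-bit : ∀ i → Bit (f i + k i)
    f+k-bit i = bit-+ (f-bit i) (Tr-bit _)
    g≈0⇒ : ∀ i → Dec (i ≡ o) → g i ≈ 0# → f i + k i ≈ 0#
    g≈0⇒ i (yes ≡.refl) _ = 0+0≈0 f-o (φ-o _ _)
    g≈0⇒ i (no i≢o) e = ⊥-elim (ψ≉0 i i≢o e)
    w-ok = Duality.represent Trθ≈1 _⊞_ o g (λ i → f i + k i) (λ i j → ψ-⊞ i j x y z)
      (λ i j → trans (+-cong (f-⊞ i j) (φ-⊞ _ _ i j))
        (solve 4 (λ a b c d → a :+ b :+ (c :+ d) := a :+ c :+ (b :+ d)) refl _ _ _ _))
      (ψ-o x y z) (0+0≈0 f-o (φ-o _ _)) f+k-bit (λ i → g≈0⇒ i (i Fin.≟ o))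
    w = proj₁ w-ok
    -- Only t² enters φ, and every element is a square.
    t = proj₁ (sqrt w)
    t²≈w : t * t ≈ w
    t²≈w = proj₂ (sqrt w)
    z≈ : z ≈ (z * p + t * y) * x + (z * r + t * x) * y
    z≈ = begin
      z                         ≈⟨ *-identityʳ z ⟨
      z * 1#                    ≈⟨ *-congˡ px+ry≈1 ⟨
      z * (p * x + r * y)
        ≈⟨ solve 6 (λ p r t x y z → z :* (p :* x :+ r :* y) := (z :* p :+ t :* y) :* x :+ (z :* r :+ t :* x) :* y)
             refl p r t x y z ⟩
      (z * p + t * y) * x + (z * r + t * x) * y  ∎
    φ≈f : ∀ i → φ (z * p + t * y) (z * r + t * x) i ≈ f i
    φ≈f i = begin
      φ (z * p + t * y) (z * r + t * x) i
        ≈⟨ Tr-cong (solve 9 (λ a b l p r t x y z →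
             a :* ((z :* r :+ t :* x) :* (z :* r :+ t :* x)) :+ b :* ((z :* p :+ t :* y) :* (z :* p :+ t :* y))
               :+ l :* ((z :* p :+ t :* y) :* (z :* r :+ t :* x))
             := (a :* (z :* r :* (z :* r)) :+ b :* (z :* p :* (z :* p)) :+ l :* (z :* p :* (z :* r)))
                :+ (t :* t :* (a :* (x :* x) :+ l :* (x :* y) :+ b :* (y :* y) :+ l :* l :* (z :* z))
                :+ (l :* z :* t :* (l :* z :* t) :+ l :* z :* t :* (p :* x :+ r :* y)))) refl
             (a i) (b i) (l i) p r t x y z) ⟩
      Tr (ω (z * p) (z * r) i + (t * t * g i + (m * m + m * (p * x + r * y))))
        ≈⟨ trans (Tr-+ _ _) (+-congˡ (trans (Tr-+ _ _) (+-congˡ (Tr-+ _ _)))) ⟩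
      k i + (Tr (t * t * g i) + (Tr (m * m) + Tr (m * (p * x + r * y))))
        ≈⟨ +-congˡ (+-cong (trans (Tr-cong (*-congʳ t²≈w)) (proj₂ w-ok i))
             (trans (+-cong (Tr-square m) (Tr-cong (trans (*-congˡ px+ry≈1) (*-identityʳ m)))) (x+x≈0 _))) ⟩
      k i + (f i + k i + 0#)
        ≈⟨ solve 2 (λ k f → k :+ (f :+ k :+ con false) := f) refl (k i) (f i) ⟩
      f i ∎
      where m = l i * z * t

  inv : Invertible → Invertible
  inv A = record
    { matrix = inverse A ; inverse = matrix A ; inverseₗ = inverseᵣ A ; inverseᵣ = inverseₗ A }

  ∙-cong : ∀ u {v w : Triple} → (∀ i → v i ≈ w i) → u ∙ v ≈ u ∙ w
  ∙-cong u e = +-cong (*-congˡ (e 0F)) (+-cong (*-congˡ (e 1F)) (+-cong (*-congˡ (e 2F)) refl))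

  ∙-* : ∀ u k v → u ∙ (k *ᵥ v) ≈ k * (u ∙ v)
  ∙-* u k v = solve 7 (λ a b c k x y z →
    a :* (k :* x) :+ (b :* (k :* y) :+ (c :* (k :* z) :+ con false))
    := k :* (a :* x :+ (b :* y :+ (c :* z :+ con false)))) refl
    (u 0F) (u 1F) (u 2F) k (v 0F) (v 1F) (v 2F)

  ∙-+ : ∀ u v w → u ∙ (v +ᵥ w) ≈ u ∙ v + u ∙ w
  ∙-+ u v w = solve 9 (λ a b c x y z x′ y′ z′ →
    a :* (x :+ x′) :+ (b :* (y :+ y′) :+ (c :* (z :+ z′) :+ con false))
    := a :* x :+ (b :* y :+ (c :* z :+ con false)) :+ (a :* x′ :+ (b :* y′ :+ (c :* z′ :+ con false)))) refl
    (u 0F) (u 1F) (u 2F) (v 0F) (v 1F) (v 2F) (w 0F) (w 1F) (w 2F)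

  basis : Fin 3 → Triple
  basis 0F = 1# ∷ 0# ∷ 0# ∷ []
  basis 1F = 0# ∷ 1# ∷ 0# ∷ []
  basis 2F = 0# ∷ 0# ∷ 1# ∷ []

  ∙-basis : ∀ u i → u ∙ basis i ≈ u i
  ∙-basis u 0F = solve 3 (λ x y z →
    x :* con true :+ (y :* con false :+ (z :* con false :+ con false)) := x) refl
    (u 0F) (u 1F) (u 2F)
  ∙-basis u 1F = solve 3 (λ x y z →
    x :* con false :+ (y :* con true :+ (z :* con false :+ con false)) := y) refl
    (u 0F) (u 1F) (u 2F)
  ∙-basis u 2F = solve 3 (λ x y z →
    x :* con false :+ (y :* con false :+ (z :* con true :+ con false)) := z) refl
    (u 0F) (u 1F) (u 2F)

  transform-∼ : ∀ A P Q → P ∼ Q → transform A P ∼ transform A Q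
  transform-∼ A P Q (k , k≉0 , e) = k , k≉0 , λ i → trans (∙-cong (matrix A i) e) (∙-* (matrix A i) k (coords Q))

  ≋⇒∼ : ∀ P Q → (∀ i → coords P i ≈ coords Q i) → P ∼ Q
  ≋⇒∼ P Q e = 1# , 1≉0 , λ i → trans (e i) (sym (*-identityˡ _))

  transform-inv : ∀ A P → transform A (transform (inv A) P) ∼ P
  transform-inv A P = ≋⇒∼ (transform A (transform (inv A) P)) P (inverseᵣ A (coords P))

  inv-transform : ∀ A P → transform (inv A) (transform A P) ∼ P
  inv-transform A P = ≋⇒∼ (transform (inv A) (transform A P)) P (inverseₗ A (coords P))

  on-resp : ∀ L P Q → P ∼ Q → P ∈ on L → Q ∈ on L
  on-resp L P Q (k , k≉0 , e) P∈L = cancel k≉0 (trans (sym (∙-* (coords L) k (coords Q)))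
    (trans (sym (∙-cong (coords L) e)) P∈L))

  rowProduct : Triple → Matrix → Triple
  rowProduct u B j = u ∙ (λ i → B i j)

  rowProduct-∙ : ∀ u B w → rowProduct u B ∙ w ≈ u ∙ apply B w
  rowProduct-∙ u B w = solve 15 (λ u₀ u₁ u₂ a b c d e f g h i x y z →
    (u₀ :* a :+ (u₁ :* d :+ (u₂ :* g :+ con false))) :* x
      :+ ((u₀ :* b :+ (u₁ :* e :+ (u₂ :* h :+ con false))) :* y
      :+ ((u₀ :* c :+ (u₁ :* f :+ (u₂ :* i :+ con false))) :* z :+ con false))
    := u₀ :* (a :* x :+ (b :* y :+ (c :* z :+ con false)))
      :+ (u₁ :* (d :* x :+ (e :* y :+ (f :* z :+ con false)))
      :+ (u₂ :* (g :* x :+ (h :* y :+ (i :* z :+ con false))) :+ con false))) refl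
    (u 0F) (u 1F) (u 2F) (B 0F 0F) (B 0F 1F) (B 0F 2F) (B 1F 0F) (B 1F 1F) (B 1F 2F)
    (B 2F 0F) (B 2F 1F) (B 2F 2F) (w 0F) (w 1F) (w 2F)

  -- A line is a row vector, so it moves by right multiplication with the inverse matrix.
  image : Invertible → Line → Line
  image A L = point (rowProduct (coords L) (inverse A)) λ e → nonzero L λ i → begin
    coords L i                                             ≈⟨ ∙-basis (coords L) i ⟨
    coords L ∙ basis i                                        ≈⟨ ∙-cong (coords L) (inverseₗ A (basis i)) ⟨
    coords L ∙ apply (inverse A) (apply (matrix A) (basis i))
      ≈⟨ rowProduct-∙ (coords L) (inverse A) (apply (matrix A) (basis i)) ⟨
    rowProduct (coords L) (inverse A) ∙ apply (matrix A) (basis i)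
      ≈⟨ 0+0≈0 (0x*y≈0 (e 0F)) (0+0≈0 (0x*y≈0 (e 1F)) (0+0≈0 (0x*y≈0 (e 2F)) refl)) ⟩
    0#                                                     ∎

  image-∙ : ∀ A L v → coords (image A L) ∙ apply (matrix A) v ≈ coords L ∙ v
  image-∙ A L v = trans (rowProduct-∙ (coords L) (inverse A) (apply (matrix A) v)) (∙-cong (coords L) (inverseₗ A v))

  on⇒image : ∀ A L P → P ∈ on L → transform A P ∈ on (image A L)
  on⇒image A L P = trans (image-∙ A L (coords P))

  image⇒on : ∀ A L P → transform A P ∈ on (image A L) → P ∈ on L
  image⇒on A L P = trans (sym (image-∙ A L (coords P)))

  cardinality-⊢ : ∀ A (S : PointSet) → (∀ {P Q} → P ∼ Q → P ∈ S → Q ∈ S) → ∀ L {d} →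
    HasCardinality (S ∩ on (image A L)) d → HasCardinality ((transform A ⊢ S) ∩ on L) d
  cardinality-⊢ A S resp L {d} card = enumerate f injective surjective
    where
    module C = Inverse card
    f : Fin d → ∃ ((transform A ⊢ S) ∩ on L)
    f i = transform (inv A) P , resp {P} {AA⁻¹P} (symP AA⁻¹P P (transform-inv A P)) (proj₁ (proj₂ (C.to i))) ,
      image⇒on A L (transform (inv A) P) (on-resp (image A L) P AA⁻¹P (symP AA⁻¹P P (transform-inv A P)) (proj₂ (proj₂ (C.to i))))
      where
      P = proj₁ (C.to i)
      AA⁻¹P = transform A (transform (inv A) P)
    injective : ∀ i j → proj₁ (f i) ∼ proj₁ (f j) → i ≡ j
    injective i j p = ≡.trans (≡.sym (C.strictlyInverseʳ i)) (≡.trans (C.from-cong {C.to i} {C.to j} P∼Q) (C.strictlyInverseʳ j))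
      where
      P = proj₁ (C.to i)
      Q = proj₁ (C.to j)
      P∼Q : P ∼ Q
      P∼Q = transP P (transform A (proj₁ (f i))) Q (symP (transform A (proj₁ (f i))) P (transform-inv A P))
        (transP (transform A (proj₁ (f i))) (transform A (proj₁ (f j))) Q
          (transform-∼ A (proj₁ (f i)) (proj₁ (f j)) p) (transform-inv A Q))
    surjective : ∀ P → P ∈ (transform A ⊢ S) ∩ on L → ∃ λ i → P ∼ proj₁ (f i)
    surjective P (AP∈S , P∈L) = i , transP P A⁻¹AP (proj₁ (f i)) (symP A⁻¹AP P (inv-transform A P))
      (transform-∼ (inv A) AP (proj₁ (C.to i)) (symP (proj₁ (C.to i)) AP (C.strictlyInverseˡ x)))
      where
      AP = transform A P
      A⁻¹AP = transform (inv A) AP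
      x : ∃ (S ∩ on (image A L))
      x = AP , AP∈S , on⇒image A L P P∈L
      i = C.from x

  isMaximalArc-⊢ : ∀ A {d S} → IsMaximalArc d S → IsMaximalArc d (transform A ⊢ S)
  isMaximalArc-⊢ A {d} {S} arc = record
    { respects = λ {P} {Q} p → respects {transform A P} {transform A Q} (transform-∼ A P Q p)
    ; nonempty = let P , P∈S = nonempty in transform (inv A) P , back P P∈S
    ; proper = let P , P∉S = proper in transform (inv A) P , λ e →
        P∉S (respects {transform A (transform (inv A) P)} {P} (transform-inv A P) e)
    ; intersections = λ L → Sum.map
        (λ empty P (p , e) → empty (transform A P) (p , on⇒image A L P e))
        (cardinality-⊢ A S (λ {P} {Q} → respects {P} {Q}) L) (intersections (image A L))
    ; notSinglePoint = notSinglePoint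
    ; notAffinePlane = notAffinePlane
    }
    where
    open IsMaximalArc arc
    back : ∀ P → P ∈ S → transform A (transform (inv A) P) ∈ S
    back P = respects {P} {transform A (transform (inv A) P)} (symP (transform A (transform (inv A) P)) P (transform-inv A P))

  Ψₚ : ConicParameters → Triple → Carrier
  Ψₚ (params α β l) v = Ψ (α * l) (β * l) l (v 0F) (v 1F) (v 2F)

  Ψₚ-eval : ∀ α β l v → Ψₚ (params α β l) v ≈ l * eval (quadraticForm α β l 0# 0# 1#) v
  Ψₚ-eval α β l v = solve 6 (λ α β l x y z →
    α :* l :* (x :* x) :+ l :* (x :* y) :+ β :* l :* (y :* y) :+ l :* l :* (z :* z)
    := l :* (α :* (x :* x) :+ β :* (y :* y) :+ l :* (z :* z) :+ con false :* (y :* z)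
         :+ con false :* (x :* z) :+ con true :* (x :* y))) refl α β l (v 0F) (v 1F) (v 2F)

  F⇒Ψ : ∀ p P → P ∈ F⟨ p ⟩ → Ψₚ p (coords P) ≈ 0#
  F⇒Ψ p@(params α β l) P e = trans (Ψₚ-eval α β l (coords P)) (x*0y≈0 e)

  Ψ⇒F : ∀ p P → ¬ lam p ≈ 0# → Ψₚ p (coords P) ≈ 0# → P ∈ F⟨ p ⟩
  Ψ⇒F p@(params α β l) P l≉0 e = cancel l≉0 (trans (sym (Ψₚ-eval α β l (coords P))) e)

  x/y*y≈x : ∀ {x y} → ¬ y ≈ 0# → x * y ⁻¹ * y ≈ x
  x/y*y≈x y≉0 = trans (*-assoc _ _ _) (trans (*-congˡ (inverseˡ y≉0)) (*-identityʳ _))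

  x*y/y≈x : ∀ {x y} → ¬ y ≈ 0# → x * y * y ⁻¹ ≈ x
  x*y/y≈x y≉0 = trans (*-assoc _ _ _) (trans (*-congˡ (inverseʳ y≉0)) (*-identityʳ _))

  module FromClosedSet {k} (C : ClosedSet k) where
    open ClosedSet C

    add : Fin (suc k) → Fin (suc k) → Fin (suc k)
    add zero j = j
    add (suc i) zero = suc i
    add (suc i) (suc j) with i Fin.≟ j
    ... | yes _ = zero
    ... | no i≢j = suc (proj₁ (closed i≢j))

    extend : (ConicParameters → Carrier) → Fin (suc k) → Carrier
    extend f zero = 0#
    extend f (suc i) = f (member i)

    extend-add : (f : ConicParameters → Carrier) → (∀ {s t} → s ≈ₚ t → f s ≈ f t) →
      (∀ s t → ¬ lam s + lam t ≈ 0# → f (s ⊕ t) ≈ f s + f t) →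
      ∀ i j → extend f (add i j) ≈ extend f i + extend f j
    extend-add f f-cong f-⊕ zero j = sym (+-identityˡ _)
    extend-add f f-cong f-⊕ (suc i) zero = sym (+-identityʳ _)
    extend-add f f-cong f-⊕ (suc i) (suc j) with i Fin.≟ j
    ... | yes ≡.refl = sym (x+x≈0 _)
    ... | no i≢j = trans (sym (f-cong (proj₂ (closed i≢j))))
      (f-⊕ (member i) (member j) (λ e → i≢j (lam-injective (x+y≈0⇒x≈y e))))

    lam-extend-injective : ∀ {i j} → extend lam i ≈ extend lam j → i ≡ j
    lam-extend-injective {zero} {zero} e = ≡.refl
    lam-extend-injective {zero} {suc j} e = ⊥-elim (lam≉0 j (sym e))
    lam-extend-injective {suc i} {zero} e = ⊥-elim (lam≉0 i e)
    lam-extend-injective {suc i} {suc j} e = ≡.cong suc (lam-injective e)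

    -- Multiplying by λ + λ′ clears the denominators of the composition and leaves the plain sums of
    -- αλ, βλ and λ. The zero triple takes the new index.
    pencil : Pencil (suc k)
    pencil = record
      { a = extend (λ p → α p * lam p) ; b = extend (λ p → β p * lam p) ; l = extend lam
      ; o = zero ; a-o = refl ; b-o = refl ; l-o = refl
      ; _⊞_ = add
      ; a-⊞ = extend-add (λ p → α p * lam p) (λ (eα , _ , el) → *-cong eα el) (λ s t → x/y*y≈x)
      ; b-⊞ = extend-add (λ p → β p * lam p) (λ (_ , eβ , el) → *-cong eβ el) (λ s t → x/y*y≈x)
      ; l-⊞ = extend-add lam (λ (_ , _ , el) → el) (λ s t _ → refl)
      ; l-inj = lam-extend-injective
      }

    traces : Traces pencil
    traces zero i≢o = ⊥-elim (i≢o ≡.refl)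
    traces (suc i) _ = trans (Tr-cong (*-cong (x*y/y≈x (lam≉0 i)) (x*y/y≈x (lam≉0 i)))) (trace i)

    open Pencil pencil using (conic)

    F⇒conic : ∀ i P → P ∈ F⟨ member i ⟩ → P ∈ conic (suc i)
    F⇒conic i P = F⇒Ψ (member i) P

    conic⇒F : ∀ i P → P ∈ conic (suc i) → P ∈ F⟨ member i ⟩
    conic⇒F i P = Ψ⇒F (member i) P (lam≉0 i)

  module ToClosedSet {k} (V : Pencil (suc k)) (traces : Traces V) where
    open Pencil V

    ι : Fin k → Fin (suc k)
    ι = punchIn o

    ι≢o : ∀ i → ι i ≢ o
    ι≢o i = Fin.punchInᵢ≢i o i

    param : Fin (suc k) → ConicParameters
    param i = params (a i * l i ⁻¹) (b i * l i ⁻¹) (l i)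

    param-⊞ : ∀ i j → i ≢ o → j ≢ o → i ≢ j → param i ⊕ param j ≈ₚ param (i ⊞ j)
    param-⊞ i j i≢o j≢o i≢j = div (a-⊞ i j) , div (b-⊞ i j) , sym (l-⊞ i j)
      where
      div : ∀ {x y z} → z ≈ x + y → (x * l i ⁻¹ * l i + y * l j ⁻¹ * l j) * (l i + l j) ⁻¹ ≈ z * l (i ⊞ j) ⁻¹
      div e = *-cong (trans (+-cong (x/y*y≈x (l≉0 i≢o)) (x/y*y≈x (l≉0 j≢o))) (sym e)) (⁻¹-cong (sym (l-⊞ i j)))

    ⊞≢o : ∀ {i j} → i ≢ j → i ⊞ j ≢ o
    ⊞≢o {i} {j} i≢j e = i≢j (l-inj (x+y≈0⇒x≈y (trans (sym (l-⊞ i j)) (trans (reflexive (≡.cong l e)) l-o))))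

    closedSet : ClosedSet k
    closedSet = record
      { member = λ i → param (ι i)
      ; trace = λ i → traces (ι i) (ι≢o i)
      ; lam≉0 = λ i → l≉0 (ι≢o i)
      ; lam-injective = λ {i} {j} e → Fin.punchIn-injective o i j (l-inj e)
      ; closed = λ {i} {j} i≢j →
          let ιi≢ιj = i≢j ∘ Fin.punchIn-injective o i j
              o≢⊞ = ⊞≢o ιi≢ιj ∘ ≡.sym
          in punchOut o≢⊞ , ≡.subst (λ m → param (ι i) ⊕ param (ι j) ≈ₚ param m)
               (≡.sym (Fin.punchIn-punchOut o≢⊞)) (param-⊞ (ι i) (ι j) (ι≢o i) (ι≢o j) ιi≢ιj)
      }

    Ψₚ≈ψ : ∀ i → i ≢ o → ∀ v → Ψₚ (param i) v ≈ ψ i (v 0F) (v 1F) (v 2F)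
    Ψₚ≈ψ i i≢o v = Ψ-cong (x/y*y≈x (l≉0 i≢o)) (x/y*y≈x (l≉0 i≢o)) refl refl refl refl

    isMathonArc : ∀ A → ℕ.NonZero k → suc k ≢ q → IsMathonArc (suc k) (transform A ⊢ arc)
    isMathonArc A k≢0 d≢q = record
      { isMaximalArc = isMaximalArc-⊢ A (arc-isMaximalArc V traces
          (ℕ.≢-nonZero⁻¹ k {{k≢0}} ∘ ℕ.suc-injective) d≢q (ι≢o (some k k≢0)))
      ; size = k
      ; size-nonZero = k≢0
      ; degree = ≡.refl
      ; closedSet = closedSet
      ; coordinates = A
      ; decomposition =
          (λ { {P} (inj₁ (i , i≢o , e)) → inj₁ (conic⇒ P (i≢o ∘ ≡.sym) (i≢o , e))
             ; {P} (inj₂ AP∼F₀) → inj₂ AP∼F₀ }) ,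
          (λ { {P} (inj₁ (j , e)) → inj₁ (ι j , ι≢o j , trans (sym (Ψₚ≈ψ (ι j) (ι≢o j) (apply (matrix A) (coords P))))
                 (F⇒Ψ (param (ι j)) (transform A P) e))
             ; {P} (inj₂ AP∼F₀) → inj₂ AP∼F₀ })
      }
      where
      some : ∀ k → ℕ.NonZero k → Fin k
      some (suc k) _ = zero
      conic⇒ : ∀ P {i} (o≢i : o ≢ i) → i ≢ o × transform A P ∈ conic i →
        ∃ λ j → transform A P ∈ F⟨ param (ι j) ⟩
      conic⇒ P o≢i (i≢o , e) = punchOut o≢i , ≡.subst (λ m → transform A P ∈ F⟨ param m ⟩)
        (≡.sym (Fin.punchIn-punchOut o≢i))
        (Ψ⇒F (param _) (transform A P) (l≉0 i≢o) (trans (Ψₚ≈ψ _ i≢o (apply (matrix A) (coords P))) e))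

  module OfMathonArc {d M} (mathon : IsMathonArc d M) where
    open IsMathonArc mathon public using (size; closedSet; coordinates; decomposition; degree; size-nonZero)
    open FromClosedSet closedSet public
    open Pencil pencil

    M⊆arc : ∀ P → P ∈ M → transform coordinates P ∈ arc
    M⊆arc P P∈M = Sum.map (λ (i , e) → suc i , (λ ()) , F⇒conic i (transform coordinates P) e) (λ p → p)
      (proj₁ decomposition P∈M)

    arc⊆M : ∀ P → transform coordinates P ∈ arc → P ∈ M
    arc⊆M P (inj₁ (zero , i≢o , e)) = ⊥-elim (i≢o ≡.refl)
    arc⊆M P (inj₁ (suc i , i≢o , e)) = proj₂ decomposition (inj₁ (i , conic⇒F i (transform coordinates P) e))
    arc⊆M P (inj₂ p) = proj₂ decomposition (inj₂ p)

-- Nuclei of conics, and the equation of a conic with a given nucleus.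

module Nuclei {h : ℕ} {c ℓ : Level} (F : GaloisField₂ h c ℓ) where

  open FiniteField F
  open TraceForm F
  open Plane F
  open Pencils F
  open Coordinates F
  open ≈-Reasoning setoid
  open Char2Solver using (solve; _:=_; _:+_; _:*_; _:-_; con; Polynomial)

  cross : Triple → Triple → Triple
  cross v w = v 1F * w 2F + v 2F * w 1F ∷ v 0F * w 2F + v 2F * w 0F ∷ v 0F * w 1F + v 1F * w 0F ∷ []

                                                                             
  -- In characteristic 2 the polar form at v, w is the determinant of ν, v, w. A nonzero ν therefore
  -- spans its radical and is the algebraic nucleus.
  ν : QuadraticForm → Triple
  ν (quadraticForm _ _ _ b₁ b₂ b₃) = b₁ ∷ b₂ ∷ b₃ ∷ []

  eval-cong : ∀ Q {v w : Triple} → (∀ i → v i ≈ w i) → eval Q v ≈ eval Q w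
  eval-cong (quadraticForm _ _ _ _ _ _) {v} {w} e =
    +-cong (+-cong (+-cong (+-cong (+-cong (m 0F 0F) (m 1F 1F)) (m 2F 2F)) (m 1F 2F)) (m 0F 2F)) (m 0F 1F)
    where
    m : ∀ {a} i j → a * (v i * v j) ≈ a * (w i * w j)
    m i j = *-congˡ (*-cong (e i) (e j))

  private
    Eval : ∀ {n} (a₁ a₂ a₃ b₁ b₂ b₃ x y z : Polynomial n) → Polynomial n
    Eval a₁ a₂ a₃ b₁ b₂ b₃ x y z =
      a₁ :* (x :* x) :+ a₂ :* (y :* y) :+ a₃ :* (z :* z) :+ b₁ :* (y :* z) :+ b₂ :* (x :* z) :+ b₃ :* (x :* y)

    Det : ∀ {n} (b₁ b₂ b₃ x y z x′ y′ z′ : Polynomial n) → Polynomial n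
    Det b₁ b₂ b₃ x y z x′ y′ z′ =
      b₁ :* (y :* z′ :+ z :* y′) :+ (b₂ :* (x :* z′ :+ z :* x′) :+ (b₃ :* (x :* y′ :+ y :* x′) :+ con false))

  eval-combination : ∀ Q s v t w →
    eval Q ((s *ᵥ v) +ᵥ (t *ᵥ w)) ≈ s * s * eval Q v + t * t * eval Q w + s * t * (ν Q ∙ cross v w)
  eval-combination (quadraticForm a₁ a₂ a₃ b₁ b₂ b₃) s v t w =
    solve 14 (λ a₁ a₂ a₃ b₁ b₂ b₃ s t x y z x′ y′ z′ →
      Eval a₁ a₂ a₃ b₁ b₂ b₃ (s :* x :+ t :* x′) (s :* y :+ t :* y′) (s :* z :+ t :* z′)
      := s :* s :* Eval a₁ a₂ a₃ b₁ b₂ b₃ x y z :+ t :* t :* Eval a₁ a₂ a₃ b₁ b₂ b₃ x′ y′ z′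
         :+ s :* t :* Det b₁ b₂ b₃ x y z x′ y′ z′) refl
      a₁ a₂ a₃ b₁ b₂ b₃ s t (v 0F) (v 1F) (v 2F) (w 0F) (w 1F) (w 2F)

  eval-* : ∀ Q k v → eval Q (k *ᵥ v) ≈ k * k * eval Q v
  eval-* (quadraticForm a₁ a₂ a₃ b₁ b₂ b₃) k v =
    solve 10 (λ a₁ a₂ a₃ b₁ b₂ b₃ k x y z →
      Eval a₁ a₂ a₃ b₁ b₂ b₃ (k :* x) (k :* y) (k :* z) := k :* k :* Eval a₁ a₂ a₃ b₁ b₂ b₃ x y z) refl
      a₁ a₂ a₃ b₁ b₂ b₃ k (v 0F) (v 1F) (v 2F)

  polar-ν : ∀ Q v w → polar Q v w ≈ ν Q ∙ cross v w
  polar-ν (quadraticForm a₁ a₂ a₃ b₁ b₂ b₃) v w =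
    solve 12 (λ a₁ a₂ a₃ b₁ b₂ b₃ x y z x′ y′ z′ →
      Eval a₁ a₂ a₃ b₁ b₂ b₃ (x :+ x′) (y :+ y′) (z :+ z′)
        :- Eval a₁ a₂ a₃ b₁ b₂ b₃ x y z :- Eval a₁ a₂ a₃ b₁ b₂ b₃ x′ y′ z′
      := Det b₁ b₂ b₃ x y z x′ y′ z′) refl
      a₁ a₂ a₃ b₁ b₂ b₃ (v 0F) (v 1F) (v 2F) (w 0F) (w 1F) (w 2F)

  det-rotate : ∀ u v w → u ∙ cross v w ≈ cross u w ∙ v
  det-rotate u v w = solve 9 (λ a b c x y z x′ y′ z′ → Det a b c x y z x′ y′ z′
    := (b :* z′ :+ c :* y′) :* x :+ ((a :* z′ :+ c :* x′) :* y :+ ((a :* y′ :+ b :* x′) :* z :+ con false))) refl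
    (u 0F) (u 1F) (u 2F) (v 0F) (v 1F) (v 2F) (w 0F) (w 1F) (w 2F)

  det-alternating : ∀ u v → u ∙ cross u v ≈ 0#
  det-alternating u v = solve 6 (λ a b c x y z → Det a b c a b c x y z := con false) refl
    (u 0F) (u 1F) (u 2F) (v 0F) (v 1F) (v 2F)

  det-alternating′ : ∀ u v → u ∙ cross v u ≈ 0#
  det-alternating′ u v = solve 6 (λ a b c x y z → Det a b c x y z a b c := con false) refl
    (u 0F) (u 1F) (u 2F) (v 0F) (v 1F) (v 2F)

  det-cong : ∀ u {v v′ w w′ : Triple} → (∀ i → v i ≈ v′ i) → (∀ i → w i ≈ w′ i) →
    u ∙ cross v w ≈ u ∙ cross v′ w′
  det-cong u {v} {v′} {w} {w′} e f = ∙-cong u {cross v w} {cross v′ w′} λ { 0F → m 1F 2F ; 1F → m 0F 2F ; 2F → m 0F 1F }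
    where
    m : ∀ i j → v i * w j + v j * w i ≈ v′ i * w′ j + v′ j * w′ i
    m i j = +-cong (*-cong (e i) (f j)) (*-cong (e j) (f i))

  det-combination : ∀ u x s v t w →
    u ∙ cross x ((s *ᵥ v) +ᵥ (t *ᵥ w)) ≈ s * (u ∙ cross x v) + t * (u ∙ cross x w)
  det-combination u X s v t w = solve 14 (λ a b c s t x y z x′ y′ z′ X Y Z →
    Det a b c X Y Z (s :* x :+ t :* x′) (s :* y :+ t :* y′) (s :* z :+ t :* z′)
    := s :* Det a b c X Y Z x y z :+ t :* Det a b c X Y Z x′ y′ z′) refl
    (u 0F) (u 1F) (u 2F) s t (v 0F) (v 1F) (v 2F) (w 0F) (w 1F) (w 2F) (X 0F) (X 1F) (X 2F)

  cross-basis : ∀ u v i → u ∙ cross v (basis i) ≈ cross u v i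
  cross-basis u v 0F = solve 6 (λ a b c x y z → Det a b c x y z (con true) (con false) (con false)
    := b :* z :+ c :* y) refl (u 0F) (u 1F) (u 2F) (v 0F) (v 1F) (v 2F)
  cross-basis u v 1F = solve 6 (λ a b c x y z → Det a b c x y z (con false) (con true) (con false)
    := a :* z :+ c :* x) refl (u 0F) (u 1F) (u 2F) (v 0F) (v 1F) (v 2F)
  cross-basis u v 2F = solve 6 (λ a b c x y z → Det a b c x y z (con false) (con false) (con true)
    := a :* y :+ b :* x) refl (u 0F) (u 1F) (u 2F) (v 0F) (v 1F) (v 2F)

  cross≈0⇒∼ : ∀ P Q → (∀ i → cross (coords P) (coords Q) i ≈ 0#) → P ∼ Q
  cross≈0⇒∼ P Q e = proportional₃ P Q (x+y≈0⇒x≈y (e 2F)) (x+y≈0⇒x≈y (e 1F)) (x+y≈0⇒x≈y (e 0F))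

                                                              
  -- The linear relation between dependent vectors, with minors as coefficients and no choice of a
  -- nonzero one. For i = j the two sides differ by the determinant, otherwise they agree
  -- identically.
  cramer : ∀ b v w → b ∙ cross v w ≈ 0# → ∀ i j →
    cross v w i * b j ≈ cross b w i * v j + cross v b i * w j
  cramer b v w D≈0 i j = x+y≈0⇒x≈y (go i j)
    where
    go : ∀ i j → cross v w i * b j + (cross b w i * v j + cross v b i * w j) ≈ 0#
    go 0F 0F = trans (solve 9 (λ a b c x y z r s t →
      (y :* t :+ z :* s) :* a :+ ((b :* t :+ c :* s) :* x :+ (y :* c :+ z :* b) :* r)
      := Det a b c x y z r s t) refl
      (b 0F) (b 1F) (b 2F) (v 0F) (v 1F) (v 2F) (w 0F) (w 1F) (w 2F)) D≈0
    go 0F 1F = solve 9 (λ a b c x y z r s t →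
      (y :* t :+ z :* s) :* b :+ ((b :* t :+ c :* s) :* y :+ (y :* c :+ z :* b) :* s)
      := con false) refl
      (b 0F) (b 1F) (b 2F) (v 0F) (v 1F) (v 2F) (w 0F) (w 1F) (w 2F)
    go 0F 2F = solve 9 (λ a b c x y z r s t →
      (y :* t :+ z :* s) :* c :+ ((b :* t :+ c :* s) :* z :+ (y :* c :+ z :* b) :* t)
      := con false) refl
      (b 0F) (b 1F) (b 2F) (v 0F) (v 1F) (v 2F) (w 0F) (w 1F) (w 2F)
    go 1F 0F = solve 9 (λ a b c x y z r s t →
      (x :* t :+ z :* r) :* a :+ ((a :* t :+ c :* r) :* x :+ (x :* c :+ z :* a) :* r)
      := con false) refl
      (b 0F) (b 1F) (b 2F) (v 0F) (v 1F) (v 2F) (w 0F) (w 1F) (w 2F)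
    go 1F 1F = trans (solve 9 (λ a b c x y z r s t →
      (x :* t :+ z :* r) :* b :+ ((a :* t :+ c :* r) :* y :+ (x :* c :+ z :* a) :* s)
      := Det a b c x y z r s t) refl
      (b 0F) (b 1F) (b 2F) (v 0F) (v 1F) (v 2F) (w 0F) (w 1F) (w 2F)) D≈0
    go 1F 2F = solve 9 (λ a b c x y z r s t →
      (x :* t :+ z :* r) :* c :+ ((a :* t :+ c :* r) :* z :+ (x :* c :+ z :* a) :* t)
      := con false) refl
      (b 0F) (b 1F) (b 2F) (v 0F) (v 1F) (v 2F) (w 0F) (w 1F) (w 2F)
    go 2F 0F = solve 9 (λ a b c x y z r s t →
      (x :* s :+ y :* r) :* a :+ ((a :* s :+ b :* r) :* x :+ (x :* b :+ y :* a) :* r)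
      := con false) refl
      (b 0F) (b 1F) (b 2F) (v 0F) (v 1F) (v 2F) (w 0F) (w 1F) (w 2F)
    go 2F 1F = solve 9 (λ a b c x y z r s t →
      (x :* s :+ y :* r) :* b :+ ((a :* s :+ b :* r) :* y :+ (x :* b :+ y :* a) :* s)
      := con false) refl
      (b 0F) (b 1F) (b 2F) (v 0F) (v 1F) (v 2F) (w 0F) (w 1F) (w 2F)
    go 2F 2F = trans (solve 9 (λ a b c x y z r s t →
      (x :* s :+ y :* r) :* c :+ ((a :* s :+ b :* r) :* z :+ (x :* b :+ y :* a) :* t)
      := Det a b c x y z r s t) refl
      (b 0F) (b 1F) (b 2F) (v 0F) (v 1F) (v 2F) (w 0F) (w 1F) (w 2F)) D≈0

  radical⇒∼ν : ∀ Q ν≉0 P → (∀ w → polar Q (coords P) w ≈ 0#) → P ∼ point (ν Q) ν≉0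
  radical⇒∼ν Q ν≉0 P radical = symP N P (cross≈0⇒∼ N P λ i → begin
    cross (ν Q) (coords P) i             ≈⟨ cross-basis (ν Q) (coords P) i ⟨
    ν Q ∙ cross (coords P) (basis i)     ≈⟨ polar-ν Q (coords P) (basis i) ⟨
    polar Q (coords P) (basis i)         ≈⟨ radical (basis i) ⟩
    0#                                   ∎)
    where N = point (ν Q) ν≉0

                                                                               
                                     
  -- With ν = 0 the polar form is zero and Q is the square of a linear form, which has a zero: (√a₂,
  -- √a₁, 0), or (0, 1, 0) when a₂ = 0.
  ν≉0 : ∀ Q → Nondegenerate Q → ¬ (∀ i → ν Q i ≈ 0#)
  ν≉0 Q@(quadraticForm a₁ a₂ a₃ b₁ b₂ b₃) nondegenerate ν≈0 = zero∉ (toSum (a₂ ≟ 0#))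
    where
    polar≈0 : ∀ v w → polar Q v w ≈ 0#
    polar≈0 v w = trans (polar-ν Q v w) (0+0≈0 (0x*y≈0 (ν≈0 0F)) (0+0≈0 (0x*y≈0 (ν≈0 1F)) (0+0≈0 (0x*y≈0 (ν≈0 2F)) refl)))
    s = proj₁ (sqrt a₂)
    t = proj₁ (sqrt a₁)
    s² : s * s ≈ a₂
    s² = proj₂ (sqrt a₂)
    t² : t * t ≈ a₁
    t² = proj₂ (sqrt a₁)
    zero∉ : a₂ ≈ 0# ⊎ ¬ a₂ ≈ 0# → False
    zero∉ (inj₁ a₂≈0) = nondegenerate (point (basis 1F) λ e → 1≉0 (e 1F)) (polar≈0 (basis 1F)) (trans
      (solve 6 (λ a₁ a₂ a₃ b₁ b₂ b₃ → Eval a₁ a₂ a₃ b₁ b₂ b₃ (con false) (con true) (con false) := a₂) refl a₁ a₂ a₃ b₁ b₂ b₃)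
      a₂≈0)
    zero∉ (inj₂ a₂≉0) = nondegenerate (point v λ e → a₂≉0 (trans (sym s²) (0x*y≈0 (e 0F)))) (polar≈0 v) (begin
      eval Q v
        ≈⟨ solve 8 (λ a₁ a₂ a₃ b₁ b₂ b₃ s t → Eval a₁ a₂ a₃ b₁ b₂ b₃ s t (con false)
             := a₁ :* (s :* s) :+ a₂ :* (t :* t) :+ b₃ :* (s :* t)) refl a₁ a₂ a₃ b₁ b₂ b₃ s t ⟩
      a₁ * (s * s) + a₂ * (t * t) + b₃ * (s * t)
        ≈⟨ 0+0≈0 (x≈y⇒x+y≈0 (trans (*-congˡ s²) (trans (*-comm a₁ a₂) (*-congˡ (sym t²))))) (0x*y≈0 (ν≈0 2F)) ⟩
      0# ∎)
      where
      v : Triple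
      v = s ∷ t ∷ 0# ∷ []

  nucleus : ∀ Q → Nondegenerate Q → Point
  nucleus Q nondegenerate = point (ν Q) (ν≉0 Q nondegenerate)

  evalν≉0 : ∀ Q → Nondegenerate Q → ¬ eval Q (ν Q) ≈ 0#
  evalν≉0 Q nondegenerate = nondegenerate (nucleus Q nondegenerate) λ w →
    trans (polar-ν Q (ν Q) w) (det-alternating (ν Q) w)

  module Tangents {p} {K : Pred Point p} (Q : QuadraticForm) (nondegenerate : Nondegenerate Q) (K≐Q : K ≐ zeros Q) where

    private
      b = ν Q
      B≉0 = evalν≉0 Q nondegenerate

                                                                     
                      
    -- Along the line joining b to p there is no cross term: Q(κ b + p) = κ² Q(b) + Q(p), and Q(b)
    -- is nonzero. Bijectivity of squaring leaves exactly one κ, so every line through b is a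
    -- tangent.
    tangent : ∀ (p : Triple) L≉0 → HasCardinality (K ∩ on (point (cross b p) L≉0)) 1
    tangent p L≉0 = enumerate f (λ { 0F 0F _ → ≡.refl }) λ P (P∈K , P∈L) → 0F , unique P (proj₁ K≐Q P∈K) P∈L
      where
      i = eval Q b ⁻¹
      κ = proj₁ (sqrt (eval Q p * i))
      κ² : κ * κ ≈ eval Q p * i
      κ² = proj₂ (sqrt (eval Q p * i))
      v : Triple
      v = (κ *ᵥ b) +ᵥ (1# *ᵥ p)
      det-v : ∀ w → b ∙ cross w v ≈ cross b p ∙ w
      det-v w = begin
        b ∙ cross w v                                ≈⟨ det-combination b w κ b 1# p ⟩
        κ * (b ∙ cross w b) + 1# * (b ∙ cross w p)   ≈⟨ +-cong (x*0y≈0 (det-alternating′ b w)) (*-identityˡ _) ⟩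
        0# + b ∙ cross w p                           ≈⟨ +-identityˡ _ ⟩
        b ∙ cross w p                                ≈⟨ det-rotate b w p ⟩
        cross b p ∙ w                                ∎
      Qv≈0 : eval Q v ≈ 0#
      Qv≈0 = begin
        eval Q v
          ≈⟨ eval-combination Q κ b 1# p ⟩
        κ * κ * eval Q b + 1# * 1# * eval Q p + κ * 1# * (b ∙ cross b p)
          ≈⟨ +-cong (+-congʳ (trans (*-congʳ κ²) (x/y*y≈x B≉0))) (x*0y≈0 (det-alternating b p)) ⟩
        eval Q p + 1# * 1# * eval Q p + 0#
          ≈⟨ solve 1 (λ x → x :+ con true :* con true :* x :+ con false := con false) refl _ ⟩
        0# ∎
      v∈L : cross b p ∙ v ≈ 0#
      v∈L = trans (sym (det-v v)) (solve 6 (λ a b c x y z → Det a b c x y z x y z := con false) refl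
        (b 0F) (b 1F) (b 2F) (v 0F) (v 1F) (v 2F))
      v≉0 : ¬ (∀ i → v i ≈ 0#)
      v≉0 e = L≉0 λ i → begin
        cross b p i                 ≈⟨ ∙-basis (cross b p) i ⟨
        cross b p ∙ basis i         ≈⟨ det-v (basis i) ⟨
        b ∙ cross (basis i) v       ≈⟨ 0+0≈0 (x*0y≈0 (z 1F 2F)) (0+0≈0 (x*0y≈0 (z 0F 2F)) (0+0≈0 (x*0y≈0 (z 0F 1F)) refl)) ⟩
        0#                          ∎
        where
        z : ∀ {x y} i j → x * v j + y * v i ≈ 0#
        z i j = 0+0≈0 (x*0y≈0 (e j)) (x*0y≈0 (e i))
      V : Point
      V = point v v≉0
      f : Fin 1 → ∃ (K ∩ on (point (cross b p) L≉0))
      f _ = V , proj₂ K≐Q {V} Qv≈0 , v∈L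
      unique : ∀ P → eval Q (coords P) ≈ 0# → cross b p ∙ coords P ≈ 0# → P ∼ V
      -- By `cramer` each multiple `w i *ᵥ b` is a combination of two singular vectors whose cross
      -- term is 0, so Q vanishes there. As Q(b) is nonzero, the cross product w is 0.
      unique P QP≈0 P∈L = cross≈0⇒∼ P V λ i → square≈0 (cancel B≉0 (begin
        eval Q b * (w i * w i)                     ≈⟨ *-comm _ _ ⟩
        w i * w i * eval Q b                       ≈⟨ eval-* Q (w i) b ⟨
        eval Q (w i *ᵥ b)                          ≈⟨ eval-cong Q (cramer b u v D≈0 i) ⟩
        eval Q ((cross b v i *ᵥ u) +ᵥ (cross u b i *ᵥ v))
          ≈⟨ eval-combination Q (cross b v i) u (cross u b i) v ⟩
        _  ≈⟨ 0+0≈0 (0+0≈0 (x*0y≈0 QP≈0) (x*0y≈0 Qv≈0)) (x*0y≈0 D≈0) ⟩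
        0#                                         ∎))
        where
        u = coords P
        w = cross u v
        D≈0 : b ∙ cross u v ≈ 0#
        D≈0 = trans (det-v u) P∈L

    -- Lying on the tangents spanned by b and each basis vector, n has zero cross product with b.
    nucleus-unique : ∀ n → IsNucleus n K → n ∼ nucleus Q nondegenerate
    nucleus-unique n n-nucleus = cross≈0⇒∼ n (nucleus Q nondegenerate) λ i → begin
      cross (coords n) b i              ≈⟨ cross-basis (coords n) b i ⟨
      coords n ∙ cross b (basis i)      ≈⟨ ∙-comm (coords n) (cross b (basis i)) ⟩
      cross b (basis i) ∙ coords n      ≈⟨ on-tangents (basis i) (Fin.all? (λ j → cross b (basis i) j ≟ 0#)) ⟩
      0#                                ∎
      where
      ∙-comm : ∀ u v → u ∙ v ≈ v ∙ u
      ∙-comm u v = +-cong (*-comm _ _) (+-cong (*-comm _ _) (+-cong (*-comm _ _) refl))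
      on-tangents : ∀ p → Dec (∀ j → cross b p j ≈ 0#) → cross b p ∙ coords n ≈ 0#
      on-tangents p (yes e) = 0+0≈0 (0x*y≈0 (e 0F)) (0+0≈0 (0x*y≈0 (e 1F)) (0+0≈0 (0x*y≈0 (e 2F)) refl))
      on-tangents p (no L≉0) = n-nucleus (point (cross b p) L≉0) (tangent p L≉0)

  column : Matrix → Fin 3 → Triple
  column B j i = B i j

  -- Substitution of B into Q: the square coefficients are values at the columns, the mixed ones are
  -- values of the polar form at pairs of columns.
  compose : QuadraticForm → Matrix → QuadraticForm
  compose Q B = quadraticForm (eval Q (col 0F)) (eval Q (col 1F)) (eval Q (col 2F))
    (ν Q ∙ cross (col 1F) (col 2F)) (ν Q ∙ cross (col 0F) (col 2F)) (ν Q ∙ cross (col 0F) (col 1F))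
    where col = column B

  eval-compose : ∀ Q B v → eval (compose Q B) v ≈ eval Q (apply B v)
  eval-compose Q B v = sym (begin
    eval Q (apply B v)
      ≈⟨ eval-cong Q (λ i → solve 6 (λ a b c x y z → a :* x :+ (b :* y :+ (c :* z :+ con false))
           := x :* a :+ con true :* (y :* b :+ z :* c)) refl (B i 0F) (B i 1F) (B i 2F) x y z) ⟩
    eval Q ((x *ᵥ col 0F) +ᵥ (1# *ᵥ yz))
      ≈⟨ eval-combination Q x (col 0F) 1# yz ⟩
    x * x * q₀ + 1# * 1# * eval Q yz + x * 1# * (ν Q ∙ cross (col 0F) yz)
      ≈⟨ +-cong (+-congˡ (*-congˡ (eval-combination Q y (col 1F) z (col 2F))))
           (*-congˡ (det-combination (ν Q) (col 0F) y (col 1F) z (col 2F))) ⟩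
    x * x * q₀ + 1# * 1# * (y * y * q₁ + z * z * q₂ + y * z * d₁₂) + x * 1# * (y * d₀₁ + z * d₀₂)
      ≈⟨ solve 9 (λ x y z q₀ q₁ q₂ d₁₂ d₀₂ d₀₁ →
           x :* x :* q₀ :+ con true :* con true :* (y :* y :* q₁ :+ z :* z :* q₂ :+ y :* z :* d₁₂)
             :+ x :* con true :* (y :* d₀₁ :+ z :* d₀₂) := Eval q₀ q₁ q₂ d₁₂ d₀₂ d₀₁ x y z) refl
           x y z q₀ q₁ q₂ d₁₂ d₀₂ d₀₁ ⟩
    eval (compose Q B) v ∎)
    where
    col = column B
    x = v 0F
    y = v 1F
    z = v 2F
    yz : Triple
    yz = (y *ᵥ col 1F) +ᵥ (z *ᵥ col 2F)
    q₀ = eval Q (col 0F)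
    q₁ = eval Q (col 1F)
    q₂ = eval Q (col 2F)
    d₁₂ = ν Q ∙ cross (col 1F) (col 2F)
    d₀₂ = ν Q ∙ cross (col 0F) (col 2F)
    d₀₁ = ν Q ∙ cross (col 0F) (col 1F)

  polar-compose : ∀ Q B v w → polar (compose Q B) v w ≈ polar Q (apply B v) (apply B w)
  polar-compose Q B v w = +-cong (+-cong (trans (eval-compose Q B (v +ᵥ w)) (eval-cong Q λ i → ∙-+ (B i) v w))
    (-‿cong (eval-compose Q B v))) (-‿cong (eval-compose Q B w))

  polar-cong : ∀ Q {v v′ w w′ : Triple} → (∀ i → v i ≈ v′ i) → (∀ i → w i ≈ w′ i) → polar Q v w ≈ polar Q v′ w′
  polar-cong Q {v} {v′} {w} {w′} e f = +-cong (+-cong (eval-cong Q {v +ᵥ w} {v′ +ᵥ w′} λ i → +-cong (e i) (f i))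
    (-‿cong (eval-cong Q e))) (-‿cong (eval-cong Q f))

  compose-nondegenerate : ∀ Q A → Nondegenerate Q → Nondegenerate (compose Q (matrix A))
  compose-nondegenerate Q A nondegenerate P radical QP≈0 = nondegenerate (transform A P)
    (λ w → begin
      polar Q (apply (matrix A) (coords P)) w
        ≈⟨ polar-cong Q {apply (matrix A) (coords P)} (λ i → refl) (inverseᵣ A w) ⟨
      polar Q (apply (matrix A) (coords P)) (apply (matrix A) (apply (inverse A) w))
        ≈⟨ polar-compose Q (matrix A) (coords P) (apply (inverse A) w) ⟨
      polar (compose Q (matrix A)) (coords P) (apply (inverse A) w)   ≈⟨ radical (apply (inverse A) w) ⟩
      0#                                                              ∎)
    (trans (sym (eval-compose Q (matrix A) (coords P))) QP≈0)

  form : ConicParameters → QuadraticForm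
  form (params α β l) = quadraticForm α β l 0# 0# 1#

  form-polar : ∀ p w → polar (form p) (coords F₀) w ≈ 0#
  form-polar p@(params α β l) w = trans (polar-ν (form p) (coords F₀) w) (det-alternating (coords F₀) w)

  form-nondegenerate : ∀ p → ¬ lam p ≈ 0# → Nondegenerate (form p)
  form-nondegenerate p@(params α β l) l≉0 P radical P∈F = evaluate (radical⇒∼ν (form p) (λ e → 1≉0 (e 2F)) P radical)
    where
    evaluate : ¬ P ∼ point (ν (form p)) (λ e → 1≉0 (e 2F))
    evaluate (k , k≉0 , e) = product≉0 (product≉0 k≉0 k≉0) l≉0 (begin
      k * k * l                                   ≈⟨ *-congˡ (solve 3 (λ α β l → l := Eval α β l (con false) (con false) (con true)
                                                       (con false) (con false) (con true)) refl α β l) ⟩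
      k * k * eval (form p) (ν (form p))          ≈⟨ eval-* (form p) k (ν (form p)) ⟨
      eval (form p) (k *ᵥ ν (form p))             ≈⟨ eval-cong (form p) e ⟨
      eval (form p) (coords P)                    ≈⟨ P∈F ⟩
      0#                                          ∎)

  -- The preimage of `F₀` under A is the nucleus of the conic of p, hence that of C. So the third
  -- column of the inverse of A is a multiple of `ν Q`, which kills the y z and x z terms of Q in
  -- the new coordinates; division by the x y coefficient and scaling by l give `Ψ`. The value of
  -- `traceOf` at the result is left open: z = 0 may be a secant of C.
  sameNucleus⇒Ψ : ∀ A p → ¬ lam p ≈ 0# → ∀ n → IsNucleus n (transform A ⊢ F⟨ p ⟩) →
    (C : PointSet) → IsConic C → IsNucleus n C →
    ∃ λ a → ∃ λ b → ∃ λ l → ¬ l ≈ 0# ×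
      C ≐ (λ P → let P′ = coords (transform A P) in Ψ a b l (P′ 0F) (P′ 1F) (P′ 2F) ≈ 0#)
  sameNucleus⇒Ψ A p@(params _ _ _) l≉0 n n-nucleus C (Q , nondegenerate , C≐Q) n-nucleusC =
    qa * i * l , qb * i * l , l , product≉0 qc≉0 (⁻¹≉0 e≉0) ,
    (λ {P} P∈C → trans (normalise (coords (transform A P))) (x*0y≈0 (trans (R-eval P) (proj₁ C≐Q P∈C)))) ,
    (λ {P} P∈Ψ → proj₂ C≐Q (trans (sym (R-eval P)) (cancel (product≉0 (⁻¹≉0 e≉0) (product≉0 qc≉0 (⁻¹≉0 e≉0)))
      (trans (sym (normalise (coords (transform A P)))) P∈Ψ))))
    where
    G : Point
    G = transform (inv A) F₀
    Q₁ = compose (form p) (matrix A)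
    nondegenerate₁ = compose-nondegenerate (form p) A (form-nondegenerate p l≉0)
    n∼ν₁ : n ∼ nucleus Q₁ nondegenerate₁
    n∼ν₁ = Tangents.nucleus-unique Q₁ nondegenerate₁
      ((λ {P} → trans (eval-compose (form p) (matrix A) (coords P))) ,
       (λ {P} → trans (sym (eval-compose (form p) (matrix A) (coords P))))) n n-nucleus
    G∼ν₁ : G ∼ nucleus Q₁ nondegenerate₁
    G∼ν₁ = radical⇒∼ν Q₁ (ν≉0 Q₁ nondegenerate₁) G λ w → begin
      polar Q₁ (coords G) w                                     ≈⟨ polar-compose (form p) (matrix A) (coords G) w ⟩
      polar (form p) (apply (matrix A) (coords G)) (apply (matrix A) w)
        ≈⟨ polar-cong (form p) {_} {_} {apply (matrix A) w} (inverseᵣ A (coords F₀)) (λ i → refl) ⟩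
      polar (form p) (coords F₀) (apply (matrix A) w)           ≈⟨ form-polar p (apply (matrix A) w) ⟩
      0#                                                        ∎
    G∼νQ : G ∼ nucleus Q nondegenerate
    G∼νQ = transP G n (nucleus Q nondegenerate)
      (transP G (nucleus Q₁ nondegenerate₁) n G∼ν₁ (symP n (nucleus Q₁ nondegenerate₁) n∼ν₁))
      (Tangents.nucleus-unique Q nondegenerate C≐Q n n-nucleusC)
    k = proj₁ G∼νQ
    R = compose Q (inverse A)
    R-nondegenerate = compose-nondegenerate Q (inv A) nondegenerate
    R-eval : ∀ P → eval R (coords (transform A P)) ≈ eval Q (coords P)
    R-eval P = trans (eval-compose Q (inverse A) (apply (matrix A) (coords P))) (eval-cong Q (inverseₗ A (coords P)))
    col₂ : ∀ i → column (inverse A) 2F i ≈ k * ν Q i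
    col₂ i = trans (sym (∙-basis (inverse A i) 2F)) (proj₂ (proj₂ G∼νQ) i)
    det≈0 : ∀ v → ν Q ∙ cross v (column (inverse A) 2F) ≈ 0#
    det≈0 v = trans (det-cong (ν Q) {v} {v} {column (inverse A) 2F} {k *ᵥ ν Q} (λ i → refl) col₂)
      (solve 7 (λ a b c k x y z → Det a b c x y z (k :* a) (k :* b) (k :* c) := con false) refl
        (ν Q 0F) (ν Q 1F) (ν Q 2F) k (v 0F) (v 1F) (v 2F))
    qa = QuadraticForm.x² R
    qb = QuadraticForm.y² R
    qc = QuadraticForm.z² R
    e = QuadraticForm.xy R
    yz≈0 : QuadraticForm.yz R ≈ 0#
    yz≈0 = det≈0 (column (inverse A) 1F)
    xz≈0 : QuadraticForm.xz R ≈ 0#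
    xz≈0 = det≈0 (column (inverse A) 0F)
    e≉0 : ¬ e ≈ 0#
    e≉0 e≈0 = ν≉0 R R-nondegenerate λ { 0F → yz≈0 ; 1F → xz≈0 ; 2F → e≈0 }
    R-simplified : ∀ v → eval R v ≈ qa * (v 0F * v 0F) + qb * (v 1F * v 1F) + qc * (v 2F * v 2F) + e * (v 0F * v 1F)
    R-simplified v = +-congʳ (trans (+-cong (trans (+-congˡ (0x*y≈0 yz≈0)) (+-identityʳ _)) (0x*y≈0 xz≈0)) (+-identityʳ _))
    qc≉0 : ¬ qc ≈ 0#
    qc≉0 qc≈0 = evalν≉0 R R-nondegenerate (trans (R-simplified (ν R))
      (0+0≈0 (0+0≈0 (0+0≈0 (x*0y≈0 (0x*y≈0 yz≈0)) (x*0y≈0 (0x*y≈0 xz≈0))) (0x*y≈0 qc≈0)) (x*0y≈0 (0x*y≈0 yz≈0))))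
    i = e ⁻¹
    l = qc * i
    normalise : ∀ v → Ψ (qa * i * l) (qb * i * l) l (v 0F) (v 1F) (v 2F) ≈ i * l * eval R v
    normalise v = begin
      Ψ (qa * i * l) (qb * i * l) l x y z
        ≈⟨ solve 7 (λ a b c i x y z →
             a :* i :* (c :* i) :* (x :* x) :+ c :* i :* (x :* y) :+ b :* i :* (c :* i) :* (y :* y) :+ c :* i :* (c :* i) :* (z :* z)
             := i :* (c :* i) :* (a :* (x :* x) :+ b :* (y :* y) :+ c :* (z :* z)) :+ c :* i :* con true :* (x :* y)) refl
             qa qb qc i x y z ⟩
      i * l * N + l * 1# * (x * y)          ≈⟨ +-congˡ (*-congʳ (*-congˡ (inverseʳ e≉0))) ⟨
      i * l * N + l * (e * i) * (x * y)
        ≈⟨ solve 6 (λ l e i N x y → i :* l :* N :+ l :* (e :* i) :* (x :* y) := i :* l :* (N :+ e :* (x :* y))) refl l e i N x y ⟩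
      i * l * (N + e * (x * y))             ≈⟨ *-congˡ (R-simplified v) ⟨
      i * l * eval R v                      ∎
      where
      x = v 0F
      y = v 1F
      z = v 2F
      N = qa * (x * x) + qb * (y * y) + qc * (z * z)

-- Adjoining a conic to a pencil and correcting the traces by a shear.

module Extensions {h : ℕ} {c ℓ : Level} (F : GaloisField₂ h c ℓ) where

  open FiniteField F
  open TraceForm F
  open Plane F
  open Pencils F
  open MathonArcs F
  open Coordinates F
  open ≈-Reasoning setoid
  open Char2Solver using (solve; _:=_; _:+_; _:*_; con)

  -- The shear fixes `F₀` and carries the line z = u x + v y to z = 0.
  module Shear (u v : Carrier) where

                         
    shearMatrix : Matrix → Matrix
    shearMatrix m 0F = m 0F
    shearMatrix m 1F = m 1F
    shearMatrix m 2F = λ j → m 2F j + (u * m 0F j + v * m 1F j)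

    shear-z : ∀ m w → apply (shearMatrix m) w 2F ≈ apply m w 2F + (u * apply m w 0F + v * apply m w 1F)
    shear-z m w = solve 14 (λ u v a b c a′ b′ c′ a″ b″ c″ x y z →
        (a :+ (u :* a′ :+ v :* a″)) :* x :+ ((b :+ (u :* b′ :+ v :* b″)) :* y :+ ((c :+ (u :* c′ :+ v :* c″)) :* z :+ con false))
        := a :* x :+ (b :* y :+ (c :* z :+ con false)) :+ (u :* (a′ :* x :+ (b′ :* y :+ (c′ :* z :+ con false)))
             :+ v :* (a″ :* x :+ (b″ :* y :+ (c″ :* z :+ con false))))) refl u v
        (m 2F 0F) (m 2F 1F) (m 2F 2F) (m 0F 0F) (m 0F 1F) (m 0F 2F)
        (m 1F 0F) (m 1F 1F) (m 1F 2F) (w 0F) (w 1F) (w 2F)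

    shear : Invertible → Invertible
    shear A = record
      { matrix = shearMatrix m
      ; inverse = k′
      ; inverseₗ = λ w i → trans
          (trans (+-congˡ (+-congˡ (+-congʳ (*-congˡ (shear-z m w)))))
            (solve 8 (λ k₀ k₁ k₂ u v X Y Z → (k₀ :+ k₂ :* u) :* X :+ ((k₁ :+ k₂ :* v) :* Y
                :+ (k₂ :* (Z :+ (u :* X :+ v :* Y)) :+ con false)) := k₀ :* X :+ (k₁ :* Y :+ (k₂ :* Z :+ con false))) refl
              (k i 0F) (k i 1F) (k i 2F) u v (m 0F ∙ w) (m 1F ∙ w) (m 2F ∙ w)))
          (inverseₗ A w i)
      ; inverseᵣ = λ w → λ
          { 0F → row w 0F
          ; 1F → row w 1F
          ; 2F → trans (shear-z m (apply k′ w)) (trans (+-cong (row w 2F) (+-cong (*-congˡ (row w 0F)) (*-congˡ (row w 1F))))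
              (solve 5 (λ u v x y z → z :+ (u :* x :+ v :* y) :+ (u :* x :+ v :* y) := z) refl u v (w 0F) (w 1F) (w 2F))) }
      }
      where
      m = matrix A
      k = inverse A
      k′ : Matrix
      k′ i = k i 0F + k i 2F * u ∷ k i 1F + k i 2F * v ∷ k i 2F ∷ []
      tilt : Triple → Triple
      tilt w = w 0F ∷ w 1F ∷ w 2F + (u * w 0F + v * w 1F) ∷ []
      row : ∀ w i → apply m (apply k′ w) i ≈ tilt w i
      row w i = trans (∙-cong (m i) {apply k′ w} {apply k (tilt w)} (λ i →
        solve 8 (λ k₀ k₁ k₂ u v X Y Z → (k₀ :+ k₂ :* u) :* X :+ ((k₁ :+ k₂ :* v) :* Y :+ (k₂ :* Z :+ con false))
          := k₀ :* X :+ (k₁ :* Y :+ (k₂ :* (Z :+ (u :* X :+ v :* Y)) :+ con false))) refl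
          (k i 0F) (k i 1F) (k i 2F) u v (w 0F) (w 1F) (w 2F))) (inverseᵣ A (tilt w) i)

    Ψ-shear : ∀ a b l x y z → Ψ (a + l * l * (u * u)) (b + l * l * (v * v)) l x y (z + (u * x + v * y)) ≈ Ψ a b l x y z
    Ψ-shear a b l x y z = solve 8 (λ u v a b l x y z →
      (a :+ l :* l :* (u :* u)) :* (x :* x) :+ l :* (x :* y) :+ (b :+ l :* l :* (v :* v)) :* (y :* y)
        :+ l :* l :* ((z :+ (u :* x :+ v :* y)) :* (z :+ (u :* x :+ v :* y)))
      := a :* (x :* x) :+ l :* (x :* y) :+ b :* (y :* y) :+ l :* l :* (z :* z)) refl u v a b l x y z

    -- The new a / l and b / l are the coefficients A and B of the restriction to z = u x + v y, so
    -- the trace condition after the shear says that this line misses the conic.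
    traceOf-shear : ∀ a b l → ¬ l ≈ 0# →
      traceOf (a + l * l * (u * u)) (b + l * l * (v * v)) l ≈ traceOf a b l + Tr (Φ a b l u v)
    traceOf-shear a b l l≉0 = trans (Tr-cong (*-cong (term a u) (term b v))) (OnLine.Tr-AB a b l l≉0 u v)
      where
      term : ∀ a u → (a + l * l * (u * u)) * l ⁻¹ ≈ a * l ⁻¹ + l * (u * u)
      term a u = begin
        (a + l * l * (u * u)) * l ⁻¹
          ≈⟨ solve 4 (λ a l m u → (a :+ l :* l :* (u :* u)) :* m := a :* m :+ l :* m :* (l :* (u :* u))) refl a l (l ⁻¹) u ⟩
        a * l ⁻¹ + l * l ⁻¹ * (l * (u * u))   ≈⟨ +-congˡ (trans (*-congʳ (inverseʳ l≉0)) (*-identityˡ _)) ⟩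
        a * l ⁻¹ + l * (u * u)                ∎

    shearPencil : ∀ {d} → Pencil d → Pencil d
    shearPencil V = record
      { a = λ i → a i + l i * l i * (u * u) ; b = λ i → b i + l i * l i * (v * v) ; l = l
      ; o = o
      ; a-o = 0+0≈0 a-o (0x*y≈0 (0x*y≈0 l-o)) ; b-o = 0+0≈0 b-o (0x*y≈0 (0x*y≈0 l-o)) ; l-o = l-o
      ; _⊞_ = _⊞_
      ; a-⊞ = λ i j → additive u (a-⊞ i j) (l-⊞ i j) ; b-⊞ = λ i j → additive v (b-⊞ i j) (l-⊞ i j) ; l-⊞ = l-⊞
      ; l-inj = l-inj }
      where
      open Pencil V
      additive : ∀ u {a a₁ a₂ l l₁ l₂} → a ≈ a₁ + a₂ → l ≈ l₁ + l₂ →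
        a + l * l * (u * u) ≈ (a₁ + l₁ * l₁ * (u * u)) + (a₂ + l₂ * l₂ * (u * u))
      additive u {_} {a₁} {a₂} {_} {l₁} {l₂} ea el = trans (+-cong ea (*-congʳ (*-cong el el)))
        (solve 5 (λ u a₁ a₂ l₁ l₂ → a₁ :+ a₂ :+ (l₁ :+ l₂) :* (l₁ :+ l₂) :* (u :* u)
          := (a₁ :+ l₁ :* l₁ :* (u :* u)) :+ (a₂ :+ l₂ :* l₂ :* (u :* u))) refl u a₁ a₂ l₁ l₂)

    module _ {d} (V : Pencil d) (A : Invertible) where
      open Pencil V
      private module S = Pencil (shearPencil V)

      ψ-shear : ∀ i P → (let w = apply (matrix (shear A)) (coords P); w′ = apply (matrix A) (coords P)) →
        S.ψ i (w 0F) (w 1F) (w 2F) ≈ ψ i (w′ 0F) (w′ 1F) (w′ 2F)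
      ψ-shear i P = trans (Ψ-cong refl refl refl refl refl (shear-z (matrix A) (coords P))) (Ψ-shear (a i) (b i) (l i) _ _ _)

  -- The combination l² Ψ′ + l′² Ψ is free of z; divided by l l′ (l + l′) it is A x² + x y + B y²,
  -- whose zeros are the directions of common points. The identity rests on (ρl + ρ′l′)(σl + σ′l′) +
  -- (ρl′ + ρ′l)(σl′ + σ′l) = (ρσ + ρ′σ′)(l + l′)².
  traceOf-sum : ∀ {a b l a′ b′ l′} → ¬ l ≈ 0# → ¬ l′ ≈ 0# → ¬ l + l′ ≈ 0# →
    (let m = (l + l′) ⁻¹
         A = (a * l ⁻¹ * l′ + a′ * l′ ⁻¹ * l) * m
         B = (b * l ⁻¹ * l′ + b′ * l′ ⁻¹ * l) * m) →
    traceOf (a + a′) (b + b′) (l + l′) + Tr (A * B) ≈ traceOf a b l + traceOf a′ b′ l′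
  traceOf-sum {a} {b} {l} {a′} {b′} {l′} l≉0 l′≉0 l″≉0 = begin
    traceOf (a + a′) (b + b′) (l + l′) + Tr (A * B)
      ≈⟨ +-congʳ (Tr-cong (*-cong (*-congʳ (+-cong (back l≉0) (back l′≉0))) (*-congʳ (+-cong (back l≉0) (back l′≉0))))) ⟩
    Tr ((ρ * l + ρ′ * l′) * m * ((σ * l + σ′ * l′) * m)) + Tr (A * B)
      ≈⟨ Tr-+ _ _ ⟨
    Tr ((ρ * l + ρ′ * l′) * m * ((σ * l + σ′ * l′) * m) + A * B)
      ≈⟨ Tr-cong (solve 7 (λ ρ σ l ρ′ σ′ l′ m →
           (ρ :* l :+ ρ′ :* l′) :* m :* ((σ :* l :+ σ′ :* l′) :* m) :+ (ρ :* l′ :+ ρ′ :* l) :* m :* ((σ :* l′ :+ σ′ :* l) :* m)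
           := (ρ :* σ :+ ρ′ :* σ′) :* (((l :+ l′) :* m) :* ((l :+ l′) :* m))) refl ρ σ l ρ′ σ′ l′ m) ⟩
    Tr ((ρ * σ + ρ′ * σ′) * ((l + l′) * m * ((l + l′) * m)))
      ≈⟨ Tr-cong (trans (*-congˡ (trans (*-cong (inverseʳ l″≉0) (inverseʳ l″≉0)) (*-identityˡ 1#))) (*-identityʳ _)) ⟩
    Tr (ρ * σ + ρ′ * σ′)                  ≈⟨ Tr-+ _ _ ⟩
    Tr (ρ * σ) + Tr (ρ′ * σ′)             ∎
    where
    m = (l + l′) ⁻¹
    ρ = a * l ⁻¹
    σ = b * l ⁻¹
    ρ′ = a′ * l′ ⁻¹
    σ′ = b′ * l′ ⁻¹
    A = (ρ * l′ + ρ′ * l) * m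
    B = (σ * l′ + σ′ * l) * m
    back : ∀ {x y} → ¬ y ≈ 0# → x ≈ x * y ⁻¹ * y
    back y≉0 = sym (x/y*y≈x y≉0)

  Disjoint : (a b l a′ b′ l′ : Carrier) → Set (c ⊔ ℓ)
  Disjoint a b l a′ b′ l′ = ∀ x y z → ¬ (x ≈ 0# × y ≈ 0#) → Ψ a b l x y z ≈ 0# → ¬ Ψ a′ b′ l′ x y z ≈ 0#

                                                                           
  -- For equal l the two polynomials differ by (a + a′) x² + (b + b′) y², the square of a linear
  -- form. Above a zero (x, y) of that form both conics have the same height.
  disjoint⇒l≉ : ∀ {a b l a′ b′ l′} → ¬ l ≈ 0# → Disjoint a b l a′ b′ l′ → ¬ l ≈ l′
  disjoint⇒l≉ {a} {b} {l} {a′} {b′} {l′} l≉0 disjoint l≈l′ = meet (toSum (s ≟ 0#))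
    where
    s = proj₁ (sqrt (b + b′))
    t = proj₁ (sqrt (a + a′))
    s² : s * s ≈ b + b′
    s² = proj₂ (sqrt (b + b′))
    t² : t * t ≈ a + a′
    t² = proj₂ (sqrt (a + a′))
    both : ∀ x y → ¬ (x ≈ 0# × y ≈ 0#) → (a + a′) * (x * x) + (b + b′) * (y * y) ≈ 0# → False
    both x y xy≉0 e = disjoint x y z xy≉0 (height-conic l≉0 x y) (trans (Ψ-cong refl refl (sym l≈l′) refl refl refl) (begin
      Ψ a′ b′ l x y z
        ≈⟨ solve 8 (λ a b l a′ b′ x y z →
             a′ :* (x :* x) :+ l :* (x :* y) :+ b′ :* (y :* y) :+ l :* l :* (z :* z)
             := (a :* (x :* x) :+ l :* (x :* y) :+ b :* (y :* y) :+ l :* l :* (z :* z))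
                :+ ((a :+ a′) :* (x :* x) :+ (b :+ b′) :* (y :* y))) refl a b l a′ b′ x y z ⟩
      Ψ a b l x y z + ((a + a′) * (x * x) + (b + b′) * (y * y))   ≈⟨ 0+0≈0 (height-conic l≉0 x y) e ⟩
      0#                                                          ∎))
      where z = height a b l x y
    meet : s ≈ 0# ⊎ ¬ s ≈ 0# → False
    meet (inj₁ s≈0) = both 0# 1# (λ (_ , e) → 1≉0 e)
      (0+0≈0 (x*0y≈0 (zeroˡ 0#)) (0x*y≈0 (trans (sym s²) (0x*y≈0 s≈0))))
    meet (inj₂ s≉0) = both s t (λ (e , _) → s≉0 e)
      (x≈y⇒x+y≈0 (trans (*-cong (sym t²) s²) (*-comm _ _)))

                                                                                
                                
  -- If Tr(AB) were 0 the z-free combination would split, and a zero (s, r) of it would lift to a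
  -- common point. So Tr(AB) = 1, which cancels the trace 1 of the old conic. This makes the trace
  -- constant on the coset of C.
  disjoint⇒traceOf-sum : ∀ {θ} → Tr θ ≈ 1# → ∀ {a b l a′ b′ l′} → ¬ l ≈ 0# → ¬ l′ ≈ 0# →
    Disjoint a b l a′ b′ l′ → traceOf a b l ≈ 1# → traceOf (a + a′) (b + b′) (l + l′) ≈ traceOf a′ b′ l′
  disjoint⇒traceOf-sum Trθ≈1 {a} {b} {l} {a′} {b′} {l′} l≉0 l′≉0 disjoint τ≈1 = x+y≈0⇒x≈y (begin
    τ″ + τ′                          ≈⟨ solve 3 (λ x y z → x :+ z := x :+ y :+ (y :+ z)) refl τ″ 1# τ′ ⟩
    τ″ + 1# + (1# + τ′)              ≈⟨ +-cong (+-congˡ (bit-≉0 (Tr-bit (A * B)) (meet ∘ splits Trθ≈1 A B))) (+-congʳ τ≈1) ⟨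
    τ″ + Tr (A * B) + (traceOf a b l + τ′)  ≈⟨ +-congʳ (traceOf-sum l≉0 l′≉0 l″≉0) ⟩
    traceOf a b l + τ′ + (traceOf a b l + τ′)  ≈⟨ x+x≈0 _ ⟩
    0#                               ∎)
    where
    m = (l + l′) ⁻¹
    A = (a * l ⁻¹ * l′ + a′ * l′ ⁻¹ * l) * m
    B = (b * l ⁻¹ * l′ + b′ * l′ ⁻¹ * l) * m
    τ″ = traceOf (a + a′) (b + b′) (l + l′)
    τ′ = traceOf a′ b′ l′
    l″≉0 : ¬ l + l′ ≈ 0#
    l″≉0 e = disjoint⇒l≉ l≉0 disjoint (x+y≈0⇒x≈y e)
    clear : ∀ {a a′} → l * l′ * (l + l′) * ((a * l ⁻¹ * l′ + a′ * l′ ⁻¹ * l) * m) ≈ a * (l′ * l′) + a′ * (l * l)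
    clear {a} {a′} = begin
      l * l′ * (l + l′) * ((a * l ⁻¹ * l′ + a′ * l′ ⁻¹ * l) * m)
        ≈⟨ solve 7 (λ a k l a′ k′ l′ m → l :* l′ :* (l :+ l′) :* ((a :* k :* l′ :+ a′ :* k′ :* l) :* m)
             := (l :+ l′) :* m :* (a :* k :* l :* (l′ :* l′) :+ a′ :* k′ :* l′ :* (l :* l))) refl a (l ⁻¹) l a′ (l′ ⁻¹) l′ m ⟩
      (l + l′) * m * (a * l ⁻¹ * l * (l′ * l′) + a′ * l′ ⁻¹ * l′ * (l * l))
        ≈⟨ *-cong (inverseʳ l″≉0) (+-cong (*-congʳ (x/y*y≈x l≉0)) (*-congʳ (x/y*y≈x l′≉0))) ⟩
      1# * (a * (l′ * l′) + a′ * (l * l))    ≈⟨ *-identityˡ _ ⟩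
      a * (l′ * l′) + a′ * (l * l)           ∎
    meet : ¬ Splits A B
    meet AB = disjoint s r z sr≉0 (height-conic l≉0 s r) (cancel (product≉0 l≉0 l≉0) (begin
      l * l * Ψ a′ b′ l′ s r z
        ≈⟨ solve 9 (λ a b l a′ b′ l′ x y z →
             l :* l :* (a′ :* (x :* x) :+ l′ :* (x :* y) :+ b′ :* (y :* y) :+ l′ :* l′ :* (z :* z))
             := l′ :* l′ :* (a :* (x :* x) :+ l :* (x :* y) :+ b :* (y :* y) :+ l :* l :* (z :* z))
                :+ ((a :* (l′ :* l′) :+ a′ :* (l :* l)) :* (x :* x) :+ l :* l′ :* (l :+ l′) :* (x :* y)
                   :+ (b :* (l′ :* l′) :+ b′ :* (l :* l)) :* (y :* y))) refl a b l a′ b′ l′ s r z ⟩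
      l′ * l′ * Ψ a b l s r z + ((a * (l′ * l′) + a′ * (l * l)) * (s * s) + k * (s * r) + (b * (l′ * l′) + b′ * (l * l)) * (r * r))
        ≈⟨ +-cong (x*0y≈0 (height-conic l≉0 s r)) (+-cong (+-congʳ (*-congʳ (sym clear))) (*-congʳ (sym clear))) ⟩
      0# + (k * A * (s * s) + k * (s * r) + k * B * (r * r))
        ≈⟨ +-congˡ (+-cong (+-cong (*-congʳ (*-congˡ (sym rr′)))
             (*-congˡ (trans (sym (*-identityˡ _)) (*-congʳ (sym det))))) (*-congʳ (*-congˡ (sym ss′)))) ⟩
      0# + (k * (r * r′) * (s * s) + k * ((r * s′ + r′ * s) * (s * r)) + k * (s * s′) * (r * r))
        ≈⟨ solve 5 (λ k r s r′ s′ → con false :+ (k :* (r :* r′) :* (s :* s) :+ k :* ((r :* s′ :+ r′ :* s) :* (s :* r))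
             :+ k :* (s :* s′) :* (r :* r)) := con false) refl k r s r′ s′ ⟩
      0# ∎))
      where
      open Splits AB
      k = l * l′ * (l + l′)
      z = height a b l s r
      sr≉0 : ¬ (s ≈ 0# × r ≈ 0#)
      sr≉0 (s≈0 , r≈0) = 0≉1 (trans (sym (0+0≈0 (0x*y≈0 r≈0) (x*0y≈0 s≈0))) det)

  xor : Fin 2 → Fin 2 → Fin 2
  xor 0F e = e
  xor 1F 0F = 1F
  xor 1F 1F = 0F

  infixr 7 _·_
  _·_ : Fin 2 → Carrier → Carrier
  0F · x = 0#
  1F · x = x

  ·-xor : ∀ e f x → xor e f · x ≈ e · x + f · x
  ·-xor 0F f x = sym (+-identityˡ _)
  ·-xor 1F 0F x = sym (+-identityʳ _)
  ·-xor 1F 1F x = sym (x+x≈0 x)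

  -- The group generated by the pencil and the new triple, with a bit telling the coset. As l′ is
  -- not among the old values of l, these form a proper subgroup of the new ones and l stays
  -- injective.
  module Extension {d} (V : Pencil d) (a′ b′ l′ : Carrier) (l≉l′ : ∀ i → ¬ Pencil.l V i ≈ l′) where

    private module V = Pencil V
    open V using (_⊞_)

    Index : Set
    Index = Fin (2 ℕ.* d)

    bit : Index → Fin 2
    bit x = proj₁ (remQuot {2} d x)

    base : Index → Fin d
    base x = proj₂ (remQuot {2} d x)

    ⟦_,_⟧ : Fin 2 → Fin d → Index
    ⟦ e , i ⟧ = combine e i

    index-≡ : ∀ {x y} → bit x ≡ bit y → base x ≡ base y → x ≡ y
    index-≡ {x} {y} p r = ≡.trans (≡.sym (Fin.combine-remQuot {2} d x))
      (≡.trans (≡.cong₂ combine p r) (Fin.combine-remQuot {2} d y))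

    add : Index → Index → Index
    add x y = ⟦ xor (bit x) (bit y) , base x ⊞ base y ⟧

    bit-⟦⟧ : ∀ e i → bit ⟦ e , i ⟧ ≡ e
    bit-⟦⟧ e i = ≡.cong proj₁ (Fin.remQuot-combine e i)

    base-⟦⟧ : ∀ e i → base ⟦ e , i ⟧ ≡ i
    base-⟦⟧ e i = ≡.cong proj₂ (Fin.remQuot-combine e i)

    adjoin : (Fin d → Carrier) → Carrier → Index → Carrier
    adjoin f f′ x = f (base x) + bit x · f′

    adjoin-⟦⟧ : ∀ f f′ e i → adjoin f f′ ⟦ e , i ⟧ ≡ f i + e · f′
    adjoin-⟦⟧ f f′ e i = ≡.cong₂ (λ e i → f i + e · f′) (bit-⟦⟧ e i) (base-⟦⟧ e i)

    adjoin-add : ∀ f f′ → (∀ i j → f (i ⊞ j) ≈ f i + f j) → ∀ x y →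
      adjoin f f′ (add x y) ≈ adjoin f f′ x + adjoin f f′ y
    adjoin-add f f′ f-⊞ x y = begin
      adjoin f f′ (add x y)
        ≡⟨ adjoin-⟦⟧ f f′ (xor (bit x) (bit y)) (base x ⊞ base y) ⟩
      f (base x ⊞ base y) + xor (bit x) (bit y) · f′
        ≈⟨ +-cong (f-⊞ (base x) (base y)) (·-xor (bit x) (bit y) f′) ⟩
      f (base x) + f (base y) + (bit x · f′ + bit y · f′)
        ≈⟨ solve 4 (λ a b c d → a :+ b :+ (c :+ d) := a :+ c :+ (b :+ d)) refl _ _ _ _ ⟩
      adjoin f f′ x + adjoin f f′ y ∎

    adjoin-l-injective : ∀ {x y} → adjoin V.l l′ x ≈ adjoin V.l l′ y → x ≡ y
    adjoin-l-injective {x} {y} e with go (bit x) (bit y) (base x) (base y) e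
      where
      go : ∀ e f i j → V.l i + e · l′ ≈ V.l j + f · l′ → e ≡ f × i ≡ j
      go 0F 0F i j p = ≡.refl , V.l-inj (trans (sym (+-identityʳ _)) (trans p (+-identityʳ _)))
      go 1F 1F i j p = ≡.refl , V.l-inj (x+y≈0⇒x≈y (trans
        (solve 3 (λ a b c → a :+ b := (a :+ c) :+ (b :+ c)) refl _ _ l′) (x≈y⇒x+y≈0 p)))
      go 0F 1F i j p = ⊥-elim (l≉l′ (i ⊞ j) (x+y≈0⇒x≈y (trans (+-congʳ (V.l-⊞ i j)) (trans
        (solve 3 (λ a b c → a :+ b :+ c := (a :+ con false) :+ (b :+ c)) refl _ _ l′) (x≈y⇒x+y≈0 p)))))
      go 1F 0F i j p = ⊥-elim (l≉l′ (i ⊞ j) (x+y≈0⇒x≈y (trans (+-congʳ (V.l-⊞ i j)) (trans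
        (solve 3 (λ a b c → a :+ b :+ c := (a :+ c) :+ (b :+ con false)) refl _ _ l′) (x≈y⇒x+y≈0 p)))))
    ... | p , r = index-≡ p r

    adjoin-o : ∀ f f′ → f V.o ≈ 0# → adjoin f f′ ⟦ 0F , V.o ⟧ ≈ 0#
    adjoin-o f f′ e = trans (reflexive (adjoin-⟦⟧ f f′ 0F V.o)) (trans (+-identityʳ _) e)

    extension : Pencil (2 ℕ.* d)
    extension = record
      { a = adjoin V.a a′ ; b = adjoin V.b b′ ; l = adjoin V.l l′
      ; o = ⟦ 0F , V.o ⟧
      ; a-o = adjoin-o V.a a′ V.a-o ; b-o = adjoin-o V.b b′ V.b-o ; l-o = adjoin-o V.l l′ V.l-o
      ; _⊞_ = add
      ; a-⊞ = adjoin-add V.a a′ V.a-⊞ ; b-⊞ = adjoin-add V.b b′ V.b-⊞ ; l-⊞ = adjoin-add V.l l′ V.l-⊞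
      ; l-inj = adjoin-l-injective }

    module E = Pencil extension

    module Traced {θ} (Trθ≈1 : Tr θ ≈ 1#) (traces : Traces V) (l′≉0 : ¬ l′ ≈ 0#)
      (disjoint : ∀ i → i ≢ V.o → Disjoint (V.a i) (V.b i) (V.l i) a′ b′ l′) (2d<q : 2 ℕ.* d ℕ.< q) where

      τ′ : Carrier
      τ′ = traceOf a′ b′ l′

      traceOf-cong : ∀ {a b l a₁ b₁ l₁} → a ≈ a₁ → b ≈ b₁ → l ≈ l₁ → traceOf a b l ≈ traceOf a₁ b₁ l₁
      traceOf-cong ea eb el = Tr-cong (*-cong (*-cong ea (⁻¹-cong el)) (*-cong eb (⁻¹-cong el)))

      ≢o⇒base≢o : ∀ {x} → x ≢ E.o → bit x ≡ 0F → base x ≢ V.o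
      ≢o⇒base≢o x≢o bit≡ base≡ = x≢o (index-≡ (≡.trans bit≡ (≡.sym (bit-⟦⟧ 0F V.o))) (≡.trans base≡ (≡.sym (base-⟦⟧ 0F V.o))))

                                                                                   
      -- The deviation from 1 is thereby exhibited as a homomorphism to GF(2), which a suitable line
      -- can realise as its φ.
      τ-extension : ∀ x → x ≢ E.o → E.τ x ≈ 1# + bit x · (1# + τ′)
      τ-extension x x≢o = go (bit x) (base x) (≢o⇒base≢o x≢o)
        where
        go : ∀ e i → (e ≡ 0F → i ≢ V.o) →
          traceOf (V.a i + e · a′) (V.b i + e · b′) (V.l i + e · l′) ≈ 1# + e · (1# + τ′)
        go 0F i i≢o = trans (traceOf-cong (+-identityʳ _) (+-identityʳ _) (+-identityʳ _))
          (trans (traces i (i≢o ≡.refl)) (sym (+-identityʳ 1#)))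
        go 1F i _ = trans (coset (toSum (i Fin.≟ V.o))) (solve 1 (λ t → t := con true :+ (con true :+ t)) refl τ′)
          where
          coset : i ≡ V.o ⊎ i ≢ V.o → traceOf (V.a i + a′) (V.b i + b′) (V.l i + l′) ≈ τ′
          coset (inj₁ ≡.refl) = traceOf-cong (0+ V.a-o) (0+ V.b-o) (0+ V.l-o)
            where
            0+ : ∀ {x y} → x ≈ 0# → x + y ≈ y
            0+ e = trans (+-congʳ e) (+-identityˡ _)
          coset (inj₂ i≢o) = disjoint⇒traceOf-sum Trθ≈1 (V.l≉0 i≢o) l′≉0 (disjoint i i≢o) (traces i i≢o)

      -- A root s would put the point (s, 1, 0) on a conic of the new coset. These are d quadratics
      -- with nonzero linear term, and 2d < q leaves a value that is no root.
      direction : ∃ λ s → ∀ i → ¬ (V.a i + a′) * (s * s) + (V.l i + l′) * s + (V.b i + b′) ≈ 0#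
      direction = avoidRoots (λ i → V.a i + a′) (λ i → V.l i + l′) (λ i → V.b i + b′)
        (λ i e → l≉l′ i (x+y≈0⇒x≈y e)) 2d<q

      s : Carrier
      s = proj₁ direction

      -- The old conics miss the whole line z = 0, whose slopes 0, 0 give φ = 0; the new coset is
      -- avoided by the choice of s.
      ψ≉0 : ∀ x → x ≢ E.o → ¬ E.ψ x s 1# 0# ≈ 0#
      ψ≉0 x x≢o = go (bit x) (base x) (≢o⇒base≢o x≢o)
        where
        go : ∀ e i → (e ≡ 0F → i ≢ V.o) →
          ¬ Ψ (V.a i + e · a′) (V.b i + e · b′) (V.l i + e · l′) s 1# 0# ≈ 0#
        go 0F i i≢o e = 0≉1 (trans (sym (trans (Tr-cong (solve 3 (λ a b l →
            a :* (con false :* con false) :+ b :* (con false :* con false) :+ l :* (con false :* con false) := con false)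
            refl (V.a i) (V.b i) (V.l i))) Tr-0))
          (meets⇒φ≈1 V traces (i≢o ≡.refl) {0#} {0#} (λ (_ , e) → 1≉0 e)
            (sym (0+0≈0 (zeroˡ s) (zeroˡ 1#)))
            (trans (Ψ-cong (sym (+-identityʳ _)) (sym (+-identityʳ _)) (sym (+-identityʳ _)) refl refl refl) e)))
        go 1F i _ e = proj₂ direction i (trans (solve 4 (λ a b l s → a :* (s :* s) :+ l :* s :+ b
          := a :* (s :* s) :+ l :* (s :* con true) :+ b :* (con true :* con true) :+ l :* l :* (con false :* con false))
          refl (V.a i + a′) (V.b i + b′) (V.l i + l′) s) e)

      ·-bit : ∀ e {x} → Bit x → Bit (e · x)
      ·-bit 0F _ = inj₁ refl
      ·-bit 1F x-bit = x-bit

                                                                                  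
                
      -- The prescribed φ is exactly the deviation in `τ-extension`, so shearing along this line
      -- brings every trace to 1.
      slopes : ∃₂ λ u v → 0# ≈ u * s + v * 1# × ∀ x → E.φ u v x ≈ bit x · (1# + τ′)
      slopes = lineThrough Trθ≈1 extension (λ (_ , e) → 1≉0 e) ψ≉0 (λ x → bit x · (1# + τ′))
        (λ x → ·-bit (bit x) (bit-+ (inj₂ refl) (Tr-bit _)))
        (reflexive (≡.cong (_· (1# + τ′)) (bit-⟦⟧ 0F V.o)))
        (λ x y → trans (reflexive (≡.cong (_· (1# + τ′)) (bit-⟦⟧ (xor (bit x) (bit y)) (base x ⊞ base y))))
          (·-xor (bit x) (bit y) _))

      u v : Carrier
      u = proj₁ slopes
      v = proj₁ (proj₂ slopes)

      sheared : Pencil (2 ℕ.* d)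
      sheared = Shear.shearPencil u v extension

      sheared-traces : Traces sheared
      sheared-traces x x≢o = begin
        Pencil.τ sheared x                 ≈⟨ Shear.traceOf-shear u v (E.a x) (E.b x) (E.l x) (E.l≉0 x≢o) ⟩
        E.τ x + E.φ u v x                  ≈⟨ +-cong (τ-extension x x≢o) (proj₂ (proj₂ (proj₂ slopes)) x) ⟩
        1# + t + t                         ≈⟨ solve 1 (λ t → con true :+ t :+ t := con true) refl t ⟩
        1#                                 ∎
        where t = bit x · (1# + τ′)

-- External lines, and existence and uniqueness of the extended arc.

module Containment {h : ℕ} {c ℓ : Level} (F : GaloisField₂ h c ℓ) where

  open FiniteField F
  open TraceForm F
  open Plane F
  open Pencils F
  open MathonArcs F
  open Coordinates F
  open Nuclei F
  open Extensions F
  open ≈-Reasoning setoid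
  open Char2Solver using (solve; _:=_; _:+_; _:*_; con)

  F₀∉⇒ : ∀ L → F₀ ∉ on L → ¬ coords L 2F ≈ 0#
  F₀∉⇒ L F₀∉L e = F₀∉L (trans (∙-basis (coords L) 2F) e)

  join : ∀ P Q → P ∼ Q ⊎ ∃ λ L → P ∈ on L × Q ∈ on L
  join P Q with Fin.all? (λ i → cross (coords P) (coords Q) i ≟ 0#)
  ... | yes e = inj₁ (cross≈0⇒∼ P Q e)
  ... | no L≉0 = inj₂ (point (cross (coords P) (coords Q)) L≉0 ,
    solve 6 (λ a b c x y z →
      (b :* z :+ c :* y) :* a :+ ((a :* z :+ c :* x) :* b :+ ((a :* y :+ b :* x) :* c :+ con false)) := con false)
      refl (coords P 0F) (coords P 1F) (coords P 2F) (coords Q 0F) (coords Q 1F) (coords Q 2F) ,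
    solve 6 (λ a b c x y z →
      (b :* z :+ c :* y) :* x :+ ((a :* z :+ c :* x) :* y :+ ((a :* y :+ b :* x) :* z :+ con false)) := con false)
      refl (coords P 0F) (coords P 1F) (coords P 2F) (coords Q 0F) (coords Q 1F) (coords Q 2F))

                                                            
  -- A point of T missed by S, together with the e points of S, would inject `Fin (suc e)` into
  -- `Fin e`.
  ⊆⇒⊇ : ∀ {p e} {S T : Pred Point p} → (∀ {P Q} → P ∼ Q → P ∈ S → Q ∈ S) →
    HasCardinality S e → HasCardinality T e → S ⊆ T → T ⊆ S
  ⊆⇒⊇ {e = e} {S} {T} resp S-card T-card S⊆T {P} P∈T =
    Sum.[ hit , (λ ¬hit → ⊥-elim (ℕ.<-irrefl ≡.refl (Fin.injective⇒≤ (f-injective ¬hit)))) ]′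
      (toSum (Fin.any? (λ i → g i Fin.≟ j)))
    where
    module S = Inverse S-card
    module T = Inverse T-card
    incl : ∃ S → ∃ T
    incl (Q , Q∈S) = Q , S⊆T {Q} Q∈S
    j : Fin e
    j = T.from (P , P∈T)
    g : Fin e → Fin e
    g i = T.from (incl (S.to i))
    ∼-from : ∀ x y → T.from x ≡ T.from y → proj₁ x ∼ proj₁ y
    ∼-from x y p = transP (proj₁ x) (proj₁ (T.to (T.from x))) (proj₁ y)
      (symP (proj₁ (T.to (T.from x))) (proj₁ x) (T.strictlyInverseˡ x))
      (≡.subst (λ k → proj₁ (T.to k) ∼ proj₁ y) (≡.sym p) (T.strictlyInverseˡ y))
    hit : (∃ λ i → g i ≡ j) → P ∈ S
    hit (i , p) = resp {proj₁ (S.to i)} {P} (∼-from (incl (S.to i)) (P , P∈T) p) (proj₂ (S.to i))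
    f : Fin (suc e) → Fin e
    f zero = j
    f (suc i) = g i
    f-injective : ¬ (∃ λ i → g i ≡ j) → ∀ {x y} → f x ≡ f y → x ≡ y
    f-injective ¬hit {zero} {zero} p = ≡.refl
    f-injective ¬hit {zero} {suc y} p = ⊥-elim (¬hit (y , ≡.sym p))
    f-injective ¬hit {suc x} {zero} p = ⊥-elim (¬hit (x , p))
    f-injective ¬hit {suc x} {suc y} p = ≡.cong suc (≡.trans (≡.sym (S.strictlyInverseʳ x))
      (≡.trans (S.from-cong {S.to x} {S.to y} (∼-from (incl (S.to x)) (incl (S.to y)) p)) (S.strictlyInverseʳ y)))

                                                                                 
                      
  -- The line joining a point of T to a fixed point of S meets both arcs, hence both in e points, so
  -- the two intersections coincide.
  maximalArc-⊆⇒⊇ : ∀ {e S T} → IsMaximalArc e S → IsMaximalArc e T → S ⊆ T → T ⊆ S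
  maximalArc-⊆⇒⊇ {e} {S} {T} S-arc T-arc S⊆T {P} P∈T = Sum.[ (λ Q∼P → S-arc.respects {Q} {P} Q∼P Q∈S) , onJoin ]′ (join Q P)
    where
    module S-arc = IsMaximalArc S-arc
    module T-arc = IsMaximalArc T-arc
    Q = proj₁ S-arc.nonempty
    Q∈S = proj₂ S-arc.nonempty
    card : ∀ {U : PointSet} L {R} → R ∈ U ∩ on L → Empty (U ∩ on L) ⊎ HasCardinality (U ∩ on L) e → HasCardinality (U ∩ on L) e
    card L {R} R∈ (inj₁ empty) = ⊥-elim (empty R R∈)
    card L R∈ (inj₂ k) = k
    onJoin : (∃ λ L → Q ∈ on L × P ∈ on L) → P ∈ S
    onJoin (L , Q∈L , P∈L) = proj₁ (⊆⇒⊇ {S = S ∩ on L} {T = T ∩ on L}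
      (λ {P} {R} p (P∈S , P∈L) → S-arc.respects {P} {R} p P∈S , on-resp L P R p P∈L)
      (card {S} L {Q} (Q∈S , Q∈L) (S-arc.intersections L))
      (card {T} L {P} (P∈T , P∈L) (T-arc.intersections L))
      (λ {R} (R∈S , R∈L) → S⊆T {R} R∈S , R∈L) {P} (P∈T , P∈L))

  module _ {d} (V : Pencil d) where
    open Pencil V

    arc? : ∀ P → Dec (P ∈ arc)
    arc? P = Fin.any? (λ i → ¬? (i Fin.≟ o) ×-dec (ψ i (coords P 0F) (coords P 1F) (coords P 2F) ≟ 0#))
      ⊎-dec map′ (λ (x≈0 , y≈0) → ∼F₀ P x≈0 y≈0) (λ (k , _ , e) → trans (e 0F) (zeroʳ k) , trans (e 1F) (zeroʳ k))
              ((coords P 0F ≟ 0#) ×-dec (coords P 1F ≟ 0#))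

    -- The zero homomorphism is realised as φ by some line through P, and such a line misses every
    -- conic and `F₀`.
    externalLine : ∀ {θ} → Tr θ ≈ 1# → Traces V → ∀ P → P ∉ arc → ∃ λ L → P ∈ on L × (∀ Q → Q ∈ arc → Q ∉ on L)
    externalLine Trθ≈1 traces P P∉arc = L , on⇐ P z≈ , λ Q Q∈arc Q∈L → external V traces φ≈0 Q Q∈arc (on⇒ Q Q∈L)
      where
      line = lineThrough Trθ≈1 V {coords P 0F} {coords P 1F} {coords P 2F}
        (λ (x≈0 , y≈0) → P∉arc (inj₂ (∼F₀ P x≈0 y≈0))) (λ i i≢o e → P∉arc (inj₁ (i , i≢o , e)))
        (λ _ → 0#) (λ _ → inj₁ refl) refl (λ _ _ → sym (+-identityˡ 0#))
      u = proj₁ line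
      v = proj₁ (proj₂ line)
      z≈ : coords P 2F ≈ u * coords P 0F + v * coords P 1F
      z≈ = proj₁ (proj₂ (proj₂ line))
      φ≈0 : ∀ i → φ u v i ≈ 0#
      φ≈0 = proj₂ (proj₂ (proj₂ line))
      L : Line
      L = point (u ∷ v ∷ 1# ∷ []) λ e → 1≉0 (e 2F)
      on-L : ∀ Q → coords L ∙ coords Q ≈ coords Q 2F + (u * coords Q 0F + v * coords Q 1F)
      on-L Q = solve 5 (λ u v x y z → u :* x :+ (v :* y :+ (con true :* z :+ con false)) := z :+ (u :* x :+ v :* y)) refl
        u v (coords Q 0F) (coords Q 1F) (coords Q 2F)
      on⇒ : ∀ Q → Q ∈ on L → coords Q 2F ≈ u * coords Q 0F + v * coords Q 1F
      on⇒ Q e = x+y≈0⇒x≈y (trans (sym (on-L Q)) e)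
      on⇐ : ∀ Q → coords Q 2F ≈ u * coords Q 0F + v * coords Q 1F → Q ∈ on L
      on⇐ Q e = trans (on-L Q) (x≈y⇒x+y≈0 e)

  module _ {d} (V : Pencil d) (traces : Traces V) {θ} (Trθ≈1 : Tr θ ≈ 1#) where
    open Pencil V

    -- Were φ equal to 1, the line would be a secant. This turns missing M and C into the vanishing
    -- of φ on generators.
    misses⇒φ≈0 : ∀ L (L₂≉0 : ¬ coords L 2F ≈ 0#) i → (i ≢ o → ∀ P → P ∈ conic i → P ∉ on L) →
      φ (Slopes.u L L₂≉0) (Slopes.v L L₂≉0) i ≈ 0#
    misses⇒φ≈0 L L₂≉0 i misses = bit-≉1 (Tr-bit _) λ φi≈1 →
      let i≢o = φ≈1⇒≢o φi≈1
          S = secant Trθ≈1 (a i) (b i) (l i) u v (l≉0 i≢o) (trans (+-cong (traces i i≢o) φi≈1) 1+1≈0)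
      in misses i≢o (Secant.P₁ S) (Secant.conic₁ S) (on⇐ (Secant.P₁ S) (Secant.on-line₁ S))
      where open Slopes L L₂≉0

  mathonArc? : ∀ {d M} → IsMathonArc d M → ∀ P → Dec (P ∈ M)
  mathonArc? mathon P = map′ (arc⊆M P) (M⊆arc P) (arc? pencil (transform coordinates P))
    where open OfMathonArc mathon

  mathonArc-externalLine : ∀ {θ} → Tr θ ≈ 1# → ∀ {d M} → IsMathonArc d M → ∀ P → P ∉ M →
    ∃ λ L → P ∈ on L × (∀ Q → Q ∈ M → Q ∉ on L)
  mathonArc-externalLine Trθ≈1 mathon P P∉M = L , on-L⇐ P (proj₁ (proj₂ line)) ,
    λ Q Q∈M Q∈L → proj₂ (proj₂ line) (transform A Q) (M⊆arc Q Q∈M) (on-L⇒ Q Q∈L)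
    where
    open OfMathonArc mathon
    A = coordinates
    line = externalLine pencil Trθ≈1 traces (transform A P) (P∉M ∘ arc⊆M P)
    L : Line
    L = image (inv A) (proj₁ line)
    back : ∀ Q → transform (inv A) (transform A Q) ∼ Q
    back = inv-transform A
    on-L⇒ : ∀ Q → Q ∈ on L → transform A Q ∈ on (proj₁ line)
    on-L⇒ Q Q∈L = image⇒on (inv A) (proj₁ line) (transform A Q)
      (on-resp L Q (transform (inv A) (transform A Q)) (symP (transform (inv A) (transform A Q)) Q (back Q)) Q∈L)
    on-L⇐ : ∀ Q → transform A Q ∈ on (proj₁ line) → Q ∈ on L
    on-L⇐ Q AQ∈ = on-resp L (transform (inv A) (transform A Q)) Q (back Q)
      (on⇒image (inv A) (proj₁ line) (transform A Q) AQ∈)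

  module Main {d M} (mathon : IsMathonArc d M) (2d<q : 2 ℕ.* d ℕ.< q)
    (n : Point) (n-nucleus : ∀ i → IsNucleus n (IsMathonArc.conic mathon i))
    (C : PointSet) (C-conic : IsConic C) (n-nucleusC : IsNucleus n C) (C⊥M : C ⊥ M) where

    open OfMathonArc mathon

    A : Invertible
    A = coordinates

    module V = Pencil pencil

    some : ∀ k → .(ℕ.NonZero k) → Fin k
    some (suc k) _ = zero

    i₀ : Fin size
    i₀ = some size size-nonZero

    -- The product αβ of some conic of M serves as the element of trace 1 that the Artin-Schreier
    -- and duality arguments require.
    θ : Carrier
    θ = V.a (suc i₀) * V.l (suc i₀) ⁻¹ * (V.b (suc i₀) * V.l (suc i₀) ⁻¹)

    Trθ≈1 : Tr θ ≈ 1#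
    Trθ≈1 = traces (suc i₀) λ ()

    2d<q′ : 2 ℕ.* suc size ℕ.< q
    2d<q′ = ≡.subst (λ d → 2 ℕ.* d ℕ.< q) degree 2d<q

    equation = sameNucleus⇒Ψ A (ClosedSet.member closedSet i₀) (ClosedSet.lam≉0 closedSet i₀)
      n (n-nucleus i₀) C C-conic n-nucleusC

    a′ b′ l′ : Carrier
    a′ = proj₁ equation
    b′ = proj₁ (proj₂ equation)
    l′ = proj₁ (proj₂ (proj₂ equation))

    l′≉0 : ¬ l′ ≈ 0#
    l′≉0 = proj₁ (proj₂ (proj₂ (proj₂ equation)))

    C≐Ψ : C ≐ (λ P → let P′ = coords (transform A P) in Ψ a′ b′ l′ (P′ 0F) (P′ 1F) (P′ 2F) ≈ 0#)
    C≐Ψ = proj₂ (proj₂ (proj₂ (proj₂ equation)))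

    disjoint-C : ∀ i → i ≢ V.o → Disjoint (V.a i) (V.b i) (V.l i) a′ b′ l′
    disjoint-C i i≢o x y z xy≉0 e e′ = C⊥M {P}
      (proj₂ C≐Ψ {P} (trans (Ψ-cong refl refl refl (AP≋ 0F) (AP≋ 1F) (AP≋ 2F)) e′) ,
       arc⊆M P (inj₁ (i , i≢o , trans (Ψ-cong refl refl refl (AP≋ 0F) (AP≋ 1F) (AP≋ 2F)) e)))
      where
      P′ : Point
      P′ = point (x ∷ y ∷ z ∷ []) λ e → xy≉0 (e 0F , e 1F)
      P : Point
      P = transform (inv A) P′
      AP≋ : ∀ i → coords (transform A P) i ≈ coords P′ i
      AP≋ = inverseᵣ A (coords P′)

    l≉l′ : ∀ i → ¬ V.l i ≈ l′
    l≉l′ i = go (i Fin.≟ V.o)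
      where
      go : Dec (i ≡ V.o) → ¬ V.l i ≈ l′
      go (yes ≡.refl) e = l′≉0 (trans (sym e) V.l-o)
      go (no i≢o) = disjoint⇒l≉ (V.l≉0 i≢o) (disjoint-C i i≢o)

    open Extension pencil a′ b′ l′ l≉l′
    open Traced Trθ≈1 traces l′≉0 disjoint-C 2d<q′ using (u; v; sheared; sheared-traces)

    module W = Pencil sheared

    B : Invertible
    B = Shear.shear u v A

    N : PointSet
    N = transform B ⊢ W.arc

    N-mathon : IsMathonArc (2 ℕ.* suc size) N
    N-mathon = ToClosedSet.isMathonArc sheared sheared-traces B
      -- The number of conics of N is one less than its degree, that is `size + suc (size + 0)`,
      -- which is positive; and 2d < q excludes the affine plane.
      (ℕ.>-nonZero (ℕ.≤-trans ℕ.z<s (ℕ.m≤n+m (suc (size ℕ.+ 0)) size))) (ℕ.<⇒≢ 2d<q′)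

    ψ-⟦⟧ : ∀ e i P → (let w = coords (transform B P); w′ = coords (transform A P)) →
      W.ψ ⟦ e , i ⟧ (w 0F) (w 1F) (w 2F) ≈
      Ψ (V.a i + e · a′) (V.b i + e · b′) (V.l i + e · l′) (w′ 0F) (w′ 1F) (w′ 2F)
    ψ-⟦⟧ e i P = trans (Shear.ψ-shear u v extension A ⟦ e , i ⟧ P)
      (Ψ-cong (reflexive (adjoin-⟦⟧ V.a a′ e i)) (reflexive (adjoin-⟦⟧ V.b b′ e i))
        (reflexive (adjoin-⟦⟧ V.l l′ e i)) refl refl refl)

    ψ-old : ∀ i P → (let w = coords (transform B P); w′ = coords (transform A P)) →
      W.ψ ⟦ 0F , i ⟧ (w 0F) (w 1F) (w 2F) ≈ V.ψ i (w′ 0F) (w′ 1F) (w′ 2F)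
    ψ-old i P = trans (ψ-⟦⟧ 0F i P) (Ψ-cong (+-identityʳ _) (+-identityʳ _) (+-identityʳ _) refl refl refl)

    ψ-new : ∀ P → (let w = coords (transform B P); w′ = coords (transform A P)) →
      W.ψ ⟦ 1F , V.o ⟧ (w 0F) (w 1F) (w 2F) ≈ Ψ a′ b′ l′ (w′ 0F) (w′ 1F) (w′ 2F)
    ψ-new P = trans (ψ-⟦⟧ 1F V.o P) (Ψ-cong (trans (+-congʳ V.a-o) (+-identityˡ _)) (trans (+-congʳ V.b-o) (+-identityˡ _))
      (trans (+-congʳ V.l-o) (+-identityˡ _)) refl refl refl)

    1F≢0F : ∀ {i} → ⟦ 1F , i ⟧ ≢ W.o
    1F≢0F {i} e = 1F≢0F′ (≡.trans (≡.sym (bit-⟦⟧ 1F i)) (≡.trans (≡.cong bit e) (bit-⟦⟧ 0F V.o)))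
      where
      1F≢0F′ : ¬ _≡_ {A = Fin 2} 1F 0F
      1F≢0F′ ()

    old≢o : ∀ {i} → i ≢ V.o → ⟦ 0F , i ⟧ ≢ W.o
    old≢o {i} i≢o e = i≢o (≡.trans (≡.sym (base-⟦⟧ 0F i)) (≡.trans (≡.cong base e) (base-⟦⟧ 0F V.o)))

    M∪C⊆N : (M ∪ C) ⊆ N
    M∪C⊆N {P} (inj₁ P∈M) = old (M⊆arc P P∈M)
      where
      old : transform A P ∈ V.arc → P ∈ N
      old (inj₁ (i , i≢o , e)) = inj₁ (⟦ 0F , i ⟧ , old≢o i≢o , trans (ψ-old i P) e)
      old (inj₂ (k , k≉0 , e)) = inj₂ (∼F₀ (transform B P) (trans (e 0F) (zeroʳ k)) (trans (e 1F) (zeroʳ k)))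
    M∪C⊆N {P} (inj₂ P∈C) = inj₁ (⟦ 1F , V.o ⟧ , 1F≢0F , trans (ψ-new P) (proj₁ C≐Ψ {P} P∈C))

    -- A line missing M and C misses N as well: in the coordinates of N its φ vanishes on the old
    -- indices and on the index of C, and these generate the group.
    module Unique (L : Line) (misses : ∀ P → P ∈ M ∪ C → P ∉ on L) where

      L′ : Line
      L′ = image B L

      missesB : ∀ Q → (∀ P → transform B P ∼ Q → P ∈ M ∪ C) → Q ∉ on L′
      missesB Q P∈ Q∈L′ = misses P (P∈ P BP∼Q) (image⇒on B L P (on-resp L′ Q (transform B P) (symP (transform B P) Q BP∼Q) Q∈L′))
        where
        P : Point
        P = transform (inv B) Q
        BP∼Q : transform B P ∼ Q
        BP∼Q = transform-inv B Q

      L′₂≉0 : ¬ coords L′ 2F ≈ 0#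
      L′₂≉0 = F₀∉⇒ L′ (missesB F₀ λ P (k , k≉0 , e) →
        inj₁ (arc⊆M P (inj₂ (∼F₀ (transform A P) (trans (e 0F) (zeroʳ k)) (trans (e 1F) (zeroʳ k))))))

      open Slopes L′ L′₂≉0 using (on⇒) renaming (u to u′; v to v′)

      φ-old : ∀ i → W.φ u′ v′ ⟦ 0F , i ⟧ ≈ 0#
      φ-old i = misses⇒φ≈0 sheared sheared-traces Trθ≈1 L′ L′₂≉0 ⟦ 0F , i ⟧ λ x≢o Q e → missesB Q λ P BP∼Q →
        inj₁ (arc⊆M P (inj₁ (i , (λ { ≡.refl → x≢o ≡.refl }) ,
          trans (sym (ψ-old i P)) (W.conic-resp ⟦ 0F , i ⟧ Q (transform B P) (symP (transform B P) Q BP∼Q) e))))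

      φ-new : W.φ u′ v′ ⟦ 1F , V.o ⟧ ≈ 0#
      φ-new = misses⇒φ≈0 sheared sheared-traces Trθ≈1 L′ L′₂≉0 ⟦ 1F , V.o ⟧ λ x≢o Q e → missesB Q λ P BP∼Q →
        inj₂ (proj₂ C≐Ψ {P} (trans (sym (ψ-new P))
          (W.conic-resp ⟦ 1F , V.o ⟧ Q (transform B P) (symP (transform B P) Q BP∼Q) e)))

      φ-bit : ∀ e x → bit x ≡ e → W.φ u′ v′ x ≈ 0#
      φ-bit 0F x p = ≡.subst (λ x → W.φ u′ v′ x ≈ 0#)
        (index-≡ {⟦ 0F , base x ⟧} {x} (≡.trans (bit-⟦⟧ 0F (base x)) (≡.sym p)) (base-⟦⟧ 0F (base x))) (φ-old (base x))
      -- Adding the index of C, where φ is 0, moves x into the old half.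
      φ-bit 1F x p = begin
        W.φ u′ v′ x                                   ≈⟨ +-identityʳ _ ⟨
        W.φ u′ v′ x + 0#                              ≈⟨ +-congˡ φ-new ⟨
        W.φ u′ v′ x + W.φ u′ v′ ⟦ 1F , V.o ⟧          ≈⟨ W.φ-⊞ u′ v′ x ⟦ 1F , V.o ⟧ ⟨
        W.φ u′ v′ (x W.⊞ ⟦ 1F , V.o ⟧)
          ≈⟨ φ-bit 0F (x W.⊞ ⟦ 1F , V.o ⟧) (≡.trans (bit-⟦⟧ _ _) (≡.cong₂ xor p (bit-⟦⟧ 1F V.o))) ⟩
        0#                                            ∎

      missesN : ∀ P → P ∈ N → P ∉ on L
      missesN P P∈N P∈L = external sheared sheared-traces (λ x → φ-bit (bit x) x ≡.refl) (transform B P) P∈N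
        (on⇒ (transform B P) (on⇒image B L P P∈L))

    -- A point of N off N′ would lie on a line external to N′, hence missing M and C, hence missing
    -- N. Membership in a Mathon arc is decidable, so the contradiction suffices.
    N⊆ : ∀ {N′} → IsMathonArc (2 ℕ.* d) N′ → (M ∪ C) ⊆ N′ → N ⊆ N′
    N⊆ {N′} mathon′ M∪C⊆N′ {P} P∈N = decidable-stable (mathonArc? mathon′ P) λ P∉N′ →
      let L , P∈L , L-external = mathonArc-externalLine Trθ≈1 mathon′ P P∉N′
      in Unique.missesN L (λ Q Q∈ → L-external Q (M∪C⊆N′ {Q} Q∈)) P P∈N P∈L

    mathon-N : IsMathonArc (2 ℕ.* d) N
    mathon-N = ≡.subst (λ d → IsMathonArc (2 ℕ.* d) N) (≡.sym degree) N-mathon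

    existsUnique : ∃! _≐_ (λ N → IsMathonArc (2 ℕ.* d) N × (M ∪ C) ⊆ N)
    existsUnique = N , (mathon-N , λ {P} → M∪C⊆N {P}) , λ {N′} (mathon′ , M∪C⊆N′) →
      let N⊆N′ = λ {P} → N⊆ mathon′ M∪C⊆N′ {P}
      in N⊆N′ , λ {P} → maximalArc-⊆⇒⊇ (IsMathonArc.isMaximalArc mathon-N) (IsMathonArc.isMaximalArc mathon′) N⊆N′ {P}

open import Data.Nat.Base using (_*_; _<_)

theorem2 : ∀ {h c ℓ} (F : GaloisField₂ h c ℓ) → let open Plane F in
    (d : ℕ) (M : PointSet) (mathon : IsMathonArc d M) →
    2 * d < q →
    (n : Point) → (∀ i → IsNucleus n (IsMathonArc.conic mathon i)) →
    (C : PointSet) → IsConic C → IsNucleus n C → C ⊥ M →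
    ∃! _≐_ (λ N → IsMathonArc (2 * d) N × (M ∪ C) ⊆ N)
theorem2 F d M mathon 2d<q n n-nucleus C C-conic n-nucleusC C⊥M = existsUnique
  where open Containment.Main F mathon 2d<q n n-nucleus C C-conic n-nucleusC C⊥M
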